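{- If $G$ is a connected graph on $n$ vertices, then $$\mathrm{th}_c(G)\leq \frac{(2+o(1))\,n\sqrt{W(\log(n))}}{\sqrt{\log(n)}}.$$ That is, there is a function $\varepsilon:\mathbb{N}\to\mathbb{R}$ with $\varepsilon(n)\to 0$ as $n\to\infty$ such that for every integer $n\ge 2$ and every connected graph $G$ on $n$ vertices, $\mathrm{th}_c(G)\le (2+\varepsilon(n))\,n\sqrt{W(\log n)}/\sqrt{\log n}$.
   Context: All graphs are finite, undirected and connected. All logarithms are base $e$. Asymptotics are as $n=|V(G)|\to\infty$; the $o(1)$ term depends only on $n$. $W$ is the Lambert W function: the inverse of $x\mapsto xe^x$ restricted to $x\ge 0$. Cops and Robbers: The game is played on a graph $G$ by two players, one controlling a set of cops and the other a single robber; all pieces occupy vertices of $G$ (several cops may share a vertex). First the cops choose their initial vertices, then the robber chooses an initial vertex. Then play proceeds in rounds; a round consists of a move by the cops followed by a move by the robber. On a player's turn each of that player's pieces may move to a neighboring vertex or stay put. Both players have perfect information. The cops win if after finitely many rounds some cop occupies the same vertex as the robber (capture); otherwise the robber wins. The cop number $c(G)$ is the minimum number of cops that suffices for the cops to have a winning strategy on $G$. For an integer $k\ge c(G)$, the $k$-capture time $\mathrm{capt}_k(G)$ is the minimum number of rounds it takes $k$ cops to capture the robber on $G$ under optimal play (the cops minimize the length of the game, the robber maximizes it). For $k<c(G)$, set $\mathrm{capt}_k(G)=\infty$. The cop throttling number is $\mathrm{th}_c(G)=\min_k\{k+\mathrm{capt}_k(G)\}$, the minimum over positive integers $k$. -}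

module Defs where

open import Data.Empty using (⊥; ⊥-elim)
open import Data.Fin.Base using (Fin; toℕ; fromℕ<)
open import Data.Fin.Properties as Fin using (any?; all?; toℕ<n; toℕ-fromℕ<)
open import Data.Integer.Base as ℤ using (+_)
import Data.Integer.Properties as ℤP
open import Data.Nat.Base as ℕ using (ℕ; zero; suc)
import Data.Nat.Properties as ℕP
open import Data.Product.Base using (∃; _×_; _,_; proj₁; proj₂)
open import Data.Rational.Base
  using (ℚ; mkℚ; 0ℚ; 1ℚ; ½; toℚᵘ; _≤_; _<_; _+_; _-_; -_; _*_; _/_; 1/_; _⊓_; ∣_∣; Positive; positive; nonNegative)
open import Data.Rational.Properties
import Data.Rational.Unnormalised.Base as ℚᵘ
import Data.Rational.Unnormalised.Properties as ℚᵘP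
open import Data.Sum.Base using (_⊎_; inj₁; inj₂)
open import Data.Vec.Base using (Vec; []; _∷_; lookup; allFin)
open import Data.Vec.Properties using (lookup-allFin)
open import Relation.Binary.Construct.Closure.ReflexiveTransitive using (Star)
import Relation.Binary.Definitions as Binary
open import Relation.Binary.PropositionalEquality
open import Relation.Nullary using (¬_; Dec; yes; no; contradiction; _×-dec_; _⊎-dec_; _→-dec_)
open import Relation.Nullary.Decidable using (dec⇒maybe; map′)
open import Relation.Unary using (Decidable)
open import Tactic.RingSolver using (solve-∀)
open import Tactic.RingSolver.Core.AlmostCommutativeRing
  using (AlmostCommutativeRing; fromCommutativeRing)

ℚ-ring : AlmostCommutativeRing _ _
ℚ-ring = fromCommutativeRing +-*-commutativeRing (λ p → dec⇒maybe (0ℚ ≟ p))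

abstract
  diff : ∀ {p q} → p ≤ q → 0ℚ ≤ q - p
  diff {p} {q} h = subst (_≤ q - p) (+-inverseʳ p) (+-monoˡ-≤ (- p) h)

  infixl 5 _⊞_
  _⊞_ : ∀ {p q} → 0ℚ ≤ p → 0ℚ ≤ q → 0ℚ ≤ p + q
  _⊞_ = +-mono-≤

  infixl 6 _⊠_
  _⊠_ : ∀ {p q} → 0ℚ ≤ p → 0ℚ ≤ q → 0ℚ ≤ p * q
  _⊠_ {p} {q} hp hq = subst (_≤ p * q) (*-zeroʳ p) (*-monoˡ-≤-nonNeg p {{nonNegative hp}} hq)

  ≤-by : ∀ {p q c} → 0ℚ ≤ c → p + c ≡ q → p ≤ q
  ≤-by {p} {q} {c} h e = ≤-trans (subst (_≤ p + c) (+-identityʳ p) (+-monoʳ-≤ p h)) (≤-reflexive e)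

  *-pos : ∀ {p q} → 0ℚ < p → 0ℚ < q → 0ℚ < p * q
  *-pos {p} {q} hp hq = positive⁻¹ (p * q) {{pos*pos⇒pos p {{positive hp}} q {{positive hq}}}}

  +-pos : ∀ {p q} → 0ℚ < p → 0ℚ < q → 0ℚ < p + q
  +-pos = +-mono-<

  0<1 : 0ℚ < 1ℚ
  0<1 = positive⁻¹ 1ℚ

  0≤1 : 0ℚ ≤ 1ℚ
  0≤1 = <⇒≤ 0<1

  halve : ∀ {p} → 0ℚ < p → ∃ λ q → 0ℚ < q × q + q ≡ p
  halve {p} h = ½ * p , *-pos (positive⁻¹ ½) h ,
    trans (sym (*-distribʳ-+ p ½ ½)) (*-identityˡ p)

  quarter : ∀ {p} → 0ℚ < p → ∃ λ q → 0ℚ < q × (q + q) + (q + q) ≡ p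
  quarter h with halve h
  ... | q , q>0 , refl with halve q>0
  ... | r , r>0 , refl = r , r>0 , refl

  invert : ∀ {p} → 0ℚ < p → ∃ λ q → 0ℚ < q × p * q ≡ 1ℚ
  invert {p} h = q , positive⁻¹ q {{1/pos⇒pos p {{p>0}}}} , *-inverseʳ p {{pos⇒nonZero p {{p>0}}}}
    where
    p>0 : Positive p
    p>0 = positive h
    q : ℚ
    q = (1/ p) {{pos⇒nonZero p {{p>0}}}}

  shrink : ∀ {p δ} → 0ℚ < p → 0ℚ < δ → ∃ λ η → 0ℚ < η × p * η ≡ δ
  shrink {p} {δ} hp hδ with invert hp
  ... | r , r>0 , e = r * δ , *-pos r>0 hδ , trans (sym (*-assoc p r δ)) (trans (cong (_* δ) e) (*-identityˡ δ))

  p≤∣p∣ : ∀ p → p ≤ ∣ p ∣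
  p≤∣p∣ p with ≤-total 0ℚ p
  ... | inj₁ h = ≤-reflexive (sym (0≤p⇒∣p∣≡p h))
  ... | inj₂ h = ≤-trans h (0≤∣p∣ p)

  -p≤∣p∣ : ∀ p → - p ≤ ∣ p ∣
  -p≤∣p∣ p = subst (- p ≤_) (∣-p∣≡∣p∣ p) (p≤∣p∣ (- p))

  ∣∣≤ : ∀ {p δ} → p ≤ δ → - p ≤ δ → ∣ p ∣ ≤ δ
  ∣∣≤ {p} h₁ h₂ with ∣p∣≡p∨∣p∣≡-p p
  ... | inj₁ e = subst (_≤ _) (sym e) h₁
  ... | inj₂ e = subst (_≤ _) (sym e) h₂

  neg-diff : ∀ p q → - (p - q) ≡ q - p
  neg-diff = solve-∀ ℚ-ring

  ∣-∣-comm : ∀ p q → ∣ p - q ∣ ≡ ∣ q - p ∣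
  ∣-∣-comm p q = trans (sym (∣-p∣≡∣p∣ (p - q))) (cong ∣_∣ (neg-diff p q))

  close : ∀ {p q δ} → p ≤ q + δ → q ≤ p + δ → ∣ p - q ∣ ≤ δ
  close {p} {q} {δ} h₁ h₂ = ∣∣≤
    (≤-by (diff h₁) (lem p q δ))
    (≤-by (diff h₂) (lem′ p q δ))
    where
    lem : ∀ p q δ → (p - q) + ((q + δ) - p) ≡ δ
    lem = solve-∀ ℚ-ring
    lem′ : ∀ p q δ → - (p - q) + ((p + δ) - q) ≡ δ
    lem′ = solve-∀ ℚ-ring

  close⇒≤ : ∀ {p q δ} → ∣ p - q ∣ ≤ δ → p ≤ q + δ
  close⇒≤ {p} {q} {δ} h = ≤-by (diff (≤-trans (p≤∣p∣ (p - q)) h)) (lem p q δ)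
    where
    lem : ∀ p q δ → p + (δ - (p - q)) ≡ q + δ
    lem = solve-∀ ℚ-ring

  close-sym : ∀ {p q δ} → ∣ p - q ∣ ≤ δ → ∣ q - p ∣ ≤ δ
  close-sym {p} {q} h = subst (_≤ _) (∣-∣-comm p q) h

  close-trans : ∀ {p q r δ δ′} → ∣ p - q ∣ ≤ δ → ∣ q - r ∣ ≤ δ′ → ∣ p - r ∣ ≤ δ + δ′
  close-trans {p} {q} {r} h h′ =
    ≤-trans (≤-reflexive (cong ∣_∣ (lem p q r)))
      (≤-trans (∣p+q∣≤∣p∣+∣q∣ (p - q) (q - r)) (+-mono-≤ h h′))
    where
    lem : ∀ p q r → p - r ≡ (p - q) + (q - r)
    lem = solve-∀ ℚ-ring

  ∣p-p∣≤ : ∀ p {δ} → 0ℚ ≤ δ → ∣ p - p ∣ ≤ δ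
  ∣p-p∣≤ p h = subst (λ t → ∣ t ∣ ≤ _) (sym (+-inverseʳ p)) h

  *-mono-≤-nonNeg : ∀ {p p′ q q′} → 0ℚ ≤ p′ → 0ℚ ≤ q → p ≤ p′ → q ≤ q′ → p * q ≤ p′ * q′
  *-mono-≤-nonNeg {p} {p′} {q} {q′} h h′ a b = ≤-by (diff a ⊠ h′ ⊞ h ⊠ diff b) (lem p p′ q q′)
    where
    lem : ∀ p p′ q q′ → p * q + ((p′ - p) * q + p′ * (q′ - q)) ≡ p′ * q′
    lem = solve-∀ ℚ-ring

  ∣*∣≤ : ∀ {p q M N} → ∣ p ∣ ≤ M → ∣ q ∣ ≤ N → ∣ p * q ∣ ≤ M * N
  ∣*∣≤ {p} {q} h h′ = ≤-trans (≤-reflexive (∣p*q∣≡∣p∣*∣q∣ p q))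
    (*-mono-≤-nonNeg (≤-trans (0≤∣p∣ p) h) (0≤∣p∣ q) h h′)

  close-* : ∀ {p p′ q q′ M N δ δ′} → ∣ p ∣ ≤ M → ∣ q′ ∣ ≤ N →
    ∣ p - p′ ∣ ≤ δ → ∣ q - q′ ∣ ≤ δ′ → ∣ p * q - p′ * q′ ∣ ≤ M * δ′ + N * δ
  close-* {p} {p′} {q} {q′} {M} {N} {δ} {δ′} hM hN h h′ =
    ≤-trans (≤-reflexive (cong ∣_∣ (lem p p′ q q′)))
      (≤-trans (∣p+q∣≤∣p∣+∣q∣ (p * (q - q′)) (q′ * (p - p′)))
        (+-mono-≤ (∣*∣≤ hM h′) (∣*∣≤ hN h)))
    where
    lem : ∀ p p′ q q′ → p * q - p′ * q′ ≡ p * (q - q′) + q′ * (p - p′)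
    lem = solve-∀ ℚ-ring

  close-+ : ∀ {p p′ q q′ δ δ′} → ∣ p - p′ ∣ ≤ δ → ∣ q - q′ ∣ ≤ δ′ → ∣ (p + q) - (p′ + q′) ∣ ≤ δ + δ′
  close-+ {p} {p′} {q} {q′} h h′ =
    ≤-trans (≤-reflexive (cong ∣_∣ (lem p p′ q q′)))
      (≤-trans (∣p+q∣≤∣p∣+∣q∣ (p - p′) (q - q′)) (+-mono-≤ h h′))
    where
    lem : ∀ p p′ q q′ → (p + q) - (p′ + q′) ≡ (p - p′) + (q - q′)
    lem = solve-∀ ℚ-ring

ι : ℕ → ℚ
ι n = + n / 1

abstract
  ιᵘ : ∀ n → toℚᵘ (ι n) ℚᵘ.≃ ℚᵘ.mkℚᵘ (+ n) 0
  ιᵘ n = toℚᵘ-fromℚᵘ (ℚᵘ.mkℚᵘ (+ n) 0)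

  ι-suc : ∀ n → ι (suc n) ≡ ι n + 1ℚ
  ι-suc n = toℚᵘ-injective (begin
    toℚᵘ (ι (suc n))                         ≈⟨ ιᵘ (suc n) ⟩
    ℚᵘ.mkℚᵘ (+ suc n) 0                       ≈⟨ ℚᵘ.*≡* (cong (ℤ._* + 1) eq) ⟩
    ℚᵘ.mkℚᵘ (+ n) 0 ℚᵘ.+ ℚᵘ.1ℚᵘ              ≈⟨ ℚᵘP.+-congˡ ℚᵘ.1ℚᵘ (ℚᵘP.≃-sym (ιᵘ n)) ⟩
    toℚᵘ (ι n) ℚᵘ.+ toℚᵘ 1ℚ                  ≈⟨ ℚᵘP.≃-sym (toℚᵘ-homo-+ (ι n) 1ℚ) ⟩
    toℚᵘ (ι n + 1ℚ)                          ∎)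
    where
    open ℚᵘP.≃-Reasoning
    eq : + suc n ≡ + n ℤ.* + 1 ℤ.+ + 1
    eq = trans (cong +_ (ℕP.+-comm 1 n)) (cong (ℤ._+ + 1) (sym (ℤP.*-identityʳ (+ n))))

  0≤ι : ∀ n → 0ℚ ≤ ι n
  0≤ι zero = ≤-refl
  0≤ι (suc n) = subst (0ℚ ≤_) (sym (ι-suc n)) (0≤ι n ⊞ 0≤1)

  0<ι : ∀ n → 0ℚ < ι (suc n)
  0<ι n = subst (0ℚ <_) (sym (ι-suc n)) (+-mono-≤-< (0≤ι n) 0<1)

  ι-mono : ∀ {m n} → m ℕ.≤ n → ι m ≤ ι n
  ι-mono {n = n} ℕ.z≤n = 0≤ι n
  ι-mono {suc m} {suc n} (ℕ.s≤s h) = subst₂ _≤_ (sym (ι-suc m)) (sym (ι-suc n)) (+-monoˡ-≤ 1ℚ (ι-mono h))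

  ι-inv : ∀ n → ι (suc n) * (+ 1 / suc n) ≡ 1ℚ
  ι-inv n = toℚᵘ-injective (begin
    toℚᵘ (ι (suc n) * (+ 1 / suc n))
      ≈⟨ toℚᵘ-homo-* (ι (suc n)) (+ 1 / suc n) ⟩
    toℚᵘ (ι (suc n)) ℚᵘ.* toℚᵘ (+ 1 / suc n)
      ≈⟨ ℚᵘP.*-cong (ιᵘ (suc n)) (toℚᵘ-fromℚᵘ (ℚᵘ.mkℚᵘ (+ 1) n)) ⟩
    ℚᵘ.mkℚᵘ (+ suc n) 0 ℚᵘ.* ℚᵘ.mkℚᵘ (+ 1) n
      ≈⟨ ℚᵘ.*≡* eq ⟩
    toℚᵘ 1ℚ ∎)
    where
    open ℚᵘP.≃-Reasoning
    eq : (+ suc n ℤ.* + 1) ℤ.* + 1 ≡ + 1 ℤ.* + suc (n ℕ.+ 0)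
    eq = trans (ℤP.*-identityʳ (+ suc n ℤ.* + 1)) (trans (ℤP.*-identityʳ (+ suc n))
      (sym (trans (ℤP.*-identityˡ (+ suc (n ℕ.+ 0))) (cong (λ k → + suc k) (ℕP.+-identityʳ n)))))

  0<1/ : ∀ n → 0ℚ < + 1 / suc n
  0<1/ n = positive⁻¹ (+ 1 / suc n) {{normalize-pos 1 (suc n)}}

  archimedes : ∀ p → ∃ λ N → p ≤ ι N
  archimedes p@(mkℚ a d _) = ℤ.∣ a ∣ , toℚᵘ-cancel-≤
    (ℚᵘP.≤-trans (ℚᵘ.*≤* le) (ℚᵘP.≤-reflexive (ℚᵘP.≃-sym (ιᵘ ℤ.∣ a ∣))))
    where
    open ℤP.≤-Reasoning
    le : a ℤ.* + 1 ℤ.≤ + ℤ.∣ a ∣ ℤ.* + suc d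
    le = begin
      a ℤ.* + 1 ≡⟨ ℤP.*-identityʳ a ⟩
      a ≤⟨ i≤∣i∣ a ⟩
      + ℤ.∣ a ∣ ≤⟨ ℤ.+≤+ (ℕP.m≤m*n ℤ.∣ a ∣ (suc d)) ⟩
      + (ℤ.∣ a ∣ ℕ.* suc d) ≡⟨ ℤP.pos-* ℤ.∣ a ∣ (suc d) ⟩
      + ℤ.∣ a ∣ ℤ.* + suc d ∎
      where
      i≤∣i∣ : ∀ i → i ℤ.≤ + ℤ.∣ i ∣
      i≤∣i∣ (+ n) = ℤP.≤-refl
      i≤∣i∣ (ℤ.-[1+ n ]) = ℤ.-≤+

  min-pos : ∀ {p q} → 0ℚ < p → 0ℚ < q → 0ℚ < p ⊓ q
  min-pos {p} {q} h h′ with ⊓-sel p q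
  ... | inj₁ e = subst (0ℚ <_) (sym e) h
  ... | inj₂ e = subst (0ℚ <_) (sym e) h′

abstract
  eighth : ∀ {c} → 0ℚ < c → ∃ λ δ → 0ℚ < δ × ((δ + δ) + (δ + δ)) + ((δ + δ) + (δ + δ)) ≡ c
  eighth h with halve h
  ... | d , d>0 , refl with quarter d>0
  ... | δ , δ>0 , refl = δ , δ>0 , refl

  double≰0 : ∀ {δ} → 0ℚ < δ → ¬ (δ + δ ≤ 0ℚ)
  double≰0 h k = <-irrefl refl (<-≤-trans (+-pos h h) k)

  clash₅ : ∀ {δ c p q r s t} → 0ℚ < δ → ((δ + δ) + (δ + δ)) + ((δ + δ) + (δ + δ)) ≡ c →
    q + c ≤ p → p ≤ r + δ → r ≤ s + δ → s ≤ t + δ → t ≤ q + δ → ⊥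
  clash₅ {δ} {c} {p} {q} {r} {s} {t} δ>0 refl h₁ h₂ h₃ h₄ h₅ = double≰0 δ>0
    (≤-by (diff h₁ ⊞ diff h₂ ⊞ diff h₃ ⊞ diff h₄ ⊞ diff h₅ ⊞ <⇒≤ δ>0 ⊞ <⇒≤ δ>0) (lem δ p q r s t))
    where
    lem : ∀ δ p q r s t → (δ + δ) + (((p - (q + (((δ + δ) + (δ + δ)) + ((δ + δ) + (δ + δ)))))
      + ((r + δ) - p)) + ((s + δ) - r) + ((t + δ) - s) + ((q + δ) - t) + δ + δ) ≡ 0ℚ
    lem = solve-∀ ℚ-ring

  clash₃ : ∀ {δ c p q r} → 0ℚ < δ → (δ + δ) + (δ + δ) ≡ c →
    q + c ≤ p → p ≤ r + δ → r ≤ q + δ → ⊥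
  clash₃ {δ} {c} {p} {q} {r} δ>0 refl h₁ h₂ h₃ = double≰0 δ>0
    (≤-by (diff h₁ ⊞ diff h₂ ⊞ diff h₃) (lem δ p q r))
    where
    lem : ∀ δ p q r → (δ + δ) + ((p - (q + ((δ + δ) + (δ + δ)))) + ((r + δ) - p) + ((q + δ) - r)) ≡ 0ℚ
    lem = solve-∀ ℚ-ring

  by-contradiction : ∀ {p q} → ¬ (q ≤ p) → p ≤ q
  by-contradiction {p} {q} h with ≤-total p q
  ... | inj₁ k = k
  ... | inj₂ k = ⊥-elim (h k)

Eventually : (ℕ → Set) → Set
Eventually P = ∃ λ N → ∀ n → N ℕ.≤ n → P n

Eventually₂ : (ℕ → ℕ → Set) → Set
Eventually₂ P = ∃ λ N → ∀ m n → N ℕ.≤ m → N ℕ.≤ n → P m n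

infixr 4 _∧ᵉ_
_∧ᵉ_ : ∀ {P Q} → Eventually P → Eventually Q → Eventually (λ n → P n × Q n)
(M , f) ∧ᵉ (N , g) = M ℕ.⊔ N , λ n h → f n (ℕP.≤-trans (ℕP.m≤m⊔n M N) h) , g n (ℕP.≤-trans (ℕP.m≤n⊔m M N) h)

mapᵉ : ∀ {P Q : ℕ → Set} → (∀ {n} → P n → Q n) → Eventually P → Eventually Q
mapᵉ g (N , f) = N , λ n h → g (f n h)

infixr 4 _∧²_
_∧²_ : ∀ {P Q} → Eventually₂ P → Eventually₂ Q → Eventually₂ (λ m n → P m n × Q m n)
(M , f) ∧² (N , g) = M ℕ.⊔ N , λ m n h h′ →
  f m n (ℕP.≤-trans (ℕP.m≤m⊔n M N) h) (ℕP.≤-trans (ℕP.m≤m⊔n M N) h′) ,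
  g m n (ℕP.≤-trans (ℕP.m≤n⊔m M N) h) (ℕP.≤-trans (ℕP.m≤n⊔m M N) h′)

map² : ∀ {P Q : ℕ → ℕ → Set} → (∀ {m n} → P m n → Q m n) → Eventually₂ P → Eventually₂ Q
map² g (N , f) = N , λ m n h h′ → g (f m n h h′)

split² : ∀ {P Q} → Eventually P → Eventually Q → Eventually₂ (λ m n → P m × Q n)
split² (M , f) (N , g) = M ℕ.⊔ N , λ m n h h′ →
  f m (ℕP.≤-trans (ℕP.m≤m⊔n M N) h) , g n (ℕP.≤-trans (ℕP.m≤n⊔m M N) h′)

diag : ∀ {P} → Eventually₂ P → Eventually (λ n → P n n)
diag (N , f) = N , λ n h → f n n h h

record ℝ : Set where
  constructor mkℝ
  field
    seq    : ℕ → ℚ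
    cauchy : ∀ {δ} → 0ℚ < δ → Eventually₂ λ m n → ∣ seq m - seq n ∣ ≤ δ

open ℝ public

infix 4 _≤ᴿ_ _<ᴿ_ _≃ᴿ_

_≤ᴿ_ : ℝ → ℝ → Set
x ≤ᴿ y = ∀ δ → 0ℚ < δ → Eventually λ n → seq x n ≤ seq y n + δ

_<ᴿ_ : ℝ → ℝ → Set
x <ᴿ y = ∃ λ δ → 0ℚ < δ × Eventually λ n → seq x n + δ ≤ seq y n

_≃ᴿ_ : ℝ → ℝ → Set
x ≃ᴿ y = x ≤ᴿ y × y ≤ᴿ x

fromℚ : ℚ → ℝ
fromℚ p = mkℝ (λ _ → p) λ h → 0 , λ _ _ _ _ → ∣p-p∣≤ p (<⇒≤ h)

fromℕ : ℕ → ℝ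
fromℕ n = fromℚ (ι n)

abstract
  bounded : ∀ x → ∃ λ M → 0ℚ < M × Eventually λ n → ∣ seq x n ∣ ≤ M
  bounded x with cauchy x 0<1
  ... | N , f = ∣ seq x N ∣ + 1ℚ , +-mono-≤-< (0≤∣p∣ (seq x N)) 0<1 , N , λ n h →
    ≤-trans (≤-reflexive (cong ∣_∣ (lem (seq x n) (seq x N))))
      (≤-trans (∣p+q∣≤∣p∣+∣q∣ (seq x N) (seq x n - seq x N))
        (+-monoʳ-≤ ∣ seq x N ∣ (f n N h ℕP.≤-refl)))
    where
    lem : ∀ p q → p ≡ q + (p - q)
    lem = solve-∀ ℚ-ring

-- A sequence of maps ℚ → ℚ whose diagonal n ↦ f n (x n) is Cauchy, and
-- depends only on the limit of x, for every Cauchy sequence x.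
record Continuous (f : ℕ → ℚ → ℚ) : Set where
  field
    bound   : ∀ B → ∃ λ M → 0ℚ < M × Eventually λ n → ∀ a → ∣ a ∣ ≤ B → ∣ f n a ∣ ≤ M
    modulus : ∀ B {δ} → 0ℚ < δ → ∃ λ η → 0ℚ < η × Eventually₂ λ m n →
      ∀ a b → ∣ a ∣ ≤ B → ∣ b ∣ ≤ B → ∣ a - b ∣ ≤ η → ∣ f m a - f n b ∣ ≤ δ

open Continuous public

apply : ∀ {f} → Continuous f → ℝ → ℝ
apply {f} c x = mkℝ (λ n → f n (seq x n)) λ h → go h
  where
  go : ∀ {δ} → 0ℚ < δ → Eventually₂ λ m n → ∣ f m (seq x m) - f n (seq x n) ∣ ≤ δ
  go {δ} h with bounded x
  ... | B , _ , (L , b) with modulus c B h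
  ... | η , η>0 , (M , e) with cauchy x η>0
  ... | N , d = L ℕ.⊔ (M ℕ.⊔ N) , λ m n hm hn →
    e m n (M≤ hm) (M≤ hn) (seq x m) (seq x n)
      (b m (L≤ hm)) (b n (L≤ hn)) (d m n (N≤ hm) (N≤ hn))
    where
    L≤ : ∀ {n} → L ℕ.⊔ (M ℕ.⊔ N) ℕ.≤ n → L ℕ.≤ n
    L≤ h = ℕP.≤-trans (ℕP.m≤m⊔n L (M ℕ.⊔ N)) h
    M≤ : ∀ {n} → L ℕ.⊔ (M ℕ.⊔ N) ℕ.≤ n → M ℕ.≤ n
    M≤ h = ℕP.≤-trans (ℕP.m≤m⊔n M N) (ℕP.≤-trans (ℕP.m≤n⊔m L (M ℕ.⊔ N)) h)
    N≤ : ∀ {n} → L ℕ.⊔ (M ℕ.⊔ N) ℕ.≤ n → N ℕ.≤ n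
    N≤ h = ℕP.≤-trans (ℕP.m≤n⊔m M N) (ℕP.≤-trans (ℕP.m≤n⊔m L (M ℕ.⊔ N)) h)

id-continuous : Continuous λ _ a → a
id-continuous = record
  { bound   = λ B → ∣ B ∣ + 1ℚ , +-mono-≤-< (0≤∣p∣ B) 0<1 , 0 , λ n _ a h →
      ≤-trans h (≤-trans (p≤∣p∣ B) (≤-by 0≤1 refl))
  ; modulus = λ B {δ} h → δ , h , 0 , λ _ _ _ _ _ _ _ _ d → d
  }

const-continuous : ∀ x → Continuous λ n _ → seq x n
const-continuous x = record
  { bound   = λ _ → proj₁ (bounded x) , proj₁ (proj₂ (bounded x)) ,
      mapᵉ (λ h _ _ → h) (proj₂ (proj₂ (bounded x)))
  ; modulus = λ _ h → 1ℚ , 0<1 , map² (λ d _ _ _ _ _ → d) (cauchy x h)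
  }

+-continuous : ∀ {f g} → Continuous f → Continuous g → Continuous λ n a → f n a + g n a
+-continuous {f} {g} cf cg = record { bound = bd ; modulus = md }
  where
  bd : ∀ B → _
  bd B with bound cf B | bound cg B
  ... | M , M>0 , e | N , N>0 , e′ = M + N , +-pos M>0 N>0 ,
    mapᵉ (λ { {n} (h , h′) a k → ≤-trans (∣p+q∣≤∣p∣+∣q∣ (f n a) (g n a)) (+-mono-≤ (h a k) (h′ a k)) })
      (e ∧ᵉ e′)
  md : ∀ B {δ} → 0ℚ < δ → _
  md B h with halve h
  ... | δ , δ>0 , refl with modulus cf B δ>0 | modulus cg B δ>0
  ... | η , η>0 , e | η′ , η′>0 , e′ = η ⊓ η′ , min-pos η>0 η′>0 ,
    map² (λ { {m} {n} (h , h′) a b ka kb d → close-+ {f m a} {f n b} {g m a} {g n b}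
      (h a b ka kb (≤-trans d (p⊓q≤p η η′))) (h′ a b ka kb (≤-trans d (p⊓q≤q η η′))) })
      (e ∧² e′)

*-continuous : ∀ {f g} → Continuous f → Continuous g → Continuous λ n a → f n a * g n a
*-continuous {f} {g} cf cg = record { bound = bd ; modulus = md }
  where
  bd : ∀ B → _
  bd B with bound cf B | bound cg B
  ... | M , M>0 , e | N , N>0 , e′ = M * N , *-pos M>0 N>0 ,
    mapᵉ (λ { (h , h′) a k → ∣*∣≤ (h a k) (h′ a k) }) (e ∧ᵉ e′)
  md : ∀ B {δ} → 0ℚ < δ → _
  md B h with halve h | bound cf B | bound cg B
  ... | δ , δ>0 , refl | M , M>0 , bf | N , N>0 , bg with shrink N>0 δ>0 | shrink M>0 δ>0
  ... | δ₁ , δ₁>0 , e₁ | δ₂ , δ₂>0 , e₂ with modulus cf B δ₁>0 | modulus cg B δ₂>0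
  ... | η , η>0 , e | η′ , η′>0 , e′ = η ⊓ η′ , min-pos η>0 η′>0 ,
    map² (λ { {m} {n} ((hM , hN) , h , h′) a b ka kb d →
      ≤-trans (close-* {f m a} {f n b} {g m a} {g n b} (hM a ka) (hN b kb)
        (h a b ka kb (≤-trans d (p⊓q≤p η η′))) (h′ a b ka kb (≤-trans d (p⊓q≤q η η′))))
      (≤-reflexive (cong₂ _+_ e₂ e₁)) })
      (split² bf bg ∧² e ∧² e′)

infixl 6 _+ᴿ_
infixl 7 _*ᴿ_

_+ᴿ_ : ℝ → ℝ → ℝ
x +ᴿ y = apply (+-continuous id-continuous (const-continuous y)) x

_*ᴿ_ : ℝ → ℝ → ℝ
x *ᴿ y = apply (*-continuous id-continuous (const-continuous y)) x

term : ℕ → ℚ → ℚ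
term zero    q = 1ℚ
term (suc k) q = term k q * (q * (+ 1 / suc k))

expSum : ℕ → ℚ → ℚ
expSum zero    q = 1ℚ
expSum (suc n) q = expSum n q + term (suc n) q

term-continuous : ∀ k → Continuous λ _ → term k
term-continuous zero = const-continuous (fromℚ 1ℚ)
term-continuous (suc k) = *-continuous (term-continuous k)
  (*-continuous id-continuous (const-continuous (fromℚ (+ 1 / suc k))))

expSum-continuousᶠ : ∀ k → Continuous λ _ → expSum k
expSum-continuousᶠ zero = const-continuous (fromℚ 1ℚ)
expSum-continuousᶠ (suc k) = +-continuous (expSum-continuousᶠ k) (term-continuous (suc k))

∣term∣≤ : ∀ k {a B} → ∣ a ∣ ≤ B → ∣ term k a ∣ ≤ term k B
∣term∣≤ zero h = ≤-refl
∣term∣≤ (suc k) h = ∣*∣≤ (∣term∣≤ k h) (∣*∣≤ h (≤-reflexive (0≤p⇒∣p∣≡p (<⇒≤ (0<1/ k)))))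

0<term : ∀ k {B} → 0ℚ < B → 0ℚ < term k B
0<term zero h = 0<1
0<term (suc k) h = *-pos (0<term k h) (*-pos h (0<1/ k))

0≤term : ∀ k {B} → 0ℚ ≤ B → 0ℚ ≤ term k B
0≤term zero h = 0≤1
0≤term (suc k) h = 0≤term k h ⊠ (h ⊠ <⇒≤ (0<1/ k))

∣expSum∣≤ : ∀ n {a B} → ∣ a ∣ ≤ B → ∣ expSum n a ∣ ≤ expSum n B
∣expSum∣≤ zero h = ≤-refl
∣expSum∣≤ (suc n) {a} h = ≤-trans (∣p+q∣≤∣p∣+∣q∣ (expSum n a) (term (suc n) a))
  (+-mono-≤ (∣expSum∣≤ n h) (∣term∣≤ (suc n) h))

-- Past k ≥ 2B the terms at least halve, so each bounds the tail after it.
module Tail {B} (B>0 : 0ℚ < B) where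

  K : ℕ
  K = proj₁ (archimedes (B + B))

  ratio : ∀ k → K ℕ.≤ k → B * (+ 1 / suc k) ≤ ½
  ratio k h = *-cancelˡ-≤-pos (1ℚ + 1ℚ) {{positive (+-pos 0<1 0<1)}}
    (≤-by (diff big ⊠ <⇒≤ (0<1/ k)) (trans (lem B (+ 1 / suc k) (ι (suc k))) (ι-inv k)))
    where
    big : B + B ≤ ι (suc k)
    big = ≤-trans (proj₂ (archimedes (B + B))) (ι-mono (ℕP.m≤n⇒m≤1+n h))
    lem : ∀ B r i → (1ℚ + 1ℚ) * (B * r) + (i - (B + B)) * r ≡ i * r
    lem = solve-∀ ℚ-ring

  T : ℕ → ℚ
  T k = term k B

  T-half : ∀ k → K ℕ.≤ k → T (suc k) + T (suc k) ≤ T k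
  T-half k h = ≤-trans (+-mono-≤ le le) (≤-reflexive
    (trans (sym (*-distribˡ-+ (T k) ½ ½)) (*-identityʳ (T k))))
    where
    le : T (suc k) ≤ T k * ½
    le = *-monoˡ-≤-nonNeg (T k) {{nonNegative (<⇒≤ (0<term k B>0))}} (ratio k h)

  tail : ∀ a n j → K ℕ.≤ n → ∣ a ∣ ≤ B →
    ∣ expSum (j ℕ.+ n) a - expSum n a ∣ + T (j ℕ.+ n) ≤ T n
  tail a n zero h k = ≤-trans (+-monoˡ-≤ (T n) (∣p-p∣≤ (expSum n a) ≤-refl)) (≤-reflexive (+-identityˡ (T n)))
  tail a n (suc j) h k = ≤-trans
    (+-monoˡ-≤ (T (suc j ℕ.+ n)) (≤-trans (≤-reflexive (cong ∣_∣ (lem e t s))) (≤-trans (∣p+q∣≤∣p∣+∣q∣ (e - s) t)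
       (+-monoʳ-≤ ∣ e - s ∣ (∣term∣≤ (suc j ℕ.+ n) k)))))
    (≤-trans (≤-reflexive (+-assoc ∣ e - s ∣ (T (suc j ℕ.+ n)) (T (suc j ℕ.+ n))))
      (≤-trans (+-monoʳ-≤ ∣ e - s ∣ (T-half (j ℕ.+ n) (ℕP.≤-trans h (ℕP.m≤n+m n j)))) (tail a n j h k)))
    where
    e = expSum (j ℕ.+ n) a
    t = term (suc j ℕ.+ n) a
    s = expSum n a
    lem : ∀ e t s → (e + t) - s ≡ (e - s) + t
    lem = solve-∀ ℚ-ring

  decay : ∀ j → T (j ℕ.+ K) * ι (suc j) ≤ T K
  decay zero = ≤-reflexive (*-identityʳ (T K))
  decay (suc j) = ≤-trans
    (≤-by (<⇒≤ (0<term (suc j ℕ.+ K) B>0) ⊠ 0≤ι j ⊞ diff (T-half (j ℕ.+ K) (ℕP.m≤n+m K j)) ⊠ 0≤ι (suc j))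
      (trans (cong₂ (λ u v → T (suc j ℕ.+ K) * u + (T (suc j ℕ.+ K) * ι j + (T (j ℕ.+ K) - (T (suc j ℕ.+ K) + T (suc j ℕ.+ K))) * v))
         (trans (ι-suc (suc j)) (cong (_+ 1ℚ) (ι-suc j))) (ι-suc j))
         (trans (lem (T (suc j ℕ.+ K)) (T (j ℕ.+ K)) (ι j)) (cong (T (j ℕ.+ K) *_) (sym (ι-suc j))))))
    (decay j)
    where
    lem : ∀ t u i → t * (i + 1ℚ + 1ℚ) + (t * i + (u - (t + t)) * (i + 1ℚ)) ≡ u * (i + 1ℚ)
    lem = solve-∀ ℚ-ring

  small : ∀ {δ} → 0ℚ < δ → Eventually λ n → T n ≤ δ
  small {δ} δ>0 with shrink δ>0 (0<term K B>0)
  ... | q , _ , e with archimedes q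
  ... | J , hJ = J ℕ.+ K , λ n h → subst (λ k → T k ≤ δ) (lem₀ n h) (go n h)
    where
    j : ℕ → ℕ
    j n = n ℕ.∸ K
    lem₀ : ∀ n → J ℕ.+ K ℕ.≤ n → j n ℕ.+ K ≡ n
    lem₀ n h = ℕP.m∸n+n≡m (ℕP.≤-trans (ℕP.m≤n+m K J) h)
    go : ∀ n → J ℕ.+ K ℕ.≤ n → T (j n ℕ.+ K) ≤ δ
    go n h = *-cancelʳ-≤-pos (ι (suc (j n))) {{positive (0<ι (j n))}} (≤-trans (decay (j n))
      (subst (_≤ δ * ι (suc (j n))) e (*-monoˡ-≤-nonNeg δ {{nonNegative (<⇒≤ δ>0)}}
        (≤-trans hJ (ι-mono (ℕP.m≤n⇒m≤1+n (ℕP.m+n≤o⇒m≤o∸n J h)))))))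

  tail≤ : ∀ a n m → K ℕ.≤ n → n ℕ.≤ m → ∣ a ∣ ≤ B → ∣ expSum m a - expSum n a ∣ ≤ T n
  tail≤ a n m h h′ k = subst (λ i → ∣ expSum i a - expSum n a ∣ ≤ T n) (ℕP.m∸n+n≡m h′)
    (≤-trans (≤-by (<⇒≤ (0<term (m ℕ.∸ n ℕ.+ n) B>0)) refl) (tail a n (m ℕ.∸ n) h k))

expSum-continuous : Continuous expSum
expSum-continuous = record { bound = bd ; modulus = md }
  where
  bd : ∀ B₀ → _
  bd B₀ = expSum K B + T K , bound>0 K , K , λ n h a k →
    ≤-trans (∣expSum∣≤ n (≤-trans k B₀≤B)) 
      (close⇒≤ (tail≤ B K n ℕP.≤-refl h (≤-reflexive (0≤p⇒∣p∣≡p (<⇒≤ B>0)))))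
    where
    B = ∣ B₀ ∣ + 1ℚ
    B>0 : 0ℚ < B
    B>0 = +-mono-≤-< (0≤∣p∣ B₀) 0<1
    B₀≤B : B₀ ≤ B
    B₀≤B = ≤-trans (p≤∣p∣ B₀) (≤-by 0≤1 refl)
    open Tail B>0
    es>0 : ∀ n → 0ℚ < expSum n B
    es>0 zero = 0<1
    es>0 (suc n) = +-pos (es>0 n) (0<term (suc n) B>0)
    bound>0 : ∀ n → 0ℚ < expSum n B + T n
    bound>0 n = +-pos (es>0 n) (0<term n B>0)
  md : ∀ B₀ {δ} → 0ℚ < δ → _
  md B₀ h with quarter h
  ... | δ , δ>0 , refl = η , η>0 , N₂ , λ m n hm hn a b ka kb d →
      ≤-trans (close-trans {expSum m a} {expSum N₂ b} {expSum n b} (close-trans {expSum m a} {expSum N₂ a} {expSum N₂ b} (tail≤ a N₂ m K≤ hm (≤-trans ka B₀≤B)) (proj₂ e N₁ N₁ ℕP.≤-refl ℕP.≤-refl a b ka kb d))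
        (close-sym {expSum n b} {expSum N₂ b} (tail≤ b N₂ n K≤ hn (≤-trans kb B₀≤B))))
      (≤-trans (+-mono-≤ (+-monoˡ-≤ δ T≤) T≤) (≤-by (<⇒≤ δ>0) (+-assoc (δ + δ) δ δ)))
    where
    B = ∣ B₀ ∣ + 1ℚ
    B>0 : 0ℚ < B
    B>0 = +-mono-≤-< (0≤∣p∣ B₀) 0<1
    B₀≤B : B₀ ≤ B
    B₀≤B = ≤-trans (p≤∣p∣ B₀) (≤-by 0≤1 refl)
    open Tail B>0
    N₂ = proj₁ (small δ>0) ℕ.⊔ K
    K≤ : K ℕ.≤ N₂
    K≤ = ℕP.m≤n⊔m (proj₁ (small δ>0)) K
    T≤ : T N₂ ≤ δ
    T≤ = proj₂ (small δ>0) N₂ (ℕP.m≤m⊔n (proj₁ (small δ>0)) K)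
    md′ = modulus (expSum-continuousᶠ N₂) B₀ δ>0
    η = proj₁ md′
    η>0 = proj₁ (proj₂ md′)
    e = proj₂ (proj₂ md′)
    N₁ = proj₁ e

-- The n-th approximant of exp x is Σ_{k≤n} (x n)ᵏ / k!.
exp : ℝ → ℝ
exp = apply expSum-continuous

LastUpTo : (ℕ → Set) → ℕ → ℕ → Set
LastUpTo P J j = j ℕ.≤ J × (j ≡ 0 ⊎ P j) × (j ≡ J ⊎ ¬ P (suc j))

lastUpTo : ∀ {P : ℕ → Set} → Decidable P → ∀ J → ∃ (LastUpTo P J)
lastUpTo P? zero = 0 , ℕ.z≤n , inj₁ refl , inj₁ refl
lastUpTo P? (suc J) with P? (suc J)
... | yes p = suc J , ℕP.≤-refl , inj₂ p , inj₁ refl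
... | no ¬p with lastUpTo P? J
... | j , j≤J , l , inj₁ refl = j , ℕP.m≤n⇒m≤1+n j≤J , l , inj₂ ¬p
... | j , j≤J , l , inj₂ u = j , ℕP.m≤n⇒m≤1+n j≤J , l , inj₂ u

-- Hypotheses under which f z = y has a solution z ≥ 0, where f is the increasing
-- function approximated by the f n.
record Solvable (f : ℕ → ℚ → ℚ) (y : ℝ) : Set where
  field
    continuous : Continuous f
    growth     : ∀ {η} → 0ℚ < η → ∃ λ c → 0ℚ < c × Eventually λ n →
                 ∀ a b → 0ℚ ≤ a → a + η ≤ b → f n a + c ≤ f n b
    bottom     : ∀ {δ} → 0ℚ < δ → Eventually λ n → f n 0ℚ ≤ seq y n + δ
    top        : ℚ
    top>0      : 0ℚ < top
    below-top  : Eventually λ n → seq y n ≤ f n top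

module Solve {f : ℕ → ℚ → ℚ} {y : ℝ} (s : Solvable f y) where
  open Solvable s

  step : ℕ → ℚ
  step n = top * (+ 1 / suc n)

  grid : ℕ → ℕ → ℚ
  grid n j = ι j * step n

  last : ∀ n → ∃ (LastUpTo (λ j → f n (grid n j) ≤ seq y n) (suc n))
  last n = lastUpTo (λ j → f n (grid n j) ≤? seq y n) (suc n)

  z : ℕ → ℚ
  z n = grid n (proj₁ (last n))

  step>0 : ∀ n → 0ℚ < step n
  step>0 n = *-pos top>0 (0<1/ n)

  grid-mono : ∀ n {i j} → i ℕ.≤ j → grid n i ≤ grid n j
  grid-mono n h = *-monoʳ-≤-nonNeg (step n) {{nonNegative (<⇒≤ (step>0 n))}} (ι-mono h)

  grid-top : ∀ n → grid n (suc n) ≡ top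
  grid-top n = trans (lem (ι (suc n)) top (+ 1 / suc n)) (trans (cong (top *_) (ι-inv n)) (*-identityʳ top))
    where
    lem : ∀ i t r → i * (t * r) ≡ t * (i * r)
    lem = solve-∀ ℚ-ring

  grid-suc : ∀ n j → grid n (suc j) ≡ grid n j + step n
  grid-suc n j = trans (cong (_* step n) (ι-suc j)) (lem (ι j) (step n))
    where
    lem : ∀ i h → (i + 1ℚ) * h ≡ i * h + h
    lem = solve-∀ ℚ-ring

  grid≥0 : ∀ n j → 0ℚ ≤ grid n j
  grid≥0 n j = 0≤ι j ⊠ <⇒≤ (step>0 n)

  z≥0 : ∀ n → 0ℚ ≤ z n
  z≥0 n = grid≥0 n (proj₁ (last n))

  grid≤top : ∀ n {j} → j ℕ.≤ suc n → ∣ grid n j ∣ ≤ top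
  grid≤top n {j} h = ≤-trans (≤-reflexive (0≤p⇒∣p∣≡p (grid≥0 n j)))
    (subst (grid n j ≤_) (grid-top n) (grid-mono n h))

  z≤top : ∀ n → ∣ z n ∣ ≤ top
  z≤top n = grid≤top n (proj₁ (proj₂ (last n)))

  step-small : ∀ {η} → 0ℚ < η → Eventually λ n → step n ≤ η
  step-small {η} η>0 = N , λ n h → *-cancelʳ-≤-pos (ι (suc n)) {{positive (0<ι n)}}
    (≤-trans (≤-reflexive (trans (lem top (+ 1 / suc n) (ι (suc n))) (trans (cong (top *_) (ι-inv n)) (*-identityʳ top))))
      (subst (_≤ η * ι (suc n)) e (*-monoˡ-≤-nonNeg η {{nonNegative (<⇒≤ η>0)}}
        (≤-trans hN (ι-mono (ℕP.m≤n⇒m≤1+n h))))))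
    where
    q = proj₁ (shrink η>0 top>0)
    e = proj₂ (proj₂ (shrink η>0 top>0))
    N = proj₁ (archimedes q)
    hN = proj₂ (archimedes q)
    lem : ∀ t r i → t * r * i ≡ t * (i * r)
    lem = solve-∀ ℚ-ring

  above : ∀ {δ} → 0ℚ < δ → Eventually λ n → f n (z n) ≤ seq y n + δ
  above {δ} δ>0 = mapᵉ (λ {n} h → go n h (last n) refl) (bottom δ>0)
    where
    go : ∀ n → f n 0ℚ ≤ seq y n + δ → ∀ l → l ≡ last n → f n (grid n (proj₁ l)) ≤ seq y n + δ
    go n h (.0 , _ , inj₁ refl , _) _ = subst (λ t → f n t ≤ seq y n + δ) (sym (*-zeroˡ (step n))) h
    go n h (j , _ , inj₂ p , _) _ = ≤-trans p (≤-by (<⇒≤ δ>0) refl)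

  below : ∀ {δ} → 0ℚ < δ → Eventually λ n → seq y n ≤ f n (z n) + δ
  below {δ} δ>0 = mapᵉ (λ {n} (t , h , m) → go n t h m (last n))
    (below-top ∧ᵉ step-small (proj₁ (proj₂ md)) ∧ᵉ diag (proj₂ (proj₂ md)))
    where
    md = modulus continuous top δ>0
    η = proj₁ md
    go : ∀ n → seq y n ≤ f n top → step n ≤ η →
      (∀ a b → ∣ a ∣ ≤ top → ∣ b ∣ ≤ top → ∣ a - b ∣ ≤ η → ∣ f n a - f n b ∣ ≤ δ) →
      ∀ l → seq y n ≤ f n (grid n (proj₁ l)) + δ
    go n t h m (j , _ , _ , inj₁ refl) = ≤-trans t
      (≤-trans (≤-reflexive (cong (f n) (sym (grid-top n)))) (≤-by (<⇒≤ δ>0) refl))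
    go n t h m (j , j≤ , _ , inj₂ ¬p) with ℕP.m≤n⇒m<n∨m≡n j≤
    ... | inj₂ refl = ≤-trans t
      (≤-trans (≤-reflexive (cong (f n) (sym (grid-top n)))) (≤-by (<⇒≤ δ>0) refl))
    ... | inj₁ j< = ≤-trans (<⇒≤ (≰⇒> ¬p)) (close⇒≤ {f n (grid n (suc j))} {f n (grid n j)}
      (m (grid n (suc j)) (grid n j) (grid≤top n j<) (grid≤top n j≤)
        (≤-trans (≤-reflexive (trans (cong ∣_∣ (trans (cong (_- grid n j) (grid-suc n j)) (lem (grid n j) (step n))))
           (0≤p⇒∣p∣≡p (<⇒≤ (step>0 n))))) h)))
      where
      lem : ∀ g s → (g + s) - g ≡ s
      lem = solve-∀ ℚ-ring

  z-close : ∀ {η} → 0ℚ < η → Eventually₂ λ m n → z m ≤ z n + η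
  z-close {η} η>0 = N , λ m n hm hn → by-contradiction λ k →
      clash₅ {q = f n (z n)} δ>0 (proj₂ (proj₂ (eighth (proj₁ (proj₂ g)))))
        (proj₂ (proj₂ (proj₂ g)) n (≤₁ hn) (z n) (z m) (z≥0 n) k)
        (close⇒≤ {f n (z m)} {f m (z m)}
          (proj₂ (proj₂ (proj₂ md)) n m (≤₂ hn) (≤₂ hm) (z m) (z m) (z≤top m) (z≤top m)
            (∣p-p∣≤ (z m) (<⇒≤ (proj₁ (proj₂ md))))))
        (proj₂ (above δ>0) m (≤₃ hm))
        (close⇒≤ {seq y m} {seq y n} (proj₂ (cauchy y δ>0) m n (≤₅ hm) (≤₅ hn)))
        (proj₂ (below δ>0) n (≤₄ hn))
    where
    g : ∃ λ c → 0ℚ < c × Eventually λ n → ∀ a b → 0ℚ ≤ a → a + η ≤ b → f n a + c ≤ f n b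
    g = growth η>0
    δ : ℚ
    δ = proj₁ (eighth (proj₁ (proj₂ g)))
    δ>0 : 0ℚ < δ
    δ>0 = proj₁ (proj₂ (eighth (proj₁ (proj₂ g))))
    md = modulus continuous top δ>0
    N₁ = proj₁ (proj₂ (proj₂ g))
    N₂ = proj₁ (proj₂ (proj₂ md))
    N₃ = proj₁ (above δ>0)
    N₄ = proj₁ (below δ>0)
    N₅ = proj₁ (cauchy y δ>0)
    N = N₁ ℕ.+ (N₂ ℕ.+ (N₃ ℕ.+ (N₄ ℕ.+ N₅)))
    ≤₁ : ∀ {n} → N ℕ.≤ n → N₁ ℕ.≤ n
    ≤₁ = ℕP.m+n≤o⇒m≤o N₁
    ≤₂ : ∀ {n} → N ℕ.≤ n → N₂ ℕ.≤ n
    ≤₂ h = ℕP.m+n≤o⇒m≤o N₂ (ℕP.m+n≤o⇒n≤o N₁ h)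
    ≤₃ : ∀ {n} → N ℕ.≤ n → N₃ ℕ.≤ n
    ≤₃ h = ℕP.m+n≤o⇒m≤o N₃ (ℕP.m+n≤o⇒n≤o N₂ (ℕP.m+n≤o⇒n≤o N₁ h))
    ≤₄ : ∀ {n} → N ℕ.≤ n → N₄ ℕ.≤ n
    ≤₄ h = ℕP.m+n≤o⇒m≤o N₄ (ℕP.m+n≤o⇒n≤o N₃ (ℕP.m+n≤o⇒n≤o N₂ (ℕP.m+n≤o⇒n≤o N₁ h)))
    ≤₅ : ∀ {n} → N ℕ.≤ n → N₅ ℕ.≤ n
    ≤₅ h = ℕP.m+n≤o⇒n≤o N₄ (ℕP.m+n≤o⇒n≤o N₃ (ℕP.m+n≤o⇒n≤o N₂ (ℕP.m+n≤o⇒n≤o N₁ h)))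

  solution : ℝ
  solution = mkℝ z λ {δ} δ>0 →
    proj₁ (z-close δ>0) , λ m n hm hn →
      close {z m} {z n} (proj₂ (z-close δ>0) m n hm hn) (proj₂ (z-close δ>0) n m hn hm)

  solution≥0 : fromℚ 0ℚ ≤ᴿ solution
  solution≥0 δ δ>0 = 0 , λ n _ → ≤-trans (z≥0 n) (≤-by (<⇒≤ δ>0) refl)

  solves : apply continuous solution ≃ᴿ y
  solves = (λ _ → above) , (λ _ → below)

  solution>0 : (∃ λ δ → 0ℚ < δ × Eventually λ n → f n 0ℚ + δ ≤ seq y n) → fromℚ 0ℚ <ᴿ solution
  solution>0 (c , c>0 , e) = η , η>0 , mapᵉ (λ {n} → go n) (e ∧ᵉ below δ>0 ∧ᵉ diag (proj₂ (proj₂ md)))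
    where
    δ : ℚ
    δ = proj₁ (quarter c>0)
    δ>0 : 0ℚ < δ
    δ>0 = proj₁ (proj₂ (quarter c>0))
    md = modulus continuous top δ>0
    η : ℚ
    η = proj₁ md
    η>0 : 0ℚ < η
    η>0 = proj₁ (proj₂ md)
    near-0 : ∀ n → (∀ a b → ∣ a ∣ ≤ top → ∣ b ∣ ≤ top → ∣ a - b ∣ ≤ η → ∣ f n a - f n b ∣ ≤ δ) →
      z n ≤ η → f n (z n) ≤ f n 0ℚ + δ
    near-0 n m k = close⇒≤ {f n (z n)} {f n 0ℚ} (m (z n) 0ℚ (z≤top n) (<⇒≤ top>0)
      (≤-trans (≤-reflexive (trans (cong ∣_∣ (+-identityʳ (z n))) (0≤p⇒∣p∣≡p (z≥0 n)))) k))
    go : ∀ n →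
      f n 0ℚ + c ≤ seq y n × seq y n ≤ f n (z n) + δ ×
      (∀ a b → ∣ a ∣ ≤ top → ∣ b ∣ ≤ top → ∣ a - b ∣ ≤ η → ∣ f n a - f n b ∣ ≤ δ) →
      0ℚ + η ≤ z n
    go n (h , bl , m) = ≤-trans (≤-reflexive (+-identityˡ η)) (by-contradiction λ k →
      clash₃ {q = f n 0ℚ} δ>0 (proj₂ (proj₂ (quarter c>0))) h bl (near-0 n m k))

abstract
  term-mono : ∀ k {a b} → 0ℚ ≤ a → a ≤ b → term k a ≤ term k b
  term-mono zero _ _ = ≤-refl
  term-mono (suc k) {a} {b} h h′ = *-mono-≤-nonNeg (0≤term k (≤-trans h h′)) (h ⊠ r≥0)
    (term-mono k h h′) (*-mono-≤-nonNeg (≤-trans h h′) r≥0 h′ ≤-refl)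
    where
    r≥0 : 0ℚ ≤ + 1 / suc k
    r≥0 = <⇒≤ (0<1/ k)

  1≤expSum : ∀ n {a} → 0ℚ ≤ a → 1ℚ ≤ expSum n a
  1≤expSum zero h = ≤-refl
  1≤expSum (suc n) h = ≤-trans (1≤expSum n h) (≤-by (0≤term (suc n) h) refl)

  expSum-0 : ∀ n → expSum n 0ℚ ≡ 1ℚ
  expSum-0 zero = refl
  expSum-0 (suc n) = trans (cong₂ _+_ (expSum-0 n)
    (trans (cong (term n 0ℚ *_) (*-zeroˡ (+ 1 / suc n))) (*-zeroʳ (term n 0ℚ)))) (+-identityʳ 1ℚ)

  expSum-growth : ∀ {n} → 1 ℕ.≤ n → ∀ {a b} → 0ℚ ≤ a → a ≤ b → expSum n a + (b - a) ≤ expSum n b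
  expSum-growth {suc zero} _ {a} {b} _ _ = ≤-reflexive (lem a b)
    where
    lem : ∀ a b → (1ℚ + 1ℚ * (a * 1ℚ)) + (b - a) ≡ 1ℚ + 1ℚ * (b * 1ℚ)
    lem = solve-∀ ℚ-ring
  expSum-growth {suc (suc n)} _ {a} {b} h h′ = ≤-by
    (diff (expSum-growth {suc n} (ℕ.s≤s ℕ.z≤n) h h′) ⊞ diff (term-mono (suc (suc n)) h h′))
    (lem (expSum (suc n) a) (term (suc (suc n)) a) (expSum (suc n) b) (term (suc (suc n)) b) a b)
    where
    lem : ∀ e t e′ t′ a b → ((e + t) + (b - a)) + ((e′ - (e + (b - a))) + (t′ - t)) ≡ e′ + t′
    lem = solve-∀ ℚ-ring

0ℝ 1ℝ : ℝ
0ℝ = fromℚ 0ℚ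
1ℝ = fromℚ 1ℚ

ℝ≥0 : Set
ℝ≥0 = ∃ λ x → 0ℝ ≤ᴿ x

⟨_⟩ : ℝ≥0 → ℝ
⟨_⟩ = proj₁

module _ (x : ℝ) where

  private
    Y : ℚ
    Y = proj₁ (bounded x)

    Y>0 : 0ℚ < Y
    Y>0 = proj₁ (proj₂ (bounded x))

    x≤Y : Eventually λ n → seq x n ≤ Y
    x≤Y = mapᵉ (λ {n} h → ≤-trans (p≤∣p∣ (seq x n)) h) (proj₂ (proj₂ (bounded x)))

  √-solvable : 0ℝ ≤ᴿ x → Solvable (λ _ q → q * q) x
  √-solvable x≥0 = record
    { continuous = *-continuous id-continuous id-continuous
    ; growth     = λ {η} η>0 → η * η , *-pos η>0 η>0 , 0 , λ _ _ a b h h′ → grow η a b (<⇒≤ η>0) h h′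
    ; bottom     = x≥0 _
    ; top        = Y + 1ℚ
    ; top>0      = +-pos Y>0 0<1
    ; below-top  = mapᵉ (λ h → ≤-trans h below) x≤Y
    }
    where
    grow : ∀ η a b → 0ℚ ≤ η → 0ℚ ≤ a → a + η ≤ b → a * a + η * η ≤ b * b
    grow η a b hη ha h = ≤-by (ha ⊠ hη ⊞ ha ⊠ hη ⊞ diff h ⊠ (≤-trans (ha ⊞ hη) h ⊞ (ha ⊞ hη))) (lem η a b)
      where
      lem : ∀ η a b → (a * a + η * η) + (a * η + a * η + (b - (a + η)) * (b + (a + η))) ≡ b * b
      lem = solve-∀ ℚ-ring
    below : Y ≤ (Y + 1ℚ) * (Y + 1ℚ)
    below = ≤-by (<⇒≤ Y>0 ⊠ <⇒≤ Y>0 ⊞ <⇒≤ Y>0 ⊞ 0≤1) (lem Y)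
      where
      lem : ∀ y → y + (y * y + y + 1ℚ) ≡ (y + 1ℚ) * (y + 1ℚ)
      lem = solve-∀ ℚ-ring

  log-solvable : 1ℝ ≤ᴿ x → Solvable expSum x
  log-solvable x≥1 = record
    { continuous = expSum-continuous
    ; growth     = λ {η} η>0 → η , η>0 , 1 , λ n h a b → grow η n h a b (<⇒≤ η>0)
    ; bottom     = λ δ>0 → mapᵉ (λ {n} h → ≤-trans (≤-reflexive (expSum-0 n)) h) (x≥1 _ δ>0)
    ; top        = Y
    ; top>0      = Y>0
    ; below-top  = mapᵉ (λ { {n} (h , 1≤n) → ≤-trans h (below n 1≤n) }) (x≤Y ∧ᵉ (1 , λ _ h → h))
    }
    where
    grow : ∀ η n → 1 ℕ.≤ n → ∀ a b → 0ℚ ≤ η → 0ℚ ≤ a → a + η ≤ b → expSum n a + η ≤ expSum n b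
    grow η n 1≤n a b hη ha h = ≤-trans (≤-by (diff h) (lem (expSum n a) η a b))
      (expSum-growth 1≤n ha (≤-trans (≤-by hη refl) h))
      where
      lem : ∀ e η a b → e + η + (b - (a + η)) ≡ e + (b - a)
      lem = solve-∀ ℚ-ring
    below : ∀ n → 1 ℕ.≤ n → Y ≤ expSum n Y
    below n 1≤n = ≤-trans (≤-by 0≤1 (trans (lem Y) (cong (_+ (Y - 0ℚ)) (sym (expSum-0 n)))))
      (expSum-growth 1≤n ≤-refl (<⇒≤ Y>0))
      where
      lem : ∀ y → y + 1ℚ ≡ 1ℚ + (y - 0ℚ)
      lem = solve-∀ ℚ-ring

  W-solvable : 0ℝ ≤ᴿ x → Solvable (λ n q → q * expSum n q) x
  W-solvable x≥0 = record
    { continuous = *-continuous id-continuous expSum-continuous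
    ; growth     = λ {η} η>0 → η , η>0 , 1 , λ n h a b → grow η n h a b (<⇒≤ η>0)
    ; bottom     = λ {δ} δ>0 → mapᵉ (λ {n} h → ≤-trans (≤-reflexive (*-zeroˡ (expSum n 0ℚ))) h) (x≥0 _ δ>0)
    ; top        = Y
    ; top>0      = Y>0
    ; below-top  = mapᵉ (λ {n} h → ≤-trans h (below n)) x≤Y
    }
    where
    grow : ∀ η n → 1 ℕ.≤ n → ∀ a b → 0ℚ ≤ η → 0ℚ ≤ a → a + η ≤ b →
      a * expSum n a + η ≤ b * expSum n b
    grow η n 1≤n a b hη ha h = ≤-by
      (diff h ⊠ ≤-trans 0≤1 (1≤expSum n (≤-trans ha a≤b))
        ⊞ (ha ⊞ hη) ⊠ diff (≤-trans (≤-by (diff a≤b) refl) (expSum-growth 1≤n ha a≤b))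
        ⊞ hη ⊠ diff (1≤expSum n ha))
      (lem η a b (expSum n a) (expSum n b))
      where
      a≤b : a ≤ b
      a≤b = ≤-trans (≤-by hη refl) h
      lem : ∀ η a b e e′ → (a * e + η) +
        ((b - (a + η)) * e′ + (a + η) * (e′ - e) + η * (e - 1ℚ)) ≡ b * e′
      lem = solve-∀ ℚ-ring
    below : ∀ n → Y ≤ Y * expSum n Y
    below n = ≤-trans (≤-reflexive (sym (*-identityʳ Y)))
      (*-monoˡ-≤-nonNeg Y {{nonNegative (<⇒≤ Y>0)}} (1≤expSum n (<⇒≤ Y>0)))

  recip-solvable : 0ℝ <ᴿ x → Solvable (λ n q → q * seq x n) 1ℝ
  recip-solvable (c , c>0 , e) = record
    { continuous = *-continuous id-continuous (const-continuous x)
    ; growth     = λ {η} η>0 → η * c , *-pos η>0 c>0 ,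
                   mapᵉ (λ {n} k a b _ h → grow η a b (seq x n) (<⇒≤ η>0) k h) c≤x
    ; bottom     = λ {δ} δ>0 → 0 , λ n _ → ≤-trans (≤-reflexive (*-zeroˡ (seq x n)))
                   (0≤1 ⊞ <⇒≤ δ>0)
    ; top        = r
    ; top>0      = r>0
    ; below-top  = mapᵉ (λ {n} k → ≤-trans (≤-reflexive (sym (trans (*-comm r c) cr≡1)))
                   (*-monoˡ-≤-nonNeg r {{nonNegative (<⇒≤ r>0)}} k)) c≤x
    }
    where
    c≤x : Eventually λ n → c ≤ seq x n
    c≤x = mapᵉ (λ k → ≤-trans (≤-reflexive (sym (+-identityˡ c))) k) e
    r : ℚ
    r = proj₁ (invert c>0)
    r>0 : 0ℚ < r
    r>0 = proj₁ (proj₂ (invert c>0))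
    cr≡1 : c * r ≡ 1ℚ
    cr≡1 = proj₂ (proj₂ (invert c>0))
    grow : ∀ η a b y → 0ℚ ≤ η → c ≤ y → a + η ≤ b → a * y + η * c ≤ b * y
    grow η a b y hη k h = ≤-by (diff h ⊠ ≤-trans (<⇒≤ c>0) k ⊞ hη ⊠ diff k) (lem η a b y c)
      where
      lem : ∀ η a b y c → (a * y + η * c) + ((b - (a + η)) * y + η * (y - c)) ≡ b * y
      lem = solve-∀ ℚ-ring

-- √, log, W and recip are the solutions of the equations in √-spec, log-spec,
-- W-spec and recip-spec; on the given domains these are unique up to _≃ᴿ_.
√ : ℝ≥0 → ℝ≥0
√ (x , x≥0) = solution , solution≥0
  where open Solve (√-solvable x x≥0)

√-spec : ∀ x → ⟨ √ x ⟩ *ᴿ ⟨ √ x ⟩ ≃ᴿ ⟨ x ⟩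
√-spec (x , x≥0) = Solve.solves (√-solvable x x≥0)

√-pos : ∀ x → 0ℝ <ᴿ ⟨ x ⟩ → 0ℝ <ᴿ ⟨ √ x ⟩
√-pos (x , x≥0) = Solve.solution>0 (√-solvable x x≥0)

-- Only for arguments ≥ 1, where the value is nonnegative.
log : (x : ℝ) → 1ℝ ≤ᴿ x → ℝ≥0
log x x≥1 = solution , solution≥0
  where open Solve (log-solvable x x≥1)

log-spec : ∀ x x≥1 → exp ⟨ log x x≥1 ⟩ ≃ᴿ x
log-spec x x≥1 = Solve.solves (log-solvable x x≥1)

log-pos : ∀ x x≥1 → 1ℝ <ᴿ x → 0ℝ <ᴿ ⟨ log x x≥1 ⟩
log-pos x x≥1 (δ , δ>0 , e) = Solve.solution>0 (log-solvable x x≥1)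
  (δ , δ>0 , mapᵉ (λ {n} h → ≤-trans (≤-reflexive (cong (_+ δ) (expSum-0 n))) h) e)

W : ℝ≥0 → ℝ≥0
W (x , x≥0) = solution , solution≥0
  where open Solve (W-solvable x x≥0)

W-spec : ∀ x → ⟨ W x ⟩ *ᴿ exp ⟨ W x ⟩ ≃ᴿ ⟨ x ⟩
W-spec (x , x≥0) = Solve.solves (W-solvable x x≥0)

recip : (x : ℝ) → 0ℝ <ᴿ x → ℝ
recip x x>0 = Solve.solution (recip-solvable x x>0)

recip-spec : ∀ x x>0 → recip x x>0 *ᴿ x ≃ᴿ 1ℝ
recip-spec x x>0 = Solve.solves (recip-solvable x x>0)

infixl 7 _÷_[_]
_÷_[_] : ℝ → (y : ℝ) → 0ℝ <ᴿ y → ℝ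
x ÷ y [ y>0 ] = x *ᴿ recip y y>0

1≤fromℕ : ∀ {n} → 2 ℕ.≤ n → 1ℝ ≤ᴿ fromℕ n
1≤fromℕ h _ δ>0 = 0 , λ _ _ → ≤-trans (ι-mono (ℕP.≤-trans (ℕ.s≤s ℕ.z≤n) h)) (≤-by (<⇒≤ δ>0) refl)

1<fromℕ : ∀ {n} → 2 ℕ.≤ n → 1ℝ <ᴿ fromℕ n
1<fromℕ h = 1ℚ , 0<1 , 0 , λ _ _ → ι-mono h

log-n : ∀ n → 2 ℕ.≤ n → ℝ≥0
log-n n h = log (fromℕ n) (1≤fromℕ h)

log-n>0 : ∀ n h → 0ℝ <ᴿ ⟨ log-n n h ⟩
log-n>0 n h = log-pos (fromℕ n) (1≤fromℕ h) (1<fromℕ h)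

Tends-to-0 : (ℕ → ℝ) → Set
Tends-to-0 ε = ∀ δ → 0ℚ < δ → Eventually λ n → fromℚ (- δ) ≤ᴿ ε n × ε n ≤ᴿ fromℚ δ

record Graph (n : ℕ) : Set₁ where
  infix 4 _∼_ _∼?_
  field
    nonempty  : 0 ℕ.< n
    _∼_       : Fin n → Fin n → Set
    _∼?_      : Binary.Decidable _∼_
    sym-∼     : ∀ {u v} → u ∼ v → v ∼ u
    irrefl-∼  : ∀ {v} → ¬ v ∼ v
    connected : ∀ u v → Star _∼_ u v

module Game {n : ℕ} (G : Graph n) where
  open Graph G

  Move : Fin n → Fin n → Set
  Move u v = u ≡ v ⊎ u ∼ v

  Cops : ℕ → Set
  Cops k = Vec (Fin n) k

  CopsMove : ∀ {k} → Cops k → Cops k → Set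
  CopsMove c c′ = ∀ i → Move (lookup c i) (lookup c′ i)

  Captured : ∀ {k} → Cops k → Fin n → Set
  Captured c r = ∃ λ i → lookup c i ≡ r

  -- Position with the cops to move: they can force a capture within m further
  -- rounds.  A capture by the cops' half of a round counts that round.
  Catch : ∀ {k} → ℕ → Cops k → Fin n → Set
  Catch zero    c r = Captured c r
  Catch (suc m) c r = Captured c r ⊎
    ∃ λ c′ → CopsMove c c′ × (Captured c′ r ⊎ ∀ r′ → Move r r′ → Catch m c′ r′)

  WinWithin : ℕ → ℕ → Set
  WinWithin k m = ∃ λ (c : Cops k) → ∀ r → Catch m c r

IsLeast : (ℕ → Set) → ℕ → Set
IsLeast P m = P m × ∀ j → P j → m ℕ.≤ j

module _ {n : ℕ} (G : Graph n) where
  open Graph G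
  open Game G

  IsCaptureTime : ℕ → ℕ → Set
  IsCaptureTime k = IsLeast (WinWithin k)

  -- When k is below the cop number no m is a capture time, so such k
  -- (where the capture time is ∞) do not contribute to the minimum.
  IsThrottlingNumber : ℕ → Set
  IsThrottlingNumber = IsLeast λ t → ∃ λ k → ∃ λ m → 1 ℕ.≤ k × IsCaptureTime k m × k ℕ.+ m ≡ t

anyVec? : ∀ {n k} {P : Vec (Fin n) k → Set} → Decidable P → Dec (∃ P)
anyVec? {k = zero} P? = map′ ([] ,_) (λ { ([] , p) → p }) (P? [])
anyVec? {k = suc k} P? = map′ (λ { (x , xs , p) → x ∷ xs , p }) (λ { (x ∷ xs , p) → x , xs , p })
  (any? λ x → anyVec? λ xs → P? (x ∷ xs))

least : ∀ {P : ℕ → Set} → Decidable P → ∀ {m} → P m → ∃ (IsLeast P)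
least P? {zero} p = 0 , p , λ _ _ → ℕ.z≤n
least {P} P? {suc m} p with P? 0
... | yes p₀ = 0 , p₀ , λ _ _ → ℕ.z≤n
... | no ¬p₀ with least {λ j → P (suc j)} (λ j → P? (suc j)) p
... | j , q , min = suc j , q , λ { zero p₀ → contradiction p₀ ¬p₀ ; (suc i) r → ℕ.s≤s (min i r) }

module _ {n : ℕ} (G : Graph n) where
  open Graph G
  open Game G

  captured? : ∀ {k} (c : Cops k) r → Dec (Captured c r)
  captured? c r = any? λ i → lookup c i Fin.≟ r

  move? : ∀ u v → Dec (Move u v)
  move? u v = u Fin.≟ v ⊎-dec u ∼? v

  catch? : ∀ {k} m (c : Cops k) r → Dec (Catch m c r)
  catch? zero c r = captured? c r
  catch? (suc m) c r = captured? c r ⊎-dec anyVec? λ c′ →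
    all? (λ i → move? (lookup c i) (lookup c′ i)) ×-dec
    (captured? c′ r ⊎-dec all? λ r′ → move? r r′ →-dec catch? m c′ r′)

  winWithin? : ∀ k m → Dec (WinWithin k m)
  winWithin? k m = anyVec? λ c → all? (catch? m c)

  Budget : ℕ → Set
  Budget t = ∃ λ k → ∃ λ m → 1 ℕ.≤ k × WinWithin k m × k ℕ.+ m ≡ t

  budget? : Decidable Budget
  budget? t = map′
    (λ { (i , 1≤k , w) → toℕ i , t ℕ.∸ toℕ i , 1≤k , w , ℕP.m+[n∸m]≡n (ℕP.<⇒≤pred (toℕ<n i)) })
    (λ { (k , m , 1≤k , w , refl) → let k< = ℕ.s≤s (ℕP.m≤m+n k m) ; e = toℕ-fromℕ< k< in
      fromℕ< k< , subst (1 ℕ.≤_) (sym e) 1≤k ,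
      subst₂ WinWithin (sym e) (sym (trans (cong (k ℕ.+ m ℕ.∸_) e) (ℕP.m+n∸m≡n k m))) w })
    (any? {suc t} λ i → (1 ℕP.≤? toℕ i) ×-dec winWithin? (toℕ i) (t ℕ.∸ toℕ i))

  throttling : ∃ (IsThrottlingNumber G)
  throttling with least budget? (n , 0 , nonempty , (allFin n , λ r → r , lookup-allFin r) , refl)
  ... | t , (k , m , 1≤k , w , e) , min =
    t ,
    (k , m , 1≤k ,
      (w , λ j w′ → ℕP.+-cancelˡ-≤ k m j
        (subst (ℕ._≤ k ℕ.+ j) (sym e) (min (k ℕ.+ j) (k , j , 1≤k , w′ , refl)))) , e) ,
    λ { j (k′ , m′ , 1≤k′ , (w′ , _) , e′) → min j (k′ , m′ , 1≤k′ , w′ , e′) }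

thc : ∀ {n} → Graph n → ℕ
thc G = proj₁ (throttling G)

thc-spec : ∀ {n} (G : Graph n) → IsThrottlingNumber G (thc G)
thc-spec G = proj₂ (throttling G)

{-# OPTIONS --safe #-}
module Submission where

-- Let M = 2 t². As long as some vertex has more than M neighbours (itself included)
-- in the territory U that the robber may still use, a single cop guards them. Otherwise,
-- if U contains a shortest path with M + 1 vertices, t + 1 equally spaced cops on it catch
-- within t rounds the shadow of the robber under a retraction of U onto the path, which
-- makes the path inaccessible. Either way at most 2 t + 1 cops and rounds are spent per
-- M + 1 vertices removed from U, about n / t in total. When neither applies, every
-- component of U has at most M ^ M vertices and radius less than M; a reserve of M ^ M cops
-- stationed within distance n / t² of every vertex then occupies the whole component of
-- the robber. This is affordable if M ^ M is at most n ^ (8/9).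
--
-- For the largest such t, N = 2 (t + 1)² satisfies N log N > (8/9) log n, which forces
-- e ^ W (log n) ≤ (9/8) N, and √W (log n) / √(log n) is 1 / √(e ^ W (log n)). Since guarding
-- a path from both sides of the shadow saves a factor √2, the bound even holds with ε n = 0
-- for all large n.

open import Data.Nat.Base using (ℕ)
open import Data.Product.Base using (∃; _×_; _,_; proj₁; proj₂)
open import Function.Base using (_∘_)
open import Relation.Binary.PropositionalEquality
open import Relation.Nullary using (¬_; Dec; yes; no; contradiction)
open import Defs

-- Strategies of the cops

module _ where

  open import Data.Empty using (⊥)
  open import Data.Fin.Base as Fin using (Fin; zero; suc; toℕ; fromℕ<; inject₁; splitAt; join; combine; remQuot)
  open import Data.Fin.Properties as Fin
    using (any?; injective⇒≤; combine-remQuot; remQuot-combine; splitAt-join; toℕ-inject₁; toℕ-fromℕ<)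
  open import Data.Fin.Subset as Subset using (Subset; _∈_; _-_; ∣_∣)
  open import Data.Fin.Subset.Properties using (_∈?_; ∈⊤; ∣⊤∣≡n; x∈p⇒∣p-x∣<∣p∣; x∈p∧x≢y⇒x∈p-y)
  open import Data.Nat.Base
  open import Data.Nat.DivMod
    using (_/_; _%_; m%n<n; m≡m%n+[m/n]*n; [m+kn]%n≡m%n; m<n⇒m%n≡m; m/n*n≤m; m<n*o⇒m/o<n)
  open import Data.Nat.Properties
  open import Data.Nat.Tactic.RingSolver using (solve-∀)
  open import Data.Product.Base using (uncurry)
  open import Data.Sum.Base as Sum using (_⊎_; inj₁; inj₂; [_,_]′; swap)
  open import Data.Unit.Base using (⊤; tt)
  open import Data.Vec.Base using (lookup; tabulate; allFin)
  open import Data.Vec.Properties using (lookup∘tabulate; lookup-allFin)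
  open import Function.Definitions using (Injective)
  open import Relation.Binary.Construct.Closure.ReflexiveTransitive using (Star; ε; _◅_)
  open import Relation.Binary.Definitions using (tri<; tri≈; tri>)
  open import Relation.Nullary using (¬?; _×-dec_; _⊎-dec_)
  open import Relation.Nullary.Decidable using (map′)
  open import Relation.Unary using (Decidable)

  -- Finite counting: injections, covers, pigeonhole

  m<suc[m/n]*n : ∀ m n .{{_ : NonZero n}} → m < suc (m / n) * n
  m<suc[m/n]*n m n = subst (_< n + m / n * n) (sym (m≡m%n+[m/n]*n m n)) (+-monoˡ-< (m / n * n) (m%n<n m n))

  Injects : ∀ {n} → (Fin n → Set) → ℕ → Set
  Injects {n} P k = ∃ λ (f : Fin k → Fin n) → Injective _≡_ _≡_ f × ∀ i → P (f i)

  -- At most `k` elements, listed with repetition; the filler `x` lets even an empty `P` have lists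
  -- of every positive length.
  Covers : ∀ {n} → (Fin n → Set) → Fin n → ℕ → Set
  Covers {n} P x k = ∃ λ (f : Fin k → Fin n) →
    (∀ i → P (f i) ⊎ f i ≡ x) × (∀ v → P v → ∃ λ i → f i ≡ v)

  module _ {n} {P : Fin n → Set} (P? : Decidable P) (x : Fin n) where

    extend : ∀ {k} → Injects P k → Injects P (suc k) ⊎ Covers P x k
    extend {k} (f , inj , p) with any? (λ v → P? v ×-dec ¬? (any? λ i → f i Fin.≟ v))
    ... | yes (v , pv , v∉f) = inj₁ (g , g-inj , λ { zero → pv ; (suc i) → p i })
      where
      g : Fin (suc k) → Fin n
      g zero = v
      g (suc i) = f i
      g-inj : Injective _≡_ _≡_ g
      g-inj {zero} {zero} _ = refl
      g-inj {zero} {suc j} e = contradiction (j , sym e) v∉f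
      g-inj {suc i} {zero} e = contradiction (i , e) v∉f
      g-inj {suc i} {suc j} e = cong suc (inj e)
    ... | no ¬v = inj₂ (f , (λ i → inj₁ (p i)) , cover)
      where
      cover : ∀ v → P v → ∃ λ i → f i ≡ v
      cover v pv with any? (λ i → f i Fin.≟ v)
      ... | yes h = h
      ... | no h = contradiction (v , pv , h) ¬v

    abstract
      -- Greedy choice: a list of distinct elements of `P` that cannot be extended already covers
      -- `P`, and from then on it is only padded with `x`.
      injects⊎covers : ∀ k → Injects P (suc k) ⊎ Covers P x k
      injects⊎covers zero = extend ((λ ()) , (λ { {()} }) , λ ())
      injects⊎covers (suc k) with injects⊎covers k
      ... | inj₁ f = extend f
      ... | inj₂ (f , in-P , cover) = inj₂
        ((λ { zero → x ; (suc i) → f i }) , (λ { zero → inj₂ refl ; (suc i) → in-P i }) ,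
         λ v pv → let i , e = cover v pv in suc i , e)

  abstract
    choose : ∀ {n} {A B : Fin n → Set} → (∀ i → A i ⊎ B i) → ∃ A ⊎ (∀ i → B i)
    choose {zero} _ = inj₂ λ ()
    choose {suc n} f with f zero | choose (f ∘ suc)
    ... | inj₁ a | _ = inj₁ (zero , a)
    ... | inj₂ _ | inj₁ (i , a) = inj₁ (suc i , a)
    ... | inj₂ b | inj₂ g = inj₂ λ { zero → b ; (suc i) → g i }

    -- Pigeonhole: if every fibre had `suc q` distinct elements, together they would inject
    -- `k * suc q` indices into `Fin n`.
    small-fibre : ∀ {n k} (h : Fin n → Fin k) (x : Fin n) q → n < k * suc q →
      ∃ λ j → Covers (λ v → h v ≡ j) x q
    small-fibre {n} {k} h x q n<
      with choose (λ j → swap (injects⊎covers (λ v → h v Fin.≟ j) x q))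
    ... | inj₁ c = c
    ... | inj₂ F = contradiction (injective⇒≤ {f = g ∘ remQuot (suc q)} inj) (<⇒≱ n<)
      where
      g : Fin k × Fin (suc q) → Fin n
      g (j , i) = proj₁ (F j) i
      g-injective : ∀ a b → g a ≡ g b → a ≡ b
      g-injective (j , i) (j′ , i′) e
        with trans (sym (proj₂ (proj₂ (F j)) i)) (trans (cong h e) (proj₂ (proj₂ (F j′)) i′))
      ... | refl = cong (j ,_) (proj₁ (proj₂ (F j)) e)
      inj : Injective _≡_ _≡_ (g ∘ remQuot (suc q))
      inj {a} {b} e = trans (sym (combine-remQuot {k} (suc q) a))
        (trans (cong (uncurry combine) (g-injective _ _ e)) (combine-remQuot {k} (suc q) b))

    remove : ∀ {n} k (f : Fin k → Fin n) → Injective _≡_ _≡_ f → (U : Subset n) → (∀ i → f i ∈ U) →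
      ∃ λ U′ → ∣ U′ ∣ + k ≤ ∣ U ∣ × (∀ v → v ∈ U → v ∈ U′ ⊎ ∃ λ i → f i ≡ v)
    remove zero f inj U h = U , ≤-reflexive (+-identityʳ ∣ U ∣) , λ v p → inj₁ p
    remove (suc k) f inj U h
      with remove k (f ∘ suc) (Fin.suc-injective ∘ inj) (U - f zero)
        (λ i → x∈p∧x≢y⇒x∈p-y (h (suc i)) λ e → contradiction (inj e) λ ())
    ... | U′ , le , cover = U′ , size , go
      where
      size : ∣ U′ ∣ + suc k ≤ ∣ U ∣
      size = ≤-trans (≤-reflexive (+-suc ∣ U′ ∣ k)) (≤-trans (s≤s le) (x∈p⇒∣p-x∣<∣p∣ (h zero)))
      go : ∀ v → v ∈ U → v ∈ U′ ⊎ ∃ λ i → f i ≡ v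
      go v p with f zero Fin.≟ v
      ... | yes e = inj₂ (zero , e)
      ... | no ne with cover v (x∈p∧x≢y⇒x∈p-y p (ne ∘ sym))
      ... | inj₁ q = inj₁ q
      ... | inj₂ (i , e) = inj₂ (suc i , e)

  Near₁ : ℕ → ℕ → Set
  Near₁ x y = x ≤ suc y × y ≤ suc x

  toward : ∀ s x → ∃ λ y → Near₁ x y × (x < s → y ≡ suc x) × (s < x → suc y ≡ x)
  toward s x with <-cmp x s
  ... | tri< l _ g = suc x , (m≤n⇒m≤1+n (n≤1+n x) , ≤-refl) , (λ _ → refl) , λ h → contradiction h g
  ... | tri≈ l _ g = x , (n≤1+n x , n≤1+n x) , (λ h → contradiction h l) , λ h → contradiction h g
  toward s (suc x) | tri> l _ g = x , (≤-refl , m≤n⇒m≤1+n (n≤1+n x)) , (λ h → contradiction h l) , λ _ → refl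

  between : ∀ g t s → s ≤ g * suc t → ∃ λ (j : Fin (suc t)) → g * toℕ j ≤ s × s ≤ g * suc (toℕ j)
  between g zero s h = zero , ≤-trans (≤-reflexive (*-zeroʳ g)) z≤n , h
  between g (suc t) s h with ≤-total s (g * suc t)
  ... | inj₁ l with between g t s l
  ... | j , p , q = inject₁ j , subst (λ i → g * i ≤ s) (sym (toℕ-inject₁ j)) p ,
    subst (λ i → s ≤ g * suc i) (sym (toℕ-inject₁ j)) q
  between g (suc t) s h | inj₂ l = Fin.fromℕ (suc t) ,
    subst (λ i → g * i ≤ s) (sym (Fin.toℕ-fromℕ (suc t))) l ,
    subst (λ i → s ≤ g * suc i) (sym (Fin.toℕ-fromℕ (suc t))) h

  update : ∀ {k} {A : Set} → (Fin k → A) → Fin k → A → Fin k → A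
  update d i a j with j Fin.≟ i
  ... | yes _ = a
  ... | no _ = d j

  update-at : ∀ {k} {A : Set} (d : Fin k → A) i a → update d i a i ≡ a
  update-at d i a with i Fin.≟ i
  ... | yes _ = refl
  ... | no ne = contradiction refl ne

  -- The game with teams indexed by arbitrary types

  module _ {n : ℕ} (G : Graph n) where
    open Graph G
    open Game G

    private
      V : Set
      V = Fin n

    move-refl : ∀ {v} → Move v v
    move-refl = inj₁ refl

    move-sym : ∀ {u v} → Move u v → Move v u
    move-sym (inj₁ e) = inj₁ (sym e)
    move-sym (inj₂ a) = inj₂ (sym-∼ a)

    Caught : {I : Set} → (I → V) → V → Set
    Caught c r = ∃ λ i → c i ≡ r

    Moves : {I : Set} → (I → V) → (I → V) → Set
    Moves c c′ = ∀ i → Move (c i) (c′ i)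

    -- This is `Catch` with positions as functions on any index type, so that teams are joined by
    -- `⊎` without arithmetic on indices.
    Win : {I : Set} → ℕ → (I → V) → V → Set
    Win zero c r = Caught c r
    Win (suc m) c r = Caught c r ⊎
      ∃ λ c′ → Moves c c′ × (Caught c′ r ⊎ ∀ r′ → Move r r′ → Win m c′ r′)

    module _ {A B : Set} (e : A → B) (s : B → A) (es : ∀ b → e (s b) ≡ b) where

      caught-reindex : ∀ {c d r} → (∀ a → d a ≡ c (e a)) → Caught c r → Caught d r
      caught-reindex {c} h (b , q) = s b , trans (h (s b)) (trans (cong c (es b)) q)

      -- Cop `a` imitates cop `e a`, and the section `s` ensures that every cop of the winning team
      -- is imitated. The pointwise hypothesis avoids function extensionality.
      win-reindex : ∀ m {c d r} → (∀ a → d a ≡ c (e a)) → Win m c r → Win m d r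
      win-reindex zero h w = caught-reindex h w
      win-reindex (suc m) h (inj₁ w) = inj₁ (caught-reindex h w)
      win-reindex (suc m) h (inj₂ (c′ , mv , w)) = inj₂ (c′ ∘ e ,
        (λ a → subst (λ x → Move x (c′ (e a))) (sym (h a)) (mv (e a))) ,
        [ (λ q → inj₁ (caught-reindex (λ _ → refl) q)) ,
          (λ f → inj₂ λ r′ m′ → win-reindex m (λ _ → refl) (f r′ m′)) ]′ w)

    win-suc : ∀ m {I} {c : I → V} {r} → Win m c r → Win (suc m) c r
    win-suc zero w = inj₁ w
    win-suc (suc m) (inj₁ w) = inj₁ w
    win-suc (suc m) (inj₂ (c′ , mv , inj₁ w)) = inj₂ (c′ , mv , inj₁ w)
    win-suc (suc m) (inj₂ (c′ , mv , inj₂ f)) = inj₂ (c′ , mv , inj₂ λ r′ m′ → win-suc m (f r′ m′))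

    win-+ : ∀ j m {I} {c : I → V} {r} → Win m c r → Win (j + m) c r
    win-+ zero m w = w
    win-+ (suc j) m w = win-suc (j + m) (win-+ j m w)

    win⇒catch : ∀ {k} m {c : Fin k → V} {r v} → (∀ i → lookup v i ≡ c i) → Win m c r → Catch m v r
    win⇒catch zero h (i , q) = i , trans (h i) q
    win⇒catch (suc m) h (inj₁ (i , q)) = inj₁ (i , trans (h i) q)
    win⇒catch (suc m) h (inj₂ (c′ , mv , w)) = inj₂ (tabulate c′ ,
      (λ i → subst₂ Move (sym (h i)) (sym (lookup∘tabulate c′ i)) (mv i)) ,
      [ (λ { (i , q) → inj₁ (i , trans (lookup∘tabulate c′ i) q) }) ,
        (λ f → inj₂ λ r′ m′ → win⇒catch m (lookup∘tabulate c′) (f r′ m′)) ]′ w)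

    -- Confining the robber to a territory

    -- H is a position with the cops to move that they can maintain for as long as
    -- the robber stays in U; as soon as he leaves U they catch him.
    Confines : Subset n → {I : Set} → ((I → V) → V → Set) → Set
    Confines U H = ∀ {c r} → H c r → ∃ λ c′ → Moves c c′ ×
      (Caught c′ r ⊎ (r ∈ U × ∀ r′ → Move r r′ → H c′ r′))

    -- k further cops, starting at p, that win within T rounds together with any team
    -- that confines the robber to U.
    Plan : Subset n → ℕ → ℕ → Set₁
    Plan U k T = ∃ λ (p : Fin k → V) → ∀ {I : Set} (H : (I → V) → V → Set) → Confines U H →
      ∀ {c r} → H c r → Win T [ c , p ]′ r

    -- Within τ rounds, cops starting at q extend any team confining the robber to U to one
    -- confining him to U′ (in continuation form, since the outcome depends on his moves).
    Restricts : ∀ {j} → (Fin j → V) → Subset n → Subset n → ℕ → Set₁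
    Restricts {j} q U U′ τ = ∀ {I : Set} (H : (I → V) → V → Set) → Confines U H →
      ∃ λ (H′ : (I ⊎ Fin j → V) → V → Set) → Confines U′ H′ ×
        (∀ {K : Set} (p : K → V) T → (∀ {d r} → H′ d r → Win T [ d , p ]′ r) →
          ∀ {c r} → H c r → Win (τ + T) [ [ c , q ]′ , p ]′ r)

    -- The cops `p` wait while the cops `q` join the confining team; the plan for `U′` is then run
    -- against the enlarged team. The rest only reassociates the index types.
    plan-restrict : ∀ {j k τ T U U′} (q : Fin j → V) → Restricts q U U′ τ → Plan U′ k T → Plan U (j + k) (τ + T)
    plan-restrict {j} {k} {τ} {T} q R (p , P) = [ q , p ]′ ∘ splitAt j , win
      where
      win : ∀ {I : Set} (H : (I → V) → V → Set) → Confines _ H → ∀ {c r} → H c r →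
        Win (τ + T) [ c , [ q , p ]′ ∘ splitAt j ]′ r
      win {I} H conf {c} h with R H conf
      ... | H′ , conf′ , first = win-reindex e s es (τ + T) agree (first p T (λ h′ → P H′ conf′ h′) h)
        where
        e₂ : Fin j ⊎ Fin k → (I ⊎ Fin j) ⊎ Fin k
        e₂ (inj₁ i) = inj₁ (inj₂ i)
        e₂ (inj₂ i) = inj₂ i
        e : I ⊎ Fin (j + k) → (I ⊎ Fin j) ⊎ Fin k
        e (inj₁ i) = inj₁ (inj₁ i)
        e (inj₂ i) = e₂ (splitAt j i)
        s : (I ⊎ Fin j) ⊎ Fin k → I ⊎ Fin (j + k)
        s (inj₁ (inj₁ i)) = inj₁ i
        s (inj₁ (inj₂ i)) = inj₂ (join j k (inj₁ i))
        s (inj₂ i) = inj₂ (join j k (inj₂ i))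
        es : ∀ b → e (s b) ≡ b
        es (inj₁ (inj₁ i)) = refl
        es (inj₁ (inj₂ i)) = cong e₂ (splitAt-join j k (inj₁ i))
        es (inj₂ i) = cong e₂ (splitAt-join j k (inj₂ i))
        agree : ∀ a → [ c , [ q , p ]′ ∘ splitAt j ]′ a ≡ [ [ c , q ]′ , p ]′ (e a)
        agree (inj₁ i) = refl
        agree (inj₂ i) with splitAt j i
        ... | inj₁ _ = refl
        ... | inj₂ _ = refl

    [_,_]-moves : ∀ {I J : Set} {c c′ : I → V} {d d′ : J → V} → Moves c c′ → Moves d d′ →
      Moves [ c , d ]′ [ c′ , d′ ]′
    [ f , g ]-moves (inj₁ i) = f i
    [ f , g ]-moves (inj₂ j) = g j

    stay : ∀ {I : Set} {c : I → V} → Moves c c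
    stay _ = move-refl

    -- The guard leaves `v` only to capture: a robber in `U` but outside `U′` stands within one move
    -- of `v` when the cops are to move.
    star-restricts : ∀ {U U′} v → (∀ x → x ∈ U → x ∈ U′ ⊎ Move v x) → Restricts {1} (λ _ → v) U U′ 0
    star-restricts {U} {U′} v split {I} H conf = H′ , conf′ ,
      λ p T win {c} h → win {[ c , (λ _ → v) ]′} (h , refl)
      where
      H′ : (I ⊎ Fin 1 → V) → V → Set
      H′ d r = H (d ∘ inj₁) r × d (inj₂ zero) ≡ v
      moves₁ : ∀ {c : I ⊎ Fin 1 → V} {c′ w} → Moves (c ∘ inj₁) c′ → Move (c (inj₂ zero)) w →
        Moves c [ c′ , (λ _ → w) ]′
      moves₁ f g (inj₁ i) = f i
      moves₁ f g (inj₂ zero) = g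
      conf′ : Confines U′ H′
      conf′ {d} {r} (h , refl) with conf h
      ... | c′ , mv , inj₁ (i , q) = [ c′ , (λ _ → v) ]′ , moves₁ mv move-refl , inj₁ (inj₁ i , q)
      ... | c′ , mv , inj₂ (r∈U , f) with split r r∈U
      ... | inj₂ m = [ c′ , (λ _ → r) ]′ , moves₁ mv m , inj₁ (inj₂ zero , refl)
      ... | inj₁ r∈U′ = [ c′ , (λ _ → v) ]′ , moves₁ mv move-refl , inj₂ (r∈U′ , λ r′ m → f r′ m , refl)

    -- Guarding a shortest path

    -- A retraction ℓ of U onto a path P: the cops chase the shadow P (ℓ r) of the robber r.
    record Shadow (U : Subset n) (L : ℕ) : Set where
      field
        P       : ℕ → V
        P-step  : ∀ i → Move (P i) (P (suc i))
        ℓ       : V → ℕ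
        ℓ≤L     : ∀ v → ℓ v ≤ L
        ℓ-step  : ∀ {v w} → v ∈ U → w ∈ U → Move v w → ℓ w ≤ suc (ℓ v)

      P-near : ∀ {i j} → Near₁ i j → Move (P i) (P j)
      P-near {i} {j} (h , h′) with <-cmp i j
      ... | tri≈ _ refl _ = move-refl
      ... | tri< l _ _ = subst (λ k → Move (P i) (P k)) (≤-antisym l h′) (P-step i)
      ... | tri> _ _ l = subst (λ k → Move (P k) (P j)) (≤-antisym l h) (move-sym (P-step j))

      ℓ-near : ∀ {v w} → v ∈ U → w ∈ U → Move v w → Near₁ (ℓ v) (ℓ w)
      ℓ-near p q m = ℓ-step q p (move-sym m) , ℓ-step p q m

    module _ {U U′ : Subset n} {t₀} {L} (Sh : Shadow U L)
      (L≤ : L ≤ (suc t₀ + suc t₀) * suc t₀) where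
      open Shadow Sh

      private
        t : ℕ
        t = suc t₀

      -- On a vertex fixed by the retraction the robber coincides with his shadow, so a cop who
      -- steps onto the shadow in every round captures him there.
      path-restricts : (∀ v → v ∈ U → v ∈ U′ ⊎ P (ℓ v) ≡ v) →
        Restricts {suc t} (λ i → P ((t + t) * toℕ i)) U U′ t
      path-restricts split {I} H conf = H′ , conf′ , λ p T win h → start p T win h
        where
        H′ : (I ⊎ Fin (suc t) → V) → V → Set
        -- Invariant with the cops to move: some new cop is within one step of the shadow. He steps
        -- onto it, and the robber's reply moves the shadow by at most one step.
        H′ d r = H (d ∘ inj₁) r × (r ∈ U → ∃ λ i → Move (d (inj₂ i)) (P (ℓ r)))
        moves : ∀ {c : I ⊎ Fin (suc t) → V} {c′ d′} → Moves (c ∘ inj₁) c′ → Moves (c ∘ inj₂) d′ →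
          Moves c [ c′ , d′ ]′
        moves f g (inj₁ i) = f i
        moves f g (inj₂ i) = g i
        update-moves : ∀ {k} (d : Fin k → V) i {a} → Move (d i) a → Moves d (update d i a)
        update-moves d i m j with j Fin.≟ i
        ... | yes refl = m
        ... | no _ = move-refl
        conf′ : Confines U′ H′
        conf′ {d} {r} (h , near) with conf h
        ... | c′ , mv , inj₁ (i , q) = [ c′ , d ∘ inj₂ ]′ , moves mv stay , inj₁ (inj₁ i , q)
        ... | c′ , mv , inj₂ (r∈U , f) with near r∈U
        ... | i , m = [ c′ , d′ ]′ , moves mv (update-moves (d ∘ inj₂) i m) , result (split r r∈U)
          where
          d′ : Fin (suc t) → V
          d′ = update (d ∘ inj₂) i (P (ℓ r))
          at : d′ i ≡ P (ℓ r)
          at = update-at (d ∘ inj₂) i (P (ℓ r))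
          result : r ∈ U′ ⊎ P (ℓ r) ≡ r → _
          result (inj₂ e) = inj₁ (inj₂ i , trans at e)
          result (inj₁ r∈U′) = inj₂ (r∈U′ , λ r′ m′ → f r′ m′ ,
            λ r′∈U → i , subst (λ x → Move x _) (sym at) (P-near (ℓ-near r∈U r′∈U m′)))

        module _ {K : Set} (p : K → V) (T : ℕ) (win : ∀ {d r} → H′ d r → Win T [ d , p ]′ r) where

          -- The cops `a` and `b` flank the shadow and both step towards it, so their gap shrinks by
          -- two per round until one of them meets it. Flanking is required only for `r` in `U`:
          -- outside `U` the old team captures.
          chase : ∀ ρ {c r} → H c r → ∀ x a b → (r ∈ U → x a ≤ ℓ r × ℓ r ≤ x b) →
            x b ≤ x a + (ρ + ρ) → Win (ρ + T) [ [ c , P ∘ x ]′ , p ]′ r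
          chase ρ {c} {r} h x a b flank gap with r ∈? U
          ... | no r∉U = win-+ ρ T (win (h , λ r∈U → contradiction r∈U r∉U))
          ... | yes r∈U with x a ≟ ℓ r | x b ≟ ℓ r
          ... | yes e | _ = win-+ ρ T (win (h , λ _ → a , inj₁ (cong P e)))
          ... | no _ | yes e = win-+ ρ T (win (h , λ _ → b , inj₁ (cong P e)))
          ... | no na | no nb = squeeze ρ gap
            where
            a<r : x a < ℓ r
            a<r = ≤∧≢⇒< (proj₁ (flank r∈U)) na
            r<b : ℓ r < x b
            r<b = ≤∧≢⇒< (proj₂ (flank r∈U)) (nb ∘ sym)
            squeeze : ∀ ρ → x b ≤ x a + (ρ + ρ) → Win (ρ + T) [ [ c , P ∘ x ]′ , p ]′ r
            squeeze zero gap = contradiction (<-trans a<r r<b) (≤⇒≯ (subst (x b ≤_) (+-identityʳ (x a)) gap))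
            squeeze (suc ρ) gap with conf h
            ... | c′ , mv , result = inj₂ ([ [ c′ , P ∘ y ]′ , p ]′ ,
                [ [ mv , (λ i → P-near (proj₁ (proj₂ (toward (ℓ r) (x i))))) ]-moves , stay ]-moves ,
                finish result)
              where
              y : Fin (suc t) → ℕ
              y i = proj₁ (toward (ℓ r) (x i))
              ya : y a ≡ suc (x a)
              ya = proj₁ (proj₂ (proj₂ (toward (ℓ r) (x a)))) a<r
              yb : suc (y b) ≡ x b
              yb = proj₂ (proj₂ (proj₂ (toward (ℓ r) (x b)))) r<b
              ya≤ : y a ≤ ℓ r
              ya≤ = subst (_≤ ℓ r) (sym ya) a<r
              ≤yb : ℓ r ≤ y b
              ≤yb = s≤s⁻¹ (subst (ℓ r <_) (sym yb) r<b)
              gap′ : y b ≤ y a + (ρ + ρ)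
              gap′ = s≤s⁻¹ (subst₂ _≤_ (sym yb)
                (trans (+-suc (x a) (ρ + suc ρ)) (trans (cong (λ z → suc (x a) + z) (+-suc ρ ρ))
                  (trans (+-suc (suc (x a)) (ρ + ρ)) (cong (λ z → suc (z + (ρ + ρ))) (sym ya))))) gap)
              finish : Caught c′ r ⊎ (r ∈ U × ∀ r′ → Move r r′ → H c′ r′) →
                Caught [ [ c′ , P ∘ y ]′ , p ]′ r ⊎
                (∀ r′ → Move r r′ → Win (ρ + T) [ [ c′ , P ∘ y ]′ , p ]′ r′)
              finish (inj₁ (i , q)) = inj₁ (inj₁ (inj₁ i) , q)
              finish (inj₂ (_ , f)) = inj₂ λ r′ m → next r′ m (y a ≟ ℓ r) (y b ≟ ℓ r)
                where
                next : ∀ r′ → Move r r′ → Dec (y a ≡ ℓ r) → Dec (y b ≡ ℓ r) → Win (ρ + T) [ [ c′ , P ∘ y ]′ , p ]′ r′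
                next r′ m (yes e) _ = win-+ ρ T (win (f r′ m , λ r′∈U →
                  a , subst (λ k → Move (P k) (P (ℓ r′))) (sym e) (P-near (ℓ-near r∈U r′∈U m))))
                next r′ m (no _) (yes e) = win-+ ρ T (win (f r′ m , λ r′∈U →
                  b , subst (λ k → Move (P k) (P (ℓ r′))) (sym e) (P-near (ℓ-near r∈U r′∈U m))))
                next r′ m (no na′) (no nb′) = chase ρ (f r′ m) y a b
                  (λ r′∈U → let l , u = ℓ-near r∈U r′∈U m in
                    s≤s⁻¹ (≤-trans (≤∧≢⇒< ya≤ na′) l) ,
                    ≤-trans u (≤∧≢⇒< ≤yb (nb′ ∘ sym)))
                  gap′

          start : ∀ {c r} → H c r → Win (t + T) [ [ c , (λ i → P ((t + t) * toℕ i)) ]′ , p ]′ r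
          -- Adjacent starting points on the path are `t + t` apart, so the two cops around the
          -- shadow need at most `t` rounds.
          start {c} {r} h with between (t + t) t₀ (ℓ r) (≤-trans (ℓ≤L r) L≤)
          ... | j , l , u = chase t h (λ i → (t + t) * toℕ i) (inject₁ j) (suc j)
            (λ _ → subst (λ i → (t + t) * i ≤ ℓ r) (sym (toℕ-inject₁ j)) l , u)
            (≤-reflexive (trans (*-suc (t + t) (toℕ j)) (trans (+-comm (t + t) _)
              (cong (λ i → (t + t) * i + (t + t)) (sym (toℕ-inject₁ j))))))

    -- Balls, and flooding a component of small radius

    Near : ℕ → V → V → Set
    Near zero u v = u ≡ v
    Near (suc k) u v = ∃ λ w → Move u w × Near k w v

    near-refl : ∀ k {v} → Near k v v
    near-refl zero = refl
    near-refl (suc k) = _ , move-refl , near-refl k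

    near-snoc : ∀ k {u v w} → Near k u v → Move v w → Near (suc k) u w
    near-snoc zero refl m = _ , m , refl
    near-snoc (suc k) (x , m , h) m′ = x , m , near-snoc k h m′

    near-trans : ∀ j k {u v w} → Near j u v → Near k v w → Near (j + k) u w
    near-trans zero k refl h = h
    near-trans (suc j) k (x , m , h) h′ = x , m , near-trans j k h h′

    near-mono : ∀ {j k u v} → j ≤ k → Near j u v → Near k u v
    near-mono {j} {k} {u} {v} h p = subst (λ i → Near i u v) (m∸n+n≡m h)
      (near-trans (k ∸ j) j (near-refl (k ∸ j)) p)

    -- Moves may be pauses, so for `u` in `U` this is the closed ball of radius `i` about `u` in the
    -- subgraph induced by `U`; likewise `Near k` means distance at most `k`.
    Ball : Subset n → ℕ → V → V → Set
    Ball U zero u v = u ≡ v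
    Ball U (suc i) u v = ∃ λ w → Ball U i u w × v ∈ U × Move w v

    ball? : ∀ U i u v → Dec (Ball U i u v)
    ball? U zero u v = u Fin.≟ v
    ball? U (suc i) u v = any? λ w → ball? U i u w ×-dec (v ∈? U ×-dec move? G w v)

    ball⇒near : ∀ {U} i {u v} → Ball U i u v → Near i u v
    ball⇒near zero e = e
    ball⇒near (suc i) (w , h , _ , m) = near-snoc i (ball⇒near i h) m

    ball⊆ : ∀ {U} i {u v} → u ∈ U → Ball U i u v → v ∈ U
    ball⊆ zero h refl = h
    ball⊆ (suc i) _ (_ , _ , h , _) = h

    ball-centre : ∀ {U} i {u} → u ∈ U → Ball U i u u
    ball-centre zero h = refl
    ball-centre (suc i) h = _ , ball-centre i h , h , move-refl

    ball-suc : ∀ {U} i {u v} → u ∈ U → Ball U i u v → Ball U (suc i) u v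
    ball-suc i h b = _ , b , ball⊆ i h b , move-refl

    module _ {U : Subset n} {M} (nbrs : ∀ v → Covers (λ w → w ∈ U × Move v w) v M) where

      -- A walk of `i` moves makes `i` choices among `M` listed vertices. The filler in the list of
      -- `v` is `v` itself, so padded entries stay inside the ball.
      ball-cover : ∀ {u} → u ∈ U → ∀ i →
        ∃ λ (f : Fin (M ^ i) → V) → (∀ a → Ball U i u (f a)) × (∀ v → Ball U i u v → ∃ λ a → f a ≡ v)
      ball-cover {u} u∈U zero = (λ _ → u) , (λ _ → refl) , λ v e → zero , e
      ball-cover {u} u∈U (suc i) with ball-cover u∈U i
      ... | f , inside , cover = g ∘ remQuot (M ^ i) , (λ a → g-inside (remQuot (M ^ i) a)) , g-cover
        where
        g : Fin M × Fin (M ^ i) → V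
        g (b , a) = proj₁ (nbrs (f a)) b
        g-inside : ∀ ba → Ball U (suc i) u (g ba)
        g-inside (b , a) with proj₁ (proj₂ (nbrs (f a))) b
        ... | inj₁ (w∈U , m) = f a , inside a , w∈U , m
        ... | inj₂ e = subst (Ball U (suc i) u) (sym e) (ball-suc i u∈U (inside a))
        g-cover : ∀ v → Ball U (suc i) u v → ∃ λ a → g (remQuot (M ^ i) a) ≡ v
        g-cover v (w , h , v∈U , m) with cover w h
        ... | a , refl with proj₂ (proj₂ (nbrs (f a))) v (v∈U , m)
        ... | b , e = combine b a , trans (cong g (remQuot-combine b a)) e

    module _ {U : Subset n} {R D s b : ℕ}
      (closed : ∀ {u v} → u ∈ U → Ball U (suc D) u v → Ball U D u v)
      (cover : ∀ {u} → u ∈ U →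
        ∃ λ (f : Fin s → V) → (∀ a → Ball U D u (f a)) × (∀ v → Ball U D u v → ∃ λ a → f a ≡ v))
      (β : Fin b → V) (β-near : ∀ v → ∃ λ i → Near R (β i) v) where

      -- By `closed`, the ball of radius `D` about the robber's first position is his whole
      -- component of `U`. Each of the `b` stations holds `s` cops, enough to occupy it, and those
      -- of a station within `R` of him arrive within `R + D` rounds.
      flood-plan : Plan U (b * s) (suc (R + D))
      flood-plan = home , win
        where
        home : Fin (b * s) → V
        home a = β (proj₁ (remQuot {b} s a))
        win : ∀ {I : Set} (H : (I → V) → V → Set) → Confines U H → ∀ {c r} → H c r → Win (suc (R + D)) [ c , home ]′ r
        win {I} H conf {c} {r} h = decide (r ∈? U)
          where
          module Flood {u} (u∈U : u ∈ U) (g : Fin (b * s) → V) (g-cover : ∀ v → Ball U D u v → ∃ λ a → g a ≡ v) where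
            flood : ∀ m {c r} (d : Fin (b * s) → V) → H c r → (∀ a → Near m (d a) (g a)) →
              (r ∈ U → Ball U D u r) → Win (suc m) [ c , d ]′ r
            flood m d h near inC with conf h
            ... | c′ , mv , inj₁ (i , q) = inj₂ ([ c′ , d ]′ , [ mv , stay ]-moves , inj₁ (inj₁ i , q))
            -- The targets are now occupied, so a robber in `U` is already caught; the additional
            -- round lets the confining team catch a robber outside `U`.
            flood zero d h near inC | c′ , mv , inj₂ (r∈U , f) =
              let a , e = g-cover _ (inC r∈U) in inj₁ (inj₂ a , trans (near a) e)
            flood (suc m) d h near inC | c′ , mv , inj₂ (r∈U , f) =
              inj₂ ([ c′ , (λ a → proj₁ (near a)) ]′ , [ mv , (λ a → proj₁ (proj₂ (near a))) ]-moves ,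
                inj₂ λ r′ m′ → flood m (λ a → proj₁ (near a)) (f r′ m′) (λ a → proj₂ (proj₂ (near a)))
                  λ r′∈U → closed u∈U (_ , inC r∈U , r′∈U , m′))
          decide : Dec (r ∈ U) → Win (suc (R + D)) [ c , home ]′ r
          decide (no r∉U) with conf h
          ... | c′ , mv , inj₁ (i , q) = inj₂ ([ c′ , home ]′ , [ mv , stay ]-moves , inj₁ (inj₁ i , q))
          ... | c′ , mv , inj₂ (r∈U , _) = contradiction r∈U r∉U
          decide (yes r∈U) with β-near r | cover r∈U
          ... | i₀ , near | f , inside , covers = flood (R + D) home h home-near λ _ → ball-centre D r∈U
            where
            target : ∀ i → Dec (i ≡ i₀) → Fin s → V
            target i (yes _) x = f x
            target i (no _) x = β i
            g : Fin (b * s) → V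
            g a = target (proj₁ (remQuot {b} s a)) (proj₁ (remQuot {b} s a) Fin.≟ i₀) (proj₂ (remQuot {b} s a))
            home-near : ∀ a → Near (R + D) (home a) (g a)
            home-near a with proj₁ (remQuot {b} s a) Fin.≟ i₀
            ... | yes e = near-trans R D (subst (λ i → Near R (β i) r) (sym e) near) (ball⇒near D (inside _))
            ... | no _ = near-refl (R + D)
            g-cover : ∀ v → Ball U D r v → ∃ λ a → g a ≡ v
            g-cover v bv with covers v bv
            ... | x , e = combine i₀ x ,
              trans (cong (λ ix → target (proj₁ ix) (proj₁ ix Fin.≟ i₀) (proj₂ ix)) (remQuot-combine i₀ x))
                (trans (at (i₀ Fin.≟ i₀)) e)
              where
              at : ∀ dec → target i₀ dec x ≡ f x
              at (yes _) = refl
              at (no ne) = contradiction refl ne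
            open Flood r∈U g g-cover

    -- Geodesics and the retraction by distance

    record Geodesic (U : Subset n) (u : V) (i : ℕ) : Set where
      field
        P       : ℕ → V
        P-step  : ∀ j → Move (P j) (P (suc j))
        P-ball  : ∀ {j} → j ≤ i → Ball U j u (P j)

    -- The path rests at `v` from index `i` on, since `Shadow` needs a path indexed by all of `ℕ`.
    path-to : ∀ {U} i {u v} → Ball U i u v → ∃ λ (γ : Geodesic U u i) → ∀ j → i ≤ j → Geodesic.P γ j ≡ v
    path-to zero {u} refl = record
      { P = λ _ → u ; P-step = λ _ → move-refl ; P-ball = λ { z≤n → refl } } , λ _ _ → refl
    path-to {U} (suc i) {u} {v} bv@(w , bw , _ , m) with path-to i bw
    ... | γ , end = record { P = Q ; P-step = Q-step ; P-ball = Q-ball } , Q-end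
      where
      open Geodesic γ
      Q : ℕ → V
      Q j with j ≤? i
      ... | yes _ = P j
      ... | no _ = v
      Q-step : ∀ j → Move (Q j) (Q (suc j))
      Q-step j with j ≤? i | suc j ≤? i
      ... | yes _ | yes _ = P-step j
      ... | yes _ | no h = subst (λ x → Move x v) (sym (end j (≮⇒≥ h))) m
      ... | no h | yes h′ = contradiction (≤-trans (n≤1+n j) h′) h
      ... | no _ | no _ = move-refl
      Q-end : ∀ j → suc i ≤ j → Q j ≡ v
      Q-end j h with j ≤? i
      ... | yes h′ = contradiction h′ (<⇒≱ h)
      ... | no _ = refl
      Q-ball : ∀ {j} → j ≤ suc i → Ball U j u (Q j)
      Q-ball {j} h with j ≤? i
      ... | yes h′ = P-ball h′
      ... | no h′ with ≤-antisym h (≰⇒> h′)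
      ... | refl = bv

    module _ (U : Subset n) (L : ℕ) (u : V) where

      private
        -- The alternative `i ≡ L` truncates the distance from `u` at `L` and gives a value to
        -- vertices that `u` cannot reach inside `U`.
        leastLevel : ∀ v → ∃ (IsLeast λ i → Ball U i u v ⊎ i ≡ L)
        leastLevel v = least (λ i → ball? U i u v ⊎-dec i ≟ L) {L} (inj₂ refl)

      level : V → ℕ
      level v = proj₁ (leastLevel v)

      level-attained : ∀ v → Ball U (level v) u v ⊎ level v ≡ L
      level-attained v = proj₁ (proj₂ (leastLevel v))

      level-least : ∀ {i v} → Ball U i u v ⊎ i ≡ L → level v ≤ i
      level-least {i} {v} h = proj₂ (proj₂ (leastLevel v)) i h

      level-step : ∀ {v w} → v ∈ U → w ∈ U → Move v w → level w ≤ suc (level v)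
      level-step {v} _ w∈U m with level-attained v
      ... | inj₁ b = level-least (inj₁ (v , b , w∈U , m))
      ... | inj₂ e = ≤-trans (level-least (inj₂ refl)) (≤-trans (≤-reflexive (sym e)) (n≤1+n (level v)))

    module _ {U : Subset n} {D : ℕ} {u v : V} (u∈U : u ∈ U)
      (far : Ball U (suc D) u v) (¬near : ¬ Ball U D u v) where

      private
        L = suc D
        γ = proj₁ (path-to L far)
        end = proj₂ (path-to L far)
      open Geodesic γ

      ball-≤ : ∀ {i j w} → i ≤ j → Ball U i u w → Ball U j u w
      ball-≤ {i} {j} {w} h b = subst (λ k → Ball U k u w) (m∸n+n≡m h) (go (j ∸ i))
        where
        go : ∀ d → Ball U (d + i) u w
        go zero = b
        go (suc d) = ball-suc (d + i) u∈U (go d)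

      level-end : L ≤ level U L u v
      level-end with level-attained U L u v
      ... | inj₁ b = ≮⇒≥ λ h → ¬near (ball-≤ (s≤s⁻¹ h) b)
      ... | inj₂ e = ≤-reflexive (sym e)

      -- The level rises by at most one per step, and the remaining `L ∸ i` steps end at `v`, whose
      -- level is at least `L`; hence `P i` cannot lie below level `i`.
      level-P : ∀ {i} → i ≤ L → level U L u (P i) ≡ i
      level-P {i} h = ≤-antisym (level-least U L u (inj₁ (P-ball h)))
        (+-cancelˡ-≤ (L ∸ i) i _ (≤-trans (≤-reflexive (m∸n+n≡m h)) (≤-trans level-end descend)))
        where
        descend : level U L u v ≤ (L ∸ i) + level U L u (P i)
        descend = subst (λ w → level U L u w ≤ (L ∸ i) + level U L u (P i)) (end L ≤-refl)
          (subst (λ j → level U L u (P j) ≤ (L ∸ i) + level U L u (P i)) (m∸n+n≡m h)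
            (go (L ∸ i) (≤-reflexive (m∸n+n≡m h))))
          where
          go : ∀ d → d + i ≤ L → level U L u (P (d + i)) ≤ d + level U L u (P i)
          go zero _ = ≤-refl
          go (suc d) h = ≤-trans
            (level-step U L u (ball⊆ (d + i) u∈U (P-ball (≤-trans (n≤1+n _) h)))
              (ball⊆ (suc d + i) u∈U (P-ball h)) (P-step (d + i)))
            (s≤s (go d (≤-trans (n≤1+n _) h)))

      level-shadow : Shadow U L
      level-shadow = record
        { P = P ; P-step = P-step ; ℓ = level U L u
        ; ℓ≤L = λ _ → level-least U L u (inj₂ refl) ; ℓ-step = level-step U L u }

      -- By `level-P` the `suc L` path vertices are distinct, and each is fixed by the retraction.
      remove-path : ∃ λ U′ → ∣ U′ ∣ + suc L ≤ ∣ U ∣ × (∀ w → w ∈ U → w ∈ U′ ⊎ P (level U L u w) ≡ w)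
      remove-path with remove (suc L) (P ∘ toℕ) inj U (λ i → ball⊆ (toℕ i) u∈U (P-ball (toℕ≤L i)))
        where
        toℕ≤L : ∀ (i : Fin (suc L)) → toℕ i ≤ L
        toℕ≤L i = s≤s⁻¹ (Fin.toℕ<n i)
        inj : Injective _≡_ _≡_ (P ∘ toℕ)
        inj {i} {j} e = Fin.toℕ-injective (trans (sym (level-P (toℕ≤L i)))
          (trans (cong (level U L u) e) (level-P (toℕ≤L j))))
      ... | U′ , size , split = U′ , size , λ w w∈U → go w (split w w∈U)
        where
        go : ∀ w → w ∈ U′ ⊎ (∃ λ i → P (toℕ i) ≡ w) → w ∈ U′ ⊎ P (level U L u w) ≡ w
        go w (inj₁ h) = inj₁ h
        go w (inj₂ (i , refl)) = inj₂ (cong P (level-P (s≤s⁻¹ (Fin.toℕ<n i))))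

  -- Stations for the reserve

  module _ {n : ℕ} (G : Graph n) where
    open Graph G
    open Game G

    private
      V : Set
      V = Fin n

    module _ (root : V) where

      dist-exists : ∀ v → ∃ λ i → Ball G Subset.⊤ i root v
      dist-exists v = go 0 refl (connected root v)
        where
        go : ∀ i {u} → Ball G Subset.⊤ i root u → Star _∼_ u v → ∃ λ i → Ball G Subset.⊤ i root v
        go i h ε = i , h
        go i h (a ◅ as) = go (suc i) (_ , h , ∈⊤ , inj₂ a) as

      private
        leastDist : ∀ v → ∃ (IsLeast λ i → Ball G Subset.⊤ i root v)
        leastDist v = least (λ i → ball? G Subset.⊤ i root v) (proj₂ (dist-exists v))

      dist : V → ℕ
      dist v = proj₁ (leastDist v)

      dist≡0 : ∀ v → dist v ≡ 0 → root ≡ v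
      dist≡0 v e = subst (λ i → Ball G Subset.⊤ i root v) e (proj₁ (proj₂ (leastDist v)))

      dist-pred : ∀ {v i} → dist v ≡ suc i → ∃ λ w → dist w ≡ i × Move w v
      dist-pred {v} {i} e with subst (λ j → Ball G Subset.⊤ j root v) e (proj₁ (proj₂ (leastDist v)))
      ... | w , b , _ , m = w , ≤-antisym (proj₂ (proj₂ (leastDist w)) i b)
        (s≤s⁻¹ (subst (_≤ suc (dist w)) e
          (proj₂ (proj₂ (leastDist v)) (suc (dist w)) (w , proj₁ (proj₂ (leastDist w)) , ∈⊤ , m)))) , m

      ancestor : ∀ d {v i} → dist v ≡ d + i → ∃ λ w → dist w ≡ i × Near G d w v
      ancestor zero {v} e = v , e , refl
      ancestor (suc d) e with dist-pred e
      ... | w , e′ , m with ancestor d e′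
      ... | x , e″ , near = x , e″ , near-snoc G d near m

      -- The root together with one residue class of the distance modulo R + 1.
      bases : ∀ R → ∃ λ (β : Fin (suc (n / suc R)) → V) → ∀ v → ∃ λ i → Near G R (β i) v
      -- There are `suc R` residue classes, so one of them has at most `n / suc R` vertices.
      bases R with small-fibre (λ v → fromℕ< (m%n<n (dist v) (suc R))) root (n / suc R)
        (subst (n <_) (*-comm (suc (n / suc R)) (suc R)) (m<suc[m/n]*n n (suc R)))
      ... | j , f , _ , cover = β , near
        where
        β : Fin (suc (n / suc R)) → V
        β zero = root
        β (suc i) = f i
        ρ₀ : ℕ
        ρ₀ = toℕ j
        in-class : ∀ w q → dist w ≡ ρ₀ + q * suc R → ∃ λ i → f i ≡ w
        in-class w q e = cover w (Fin.toℕ-injective (trans (toℕ-fromℕ< _)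
          (trans (cong (_% suc R) e) (trans ([m+kn]%n≡m%n ρ₀ q (suc R)) (m<n⇒m%n≡m (Fin.toℕ<n j))))))
        via : ∀ {v} d q → d ≤ R → dist v ≡ d + (ρ₀ + q * suc R) → ∃ λ i → Near G R (β i) v
        via d q d≤R e with ancestor d e
        ... | w , e′ , nr with in-class w q e′
        ... | i , refl = suc i , near-mono G d≤R nr
        near : ∀ v → ∃ λ i → Near G R (β i) v
        near v = go (dist v / suc R) (m≡m%n+[m/n]*n (dist v) (suc R)) (≤-total ρ₀ ρ)
          where
          ρ : ℕ
          ρ = dist v % suc R
          ρ≤R : ρ ≤ R
          ρ≤R = s≤s⁻¹ (m%n<n (dist v) (suc R))
          -- Walk towards the root to the nearest depth with residue `ρ₀`: in the same block if
          -- `ρ₀ ≤ ρ`, else in the previous block. In the first block there is none before, and the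
          -- root serves.
          go : ∀ q → dist v ≡ ρ + q * suc R → ρ₀ ≤ ρ ⊎ ρ ≤ ρ₀ → ∃ λ i → Near G R (β i) v
          go q e (inj₁ ρ₀≤ρ) = via (ρ ∸ ρ₀) q (≤-trans (m∸n≤m ρ ρ₀) ρ≤R)
            (trans e (trans (cong (_+ q * suc R) (sym (m∸n+n≡m ρ₀≤ρ))) (+-assoc (ρ ∸ ρ₀) ρ₀ _)))
          go zero e (inj₂ _) with ancestor ρ e
          ... | w , e′ , nr = zero , subst (λ x → Near G R x v) (sym (dist≡0 w e′)) (near-mono G ρ≤R nr)
          go (suc q) e (inj₂ ρ≤ρ₀) with m≤n⇒m<n∨m≡n ρ≤ρ₀
          ... | inj₂ ρ≡ρ₀ = via 0 (suc q) z≤n (trans e (cong (_+ suc q * suc R) ρ≡ρ₀))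
          ... | inj₁ ρ<ρ₀ = via (ρ + (suc R ∸ ρ₀)) q
            (s≤s⁻¹ (subst (ρ + (suc R ∸ ρ₀) <_) (m+[n∸m]≡n (<⇒≤ ρ₀<)) (+-monoˡ-< (suc R ∸ ρ₀) ρ<ρ₀)))
            (trans e (trans (cong (λ x → ρ + (x + q * suc R)) (sym (m∸n+n≡m (<⇒≤ ρ₀<))))
              (lem ρ (suc R ∸ ρ₀) ρ₀ (q * suc R))))
            where
            ρ₀< : ρ₀ < suc R
            ρ₀< = Fin.toℕ<n j
            lem : ∀ r x j y → r + (x + j + y) ≡ r + x + (j + y)
            lem = solve-∀

    -- Clearing the graph

    module _ {t₀ D R b : ℕ} (eq : (suc t₀ + suc t₀) * suc t₀ ≡ suc D)
      (β : Fin (suc b) → V) (β-near : ∀ v → ∃ λ i → Near G R (β i) v) where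

      private
        t M κ S E : ℕ
        t = suc t₀
        M = suc D
        κ = suc (t + t)
        S = M ^ D
        E = suc b * S + suc (R + D)

      -- Amortised cost, multiplied by `suc M` to stay in `ℕ`: `κ` cops and rounds for every `suc M`
      -- removed vertices, plus `E` once for the final flooding.
      Cleared : Subset n → Set₁
      Cleared U = ∃ λ k → ∃ λ T → 1 ≤ k × Plan G U k T × (k + T) * suc M ≤ κ * ∣ U ∣ + suc M * E

      -- `fuel` bounds the size of `U`, which strictly drops with each star or path, and makes the
      -- recursion structural.
      clear : ∀ fuel U → ∣ U ∣ ≤ fuel → Cleared U
      clear-smaller : ∀ fuel {U U′} → ∣ U ∣ ≤ fuel → ∣ U′ ∣ + suc M ≤ ∣ U ∣ → ∀ {j τ} (q : Fin j → V) →
        Restricts G q U U′ τ → j + τ ≤ κ → Cleared U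

      clear-smaller zero h size q r c = contradiction (≤-trans (m≤n+m (suc M) _) (≤-trans size h)) λ ()
      clear-smaller (suc fuel) {U} {U′} h size {j} {τ} q r c
        with clear fuel U′ (s≤s⁻¹ (≤-trans (≤-trans (s≤s (m≤m+n _ M)) (≤-reflexive (sym (+-suc _ M)))) (≤-trans size h)))
      ... | k , T , k>0 , plan , cost = j + k , τ + T , ≤-trans k>0 (m≤n+m k j) , plan-restrict G q r plan ,
        (begin
          (j + k + (τ + T)) * suc M             ≡⟨ lem j k τ T (suc M) ⟩
          (j + τ) * suc M + (k + T) * suc M     ≤⟨ +-mono-≤ (*-monoˡ-≤ (suc M) c) cost ⟩
          κ * suc M + (κ * ∣ U′ ∣ + suc M * E)   ≡⟨ lem′ κ (suc M) ∣ U′ ∣ (suc M * E) ⟩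
          κ * (∣ U′ ∣ + suc M) + suc M * E       ≤⟨ +-monoˡ-≤ (suc M * E) (*-monoʳ-≤ κ size) ⟩
          κ * ∣ U ∣ + suc M * E                  ∎)
        where
        open ≤-Reasoning
        lem : ∀ j k τ T m → (j + k + (τ + T)) * m ≡ (j + τ) * m + (k + T) * m
        lem = solve-∀
        lem′ : ∀ κ m u e → κ * m + (κ * u + e) ≡ κ * (u + m) + e
        lem′ = solve-∀

      clear fuel U h
        with choose (λ v → injects⊎covers (λ w → w ∈? U ×-dec move? G v w) v M)
      ... | inj₁ (v , f , inj , f∈) with remove (suc M) f inj U (proj₁ ∘ f∈)
      ... | U′ , size , split = clear-smaller fuel h size (λ _ → v)
        (star-restricts G v λ x x∈U → Sum.map₂ (λ { (i , refl) → proj₂ (f∈ i) }) (split x x∈U))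
        (s≤s z≤n)
      clear fuel U h | inj₂ nbrs
        with any? (λ u → any? λ v → u ∈? U ×-dec (ball? G U (suc D) u v ×-dec ¬? (ball? G U D u v)))
      ... | yes (u , v , u∈U , far , ¬near) with remove-path G u∈U far ¬near
      ... | U′ , size , split = clear-smaller fuel h size
        (λ i → Shadow.P shadow ((t + t) * toℕ i))
        -- The `suc t` cops and `t` rounds spent here are exactly `κ`.
        (path-restricts G {t₀ = t₀} shadow (≤-reflexive (sym eq)) split) ≤-refl
        where
        shadow : Shadow G U (suc D)
        shadow = level-shadow G u∈U far ¬near
      clear fuel U h | inj₂ nbrs | no ¬far = suc b * S , suc (R + D) ,
        ≤-trans (m^n>0 M D) (m≤m+n S (b * S)) ,
        flood-plan G closed (λ u∈U → ball-cover G nbrs u∈U D) β β-near ,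
        ≤-trans (≤-reflexive (*-comm E (suc M))) (m≤n+m (suc M * E) (κ * ∣ U ∣))
        where
        closed : ∀ {u v} → u ∈ U → Ball G U (suc D) u v → Ball G U D u v
        closed {u} {v} u∈U far with ball? G U D u v
        ... | yes near = near
        ... | no ¬near = contradiction (u , v , u∈U , far , ¬near) ¬far

    thc≤ : ∀ {k T} → 1 ≤ k → WinWithin k T → thc G ≤ k + T
    thc≤ {k} {T} k>0 w with least (winWithin? G k) w
    ... | m , captured , minimal = ≤-trans
      (proj₂ (thc-spec G) (k + m) (k , m , k>0 , (captured , minimal) , refl)) (+-monoʳ-≤ k (minimal T w))

    thc≤n : thc G ≤ n
    thc≤n = subst (thc G ≤_) (+-identityʳ n)
      (thc≤ nonempty (allFin n , λ r → r , lookup-allFin r))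

    -- The empty team confines the robber to the whole graph, so the cops of the plan win by
    -- themselves.
    plan⇒thc : ∀ {k T} → 1 ≤ k → Plan G Subset.⊤ k T → thc G ≤ k + T
    plan⇒thc {k} {T} k>0 (p , win) = thc≤ k>0 (tabulate p , λ r → win⇒catch G T
      (lookup∘tabulate p)
      (win-reindex G inj₂ (λ { (inj₁ ()) ; (inj₂ i) → i }) (λ { (inj₁ ()) ; (inj₂ i) → refl }) T (λ _ → refl)
        (win {⊥} (λ _ _ → ⊤) (λ {c} _ → c , (λ ()) , inj₂ (∈⊤ , λ _ _ → tt)) {λ ()} tt)))

    throttling-bound : ∀ t₀ D R → (suc t₀ + suc t₀) * suc t₀ ≡ suc D →
      thc G * suc (suc D) ≤ suc (suc t₀ + suc t₀) * n +
        suc (suc D) * (suc (n / suc R) * suc D ^ D + suc (R + D))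
    throttling-bound t₀ D R eq
      with clear {t₀ = t₀} eq (proj₁ (bases root R)) (proj₂ (bases root R)) n Subset.⊤ (≤-reflexive (∣⊤∣≡n n))
      where
      root : V
      root = fromℕ< nonempty
    ... | k , T , k>0 , plan , cost = ≤-trans (*-monoˡ-≤ (suc (suc D)) (plan⇒thc k>0 plan))
      (subst (λ m → (k + T) * suc (suc D) ≤ suc (suc t₀ + suc t₀) * m +
          suc (suc D) * (suc (n / suc R) * suc D ^ D + suc (R + D))) (∣⊤∣≡n n) cost)

  -- Choice of the parameter `t`

  ^-cancelˡ-≤ : ∀ k {m n} → m ^ suc k ≤ n ^ suc k → m ≤ n
  ^-cancelˡ-≤ k h = ≮⇒≥ λ n<m → contradiction h (<⇒≱ (^-monoˡ-< (suc k) n<m))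

  [m*n]^k : ∀ m n k → (m * n) ^ k ≡ m ^ k * n ^ k
  [m*n]^k m n zero = refl
  [m*n]^k m n (suc k) = trans (cong (m * n *_) ([m*n]^k m n k)) (lem m n (m ^ k) (n ^ k))
    where
    lem : ∀ m n a b → m * n * (a * b) ≡ m * a * (n * b)
    lem = solve-∀

  -- (x ^ x) ^ 9 ≤ n ^ 8 says x log x ≤ (8/9) log n.
  record Fits (n x : ℕ) : Set where
    constructor mkFits
    field
      power-≤ : (x ^ x) ^ 9 ≤ n ^ 8
  open Fits

  -- The exponent 8/9 leaves a factor to spare: the eighth power of the claim follows from
  -- `x ^ 32 ≤ x ^ x`.
  Fits⇒slack : ∀ {n x} → 32 ≤ x → Fits n x → x ^ x * x ^ 4 ≤ n
  Fits⇒slack {n} {x} 32≤x h = ^-cancelˡ-≤ 7 (begin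
    (x ^ x * x ^ 4) ^ 8          ≡⟨ [m*n]^k (x ^ x) (x ^ 4) 8 ⟩
    (x ^ x) ^ 8 * (x ^ 4) ^ 8    ≡⟨ cong ((x ^ x) ^ 8 *_) (^-*-assoc x 4 8) ⟩
    (x ^ x) ^ 8 * x ^ 32         ≤⟨ *-monoʳ-≤ ((x ^ x) ^ 8) (^-monoʳ-≤ x {{>-nonZero (≤-trans (s≤s z≤n) 32≤x)}} 32≤x) ⟩
    (x ^ x) ^ 8 * x ^ x          ≡⟨ *-comm ((x ^ x) ^ 8) (x ^ x) ⟩
    (x ^ x) ^ 9                  ≤⟨ power-≤ h ⟩
    n ^ 8                        ∎)
    where open ≤-Reasoning

  -- With `m = 2 t²` the leading terms are `6 t² m² = 3 m³` on the left and `4 m³` on the right;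
  -- from `t = 9` on this margin covers all lower terms.
  lower-order : ∀ t → 9 ≤ t → let m = (t + t) * t in
    3 * suc t * (m * m * suc (t + t) + suc m * suc (m + m)) ≤ 4 * suc m * (m * m)
  lower-order t h = subst (λ t → let m = (t + t) * t in
    3 * suc t * (m * m * suc (t + t) + suc m * suc (m + m)) ≤ 4 * suc m * (m * m)) (m∸n+n≡m h)
    (≤-trans (m≤m+n _ _) (≤-reflexive (lem (t ∸ 9))))
    where
    -- Written in k = t - 9, the difference of the two sides has nonnegative coefficients.
    lem : ∀ k →
      3 * suc (k + 9) * ((((k + 9) + (k + 9)) * (k + 9)) * (((k + 9) + (k + 9)) * (k + 9)) * suc ((k + 9) + (k + 9))
          + suc (((k + 9) + (k + 9)) * (k + 9)) * suc ((((k + 9) + (k + 9)) * (k + 9)) + (((k + 9) + (k + 9)) * (k + 9)))) +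
        ((((((8 * k + 372) * k + 7000) * k + 67302) * k + 339696) * k + 803031) * k + 562758)
      ≡ 4 * suc (((k + 9) + (k + 9)) * (k + 9)) * ((((k + 9) + (k + 9)) * (k + 9)) * (((k + 9) + (k + 9)) * (k + 9)))
    lem = solve-∀

  -- Removals cost about `n / t`. The flooding cost `E ≤ M * S + R` is of lower order, because
  -- `M³ S ≤ n` and `R * M ≤ n + n`. The factor 4/3 absorbs it together with the passage from `t` to
  -- `suc t`.
  budget : ∀ {D n b R} t θ → let M = suc D in (t + t) * t ≡ M → 9 ≤ t → M ^ M * M ^ 4 ≤ n →
    b ≤ t * t → R * (t * t) ≤ n →
    θ * suc M ≤ suc (t + t) * n + suc M * (b * M ^ D + suc (R + D)) → 3 * θ * suc t ≤ 4 * n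
  budget {D} {n} {b} {R} t θ eq t≥9 slack b≤ R≤ cost = *-cancelˡ-≤ (suc M * (M * M)) (begin
      suc M * (M * M) * (3 * θ * suc t)                  ≡⟨ lem₁ M θ t ⟩
      3 * suc t * (M * M * (θ * suc M))                  ≤⟨ *-monoʳ-≤ (3 * suc t) (*-monoʳ-≤ (M * M) cost) ⟩
      3 * suc t * (M * M * (suc (t + t) * n + suc M * E))
        ≡⟨ cong (3 * suc t *_) (lem₂ M (suc (t + t)) n E) ⟩
      3 * suc t * (M * M * suc (t + t) * n + suc M * (M * M * E))
        ≤⟨ *-monoʳ-≤ (3 * suc t) (+-monoʳ-≤ (M * M * suc (t + t) * n) (*-monoʳ-≤ (suc M) extra)) ⟩
      3 * suc t * (M * M * suc (t + t) * n + suc M * (suc (M + M) * n))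
        ≡⟨ lem₃ (suc t) (M * M * suc (t + t)) (suc M) (suc (M + M)) n ⟩
      3 * suc t * (M * M * suc (t + t) + suc M * suc (M + M)) * n
        ≤⟨ *-monoˡ-≤ n (subst (λ m → 3 * suc t * (m * m * suc (t + t) + suc m * suc (m + m)) ≤ 4 * suc m * (m * m))
             eq (lower-order t t≥9)) ⟩
      4 * suc M * (M * M) * n                            ≡⟨ lem₄ M n ⟩
      suc M * (M * M) * (4 * n)                          ∎)
    where
    open ≤-Reasoning
    M S E : ℕ
    M = suc D
    S = M ^ M
    E = b * M ^ D + suc (R + D)
    lem₁ : ∀ m θ t → suc m * (m * m) * (3 * θ * suc t) ≡ 3 * suc t * (m * m * (θ * suc m))
    lem₁ = solve-∀
    lem₂ : ∀ m k n e → m * m * (k * n + suc m * e) ≡ m * m * k * n + suc m * (m * m * e)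
    lem₂ = solve-∀
    lem₃ : ∀ t a m k n → 3 * t * (a * n + m * (k * n)) ≡ 3 * t * (a + m * k) * n
    lem₃ = solve-∀
    lem₄ : ∀ m n → 4 * suc m * (m * m) * n ≡ suc m * (m * m) * (4 * n)
    lem₄ = solve-∀
    tt+tt : t * t + t * t ≡ M
    tt+tt = trans (sym (*-distribʳ-+ t t t)) eq
    2≤S : 2 ≤ S
    2≤S = ≤-trans 2≤M (m≤m*n M (M ^ D) {{m^n≢0 M D}})
      where
      2≤M : 2 ≤ M
      2≤M = subst (2 ≤_) tt+tt (+-mono-≤ {1} {t * t} {1} {t * t} 1≤ 1≤)
        where
        1≤ : 1 ≤ t * t
        1≤ = *-mono-≤ {1} {t} {1} {t} (≤-trans (s≤s z≤n) t≥9) (≤-trans (s≤s z≤n) t≥9)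
    E≤ : E ≤ M * S + R
    E≤ = begin
      b * M ^ D + suc (R + D)           ≡⟨ cong (b * M ^ D +_) (sym (+-suc R D)) ⟩
      b * M ^ D + (R + M)               ≤⟨ +-mono-≤ (*-mono-≤ b≤ (m≤n*m (M ^ D) M)) (+-monoʳ-≤ R
        (≤-trans (≤-reflexive (sym (trans (*-comm (t * t) 2) (trans (cong (t * t +_) (+-identityʳ (t * t))) tt+tt))))
          (*-monoʳ-≤ (t * t) 2≤S))) ⟩
      t * t * S + (R + t * t * S)       ≡⟨ lem₅ (t * t) S R ⟩
      (t * t + t * t) * S + R           ≡⟨ cong (λ m → m * S + R) tt+tt ⟩
      M * S + R                         ∎
      where
      lem₅ : ∀ a s r → a * s + (r + a * s) ≡ (a + a) * s + r
      lem₅ = solve-∀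
    extra : M * M * E ≤ suc (M + M) * n
    extra = begin
      M * M * E                             ≤⟨ *-monoʳ-≤ (M * M) E≤ ⟩
      M * M * (M * S + R)                   ≡⟨ lem₆ M S R ⟩
      M * M * M * S + M * (R * M)           ≤⟨ +-mono-≤ cube (*-monoʳ-≤ M RM≤) ⟩
      n + M * (n + n)                       ≡⟨ lem₇ M n ⟩
      suc (M + M) * n                       ∎
      where
      lem₆ : ∀ m s r → m * m * (m * s + r) ≡ m * m * m * s + m * (r * m)
      lem₆ = solve-∀
      lem₇ : ∀ m n → n + m * (n + n) ≡ suc (m + m) * n
      lem₇ = solve-∀
      RM≤ : R * M ≤ n + n
      RM≤ = ≤-trans (≤-reflexive (trans (cong (R *_) (sym tt+tt)) (*-distribˡ-+ R (t * t) (t * t)))) (+-mono-≤ R≤ R≤)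
      cube : M * M * M * S ≤ n
      cube = ≤-trans (≤-trans (m≤m*n (M * M * M * S) M) (≤-reflexive (lem₈ M S))) slack
        where
        lem₈ : ∀ m s → m * m * m * s * m ≡ s * (m * (m * (m * (m * 1))))
        lem₈ = solve-∀

  twice-square : ℕ → ℕ
  twice-square t = (t + t) * t

  fits? : ∀ n x → Dec (Fits n x)
  fits? n x = map′ mkFits power-≤ ((x ^ x) ^ 9 ≤? n ^ 8)

  fits-large : ∀ x → ∃ λ N → ∀ n → N ≤ n → Fits n x
  fits-large x = (x ^ x) ^ 9 , λ n h → mkFits (≤-trans h (m≤m^suc n 7))
    where
    m≤m^suc : ∀ m k → m ≤ m ^ suc k
    m≤m^suc zero k = z≤n
    m≤m^suc (suc m) k = m≤m*n (suc m) (suc m ^ k) {{m^n≢0 (suc m) k}}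

  -- No `x > n` fits, so a search over `j ≤ n` finds a `t` that fits while `suc t` does not; the
  -- offset 9 gives `9 ≤ t`.
  parameter : ∀ n → Fits n (twice-square 9) → ∃ λ t → 9 ≤ t × Fits n (twice-square t) × ¬ Fits n (twice-square (suc t))
  parameter n fits₀ with lastUpTo (λ j → fits? n (twice-square (j + 9))) n
  ... | j , j≤n , fits , tight = j + 9 , m≤n+m 9 j , here fits , there tight
    where
    here : j ≡ 0 ⊎ Fits n (twice-square (j + 9)) → Fits n (twice-square (j + 9))
    -- `lastUpTo` returns 0 by default, without a test, so this case rests on the hypothesis.
    here (inj₁ refl) = fits₀
    here (inj₂ f) = f
    n<x : ∀ i → n ≤ i → n < twice-square (i + 9)
    n<x i n≤i = ≤-trans (s≤s n≤i) (≤-trans (≤-trans (≤-reflexive (+-comm 1 i)) (+-monoʳ-≤ i {1} {9} (s≤s z≤n)))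
      (m≤n*m (i + 9) (i + 9 + (i + 9))
        {{>-nonZero (≤-trans (m≤n+m 1 i) (≤-trans (+-monoʳ-≤ i {1} {9} (s≤s z≤n)) (m≤m+n (i + 9) (i + 9))))}}))
    too-large : ∀ x → n < x → ¬ Fits n x
    too-large x n<x fits = <⇒≱ (^-monoˡ-< 8 n<x) (begin
      x ^ 8         ≤⟨ ^-monoˡ-≤ 8 (x≤x^x x {{x≢0}}) ⟩
      (x ^ x) ^ 8   ≤⟨ m≤n*m ((x ^ x) ^ 8) (x ^ x) {{m^n≢0 x x {{x≢0}}}} ⟩
      (x ^ x) ^ 9   ≤⟨ power-≤ fits ⟩
      n ^ 8         ∎)
      where
      open ≤-Reasoning
      x≢0 : NonZero x
      x≢0 = >-nonZero (≤-trans (s≤s z≤n) n<x)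
      x≤x^x : ∀ x → .{{_ : NonZero x}} → x ≤ x ^ x
      x≤x^x (suc k) = m≤m*n (suc k) (suc k ^ k) {{m^n≢0 (suc k) k}}
    there : j ≡ n ⊎ ¬ Fits n (twice-square (suc j + 9)) → ¬ Fits n (twice-square (suc j + 9))
    there (inj₁ refl) = too-large _ (n<x _ (n≤1+n n))
    there (inj₂ f) = f

  throttling-budget : ∀ {n} (G : Graph n) t₀ → 9 ≤ suc t₀ → (∃ λ D → twice-square (suc t₀) ≡ suc D) →
    (∀ x → twice-square (suc t₀) ≡ x → x ^ x * x ^ 4 ≤ n) → 3 * thc G * suc (suc t₀) ≤ 4 * n
  throttling-budget {n} G t₀ t≥9 (D , eq) slack =
    -- As `R` is the floor of `n / t²`, `n < suc R * (t * t)`, and hence there are at most `t * t`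
    -- stations.
    budget {D} {n} {suc (n / suc R)} {R} t (thc G) eq t≥9 (slack (suc D) eq)
      (m<n*o⇒m/o<n (subst (n <_) (*-comm (suc R) (t * t)) (m<suc[m/n]*n n (t * t))))
      (m/n*n≤m n (t * t)) (throttling-bound G t₀ D R eq)
    where
    t R : ℕ
    t = suc t₀
    R = n / (t * t)

  throttling-parameter : ∀ {n} (G : Graph n) → Fits n (twice-square 9) →
    ∃ λ t → 3 * thc G * suc t ≤ 4 * n × ¬ Fits n (twice-square (suc t))
  throttling-parameter {n} G fits = go (parameter n fits)
    where
    go : (∃ λ t → 9 ≤ t × Fits n (twice-square t) × ¬ Fits n (twice-square (suc t))) →
      ∃ λ t → 3 * thc G * suc t ≤ 4 * n × ¬ Fits n (twice-square (suc t))
    go (suc t₀ , t≥9 , fits-t , ¬fits) = suc t₀ , throttling-budget G t₀ t≥9 (_ , refl)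
      (λ x e → Fits⇒slack {n} {x}
        (subst (32 ≤_) e (≤-trans (m≤m+n 32 130) (*-mono-≤ (+-mono-≤ t≥9 t≥9) t≥9)))
        (subst (Fits n) e fits-t)) , ¬fits

-- Exponential inequalities for real numbers

module _ where

  open import Data.Empty using (⊥; ⊥-elim)
  open import Data.Integer.Base using (+_)
  open import Data.Nat.Base as ℕ using (zero; suc)
  import Data.Nat.Properties as ℕP
  import Data.Nat.Tactic.RingSolver as ℕ
  open import Data.Rational.Base
    using (ℚ; 0ℚ; 1ℚ; ½; _≤_; _<_; _+_; _-_; -_; _*_; _/_; _⊓_; positive; nonNegative)
    renaming (∣_∣ to abs)
  open import Data.Rational.Properties
  open import Level using (0ℓ)
  open import Relation.Binary.Bundles using (Preorder)
  open import Tactic.RingSolver using (solve-∀)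

  -- Cauchy products and truncated exponential series

  -- The Cauchy product Σ_{j ≤ n} f (n - j) * g j.
  conv : ℕ → (ℕ → ℚ) → (ℕ → ℚ) → ℚ
  conv zero    f g = f 0 * g 0
  conv (suc n) f g = conv n (f ∘ suc) g + f 0 * g (suc n)

  sumTo : ℕ → (ℕ → ℚ) → ℚ
  sumTo zero    g = g 0
  sumTo (suc n) g = sumTo n g + g (suc n)

  conv-cong : ∀ n {f f′ g g′} → (∀ i → f i ≡ f′ i) → (∀ i → g i ≡ g′ i) → conv n f g ≡ conv n f′ g′
  conv-cong zero p q = cong₂ _*_ (p 0) (q 0)
  conv-cong (suc n) p q = cong₂ _+_ (conv-cong n (p ∘ suc) q) (cong₂ _*_ (p 0) (q (suc n)))

  conv-+ˡ : ∀ n f f′ g → conv n (λ i → f i + f′ i) g ≡ conv n f g + conv n f′ g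
  conv-+ˡ zero f f′ g = *-distribʳ-+ (g 0) (f 0) (f′ 0)
  conv-+ˡ (suc n) f f′ g = trans (cong (_+ (f 0 + f′ 0) * g (suc n)) (conv-+ˡ n (f ∘ suc) (f′ ∘ suc) g))
    (lem (conv n (f ∘ suc) g) (conv n (f′ ∘ suc) g) (f 0) (f′ 0) (g (suc n)))
    where
    lem : ∀ c c′ x y z → c + c′ + (x + y) * z ≡ c + x * z + (c′ + y * z)
    lem = solve-∀ ℚ-ring

  conv-*ˡ : ∀ n a f g → conv n (λ i → a * f i) g ≡ a * conv n f g
  conv-*ˡ zero a f g = *-assoc a (f 0) (g 0)
  conv-*ˡ (suc n) a f g = trans (cong (_+ a * f 0 * g (suc n)) (conv-*ˡ n a (f ∘ suc) g))
    (lem a (conv n (f ∘ suc) g) (f 0) (g (suc n)))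
    where
    lem : ∀ a c x z → a * c + a * x * z ≡ a * (c + x * z)
    lem = solve-∀ ℚ-ring

  conv-*ʳ : ∀ n a f g → conv n f (λ i → a * g i) ≡ a * conv n f g
  conv-*ʳ zero a f g = lem a (f 0) (g 0)
    where
    lem : ∀ a x z → x * (a * z) ≡ a * (x * z)
    lem = solve-∀ ℚ-ring
  conv-*ʳ (suc n) a f g = trans (cong (_+ f 0 * (a * g (suc n))) (conv-*ʳ n a (f ∘ suc) g))
    (lem a (conv n (f ∘ suc) g) (f 0) (g (suc n)))
    where
    lem : ∀ a c x z → a * c + x * (a * z) ≡ a * (c + x * z)
    lem = solve-∀ ℚ-ring

  conv-sucʳ : ∀ n f g → conv (suc n) f g ≡ f (suc n) * g 0 + conv n f (g ∘ suc)
  conv-sucʳ zero f g = refl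
  conv-sucʳ (suc n) f g = trans (cong (_+ f 0 * g (suc (suc n))) (conv-sucʳ n (f ∘ suc) g))
    (+-assoc (f (suc (suc n)) * g 0) (conv n (f ∘ suc) (g ∘ suc)) (f 0 * g (suc (suc n))))

  -- Multiplying each coefficient by its index is the operator `x d/dx` on power series; this is its
  -- product rule.
  conv-leibniz : ∀ n f g → ι n * conv n f g ≡ conv n (λ i → ι i * f i) g + conv n f (λ i → ι i * g i)
  conv-leibniz zero f g = lem (f 0) (g 0)
    where
    lem : ∀ x y → 0ℚ * (x * y) ≡ 0ℚ * x * y + x * (0ℚ * y)
    lem = solve-∀ ℚ-ring
  conv-leibniz (suc n) f g = begin
    ι (suc n) * (c + f 0 * g (suc n))                  ≡⟨ cong (_* (c + f 0 * g (suc n))) (ι-suc n) ⟩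
    (ι n + 1ℚ) * (c + f 0 * g (suc n))                 ≡⟨ lem₁ (ι n) c (f 0) (g (suc n)) ⟩
    ι n * c + c + f 0 * ((ι n + 1ℚ) * g (suc n))
      ≡⟨ cong₂ (λ x y → x + c + f 0 * (y * g (suc n))) (conv-leibniz n (f ∘ suc) g) (sym (ι-suc n)) ⟩
    d + e + c + f 0 * (ι (suc n) * g (suc n))          ≡⟨ lem₂ d e c (f 0) (g (suc n)) (ι (suc n) * g (suc n)) ⟩
    (d + c + 0ℚ * f 0 * g (suc n)) + (e + f 0 * (ι (suc n) * g (suc n)))
      ≡⟨ cong (λ x → (x + 0ℚ * f 0 * g (suc n)) + (e + f 0 * (ι (suc n) * g (suc n))))
         (sym (trans (conv-cong n (λ i → trans (cong (_* f (suc i)) (ι-suc i)) (lem₃ (ι i) (f (suc i)))) (λ _ → refl))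
           (conv-+ˡ n (λ i → ι i * f (suc i)) (f ∘ suc) g))) ⟩
    conv (suc n) (λ i → ι i * f i) g + conv (suc n) f (λ i → ι i * g i) ∎
    where
    open ≡-Reasoning
    c d e : ℚ
    c = conv n (f ∘ suc) g
    d = conv n (λ i → ι i * f (suc i)) g
    e = conv n (f ∘ suc) (λ i → ι i * g i)
    lem₁ : ∀ i c x y → (i + 1ℚ) * (c + x * y) ≡ i * c + c + x * ((i + 1ℚ) * y)
    lem₁ = solve-∀ ℚ-ring
    lem₂ : ∀ d e c x y z → d + e + c + x * z ≡ (d + c + 0ℚ * x * y) + (e + x * z)
    lem₂ = solve-∀ ℚ-ring
    lem₃ : ∀ i x → (i + 1ℚ) * x ≡ i * x + x
    lem₃ = solve-∀ ℚ-ring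

  term-deriv : ∀ k a → ι (suc k) * term (suc k) a ≡ a * term k a
  term-deriv k a = trans (lem (ι (suc k)) (term k a) a (+ 1 / suc k))
    (trans (cong (λ x → x * (a * term k a)) (ι-inv k)) (*-identityˡ _))
    where
    lem : ∀ i t a r → i * (t * (a * r)) ≡ i * r * (a * t)
    lem = solve-∀ ℚ-ring

  -- The binomial theorem without binomial coefficients: by `conv-leibniz` both sides satisfy
  -- `(n + 1) c (n + 1) = (a + b) c n`.
  term-+ : ∀ n a b → conv n (λ i → term i a) (λ i → term i b) ≡ term n (a + b)
  term-+ zero a b = refl
  term-+ (suc n) a b = *-cancelˡ (begin
    ι (suc n) * conv (suc n) f g                                  ≡⟨ conv-leibniz (suc n) f g ⟩
    conv (suc n) (λ i → ι i * f i) g + conv (suc n) f (λ i → ι i * g i)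
      ≡⟨ cong₂ _+_ left right ⟩
    a * conv n f g + b * conv n f g                               ≡⟨ sym (*-distribʳ-+ (conv n f g) a b) ⟩
    (a + b) * conv n f g                                          ≡⟨ cong ((a + b) *_) (term-+ n a b) ⟩
    (a + b) * term n (a + b)                                      ≡⟨ sym (term-deriv n (a + b)) ⟩
    ι (suc n) * term (suc n) (a + b)                              ∎)
    where
    open ≡-Reasoning
    f g : ℕ → ℚ
    f i = term i a
    g i = term i b
    *-cancelˡ : ∀ {p q} → ι (suc n) * p ≡ ι (suc n) * q → p ≡ q
    *-cancelˡ {p} {q} e = ≤-antisym
      (*-cancelˡ-≤-pos (ι (suc n)) {{positive (0<ι n)}} (≤-reflexive e))
      (*-cancelˡ-≤-pos (ι (suc n)) {{positive (0<ι n)}} (≤-reflexive (sym e)))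
    0-first : ∀ c x y → c + 0ℚ * x * y ≡ c
    0-first = solve-∀ ℚ-ring
    0-last : ∀ c x y → y * (0ℚ * x) + c ≡ c
    0-last = solve-∀ ℚ-ring
    left : conv (suc n) (λ i → ι i * f i) g ≡ a * conv n f g
    left = trans (0-first _ (f 0) (g (suc n)))
      (trans (conv-cong n (λ i → term-deriv i a) (λ _ → refl)) (conv-*ˡ n a f g))
    right : conv (suc n) f (λ i → ι i * g i) ≡ b * conv n f g
    right = trans (conv-sucʳ n f (λ i → ι i * g i)) (trans (0-last _ (g 0) (f (suc n)))
      (trans (conv-cong n (λ _ → refl) (λ i → term-deriv i b)) (conv-*ʳ n b f g)))

  -- Partial sums are the Cauchy product with the constant series 1, so using them in one factor
  -- yields the partial sums of the product.
  expSum-+ : ∀ n a b → conv n (λ i → expSum i a) (λ i → term i b) ≡ expSum n (a + b)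
  expSum-+ zero a b = refl
  expSum-+ (suc n) a b = begin
    conv n (λ i → expSum i a + term (suc i) a) g + 1ℚ * g (suc n)
      ≡⟨ cong (_+ 1ℚ * g (suc n)) (conv-+ˡ n (λ i → expSum i a) (λ i → term (suc i) a) g) ⟩
    conv n (λ i → expSum i a) g + conv n (λ i → term (suc i) a) g + 1ℚ * g (suc n)
      ≡⟨ +-assoc (conv n (λ i → expSum i a) g) (conv n (λ i → term (suc i) a) g) (1ℚ * g (suc n)) ⟩
    conv n (λ i → expSum i a) g + conv (suc n) (λ i → term i a) g
      ≡⟨ cong₂ _+_ (expSum-+ n a b) (term-+ (suc n) a b) ⟩
    expSum (suc n) (a + b) ∎
    where
    open ≡-Reasoning
    g : ℕ → ℚ
    g i = term i b

  conv-≤ : ∀ n f g {x} → (∀ i → 0ℚ ≤ g i) → (∀ i → i ℕ.≤ n → f i ≤ x) → conv n f g ≤ x * sumTo n g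
  conv-≤ zero f g {x} h k = *-monoʳ-≤-nonNeg (g 0) {{nonNegative (h 0)}} (k 0 ℕ.z≤n)
  conv-≤ (suc n) f g {x} h k = ≤-trans (+-mono-≤ (conv-≤ n (f ∘ suc) g h λ i l → k (suc i) (ℕ.s≤s l))
    (*-monoʳ-≤-nonNeg (g (suc n)) {{nonNegative (h (suc n))}} (k 0 ℕ.z≤n)))
    (≤-reflexive (sym (*-distribˡ-+ x (sumTo n g) (g (suc n)))))

  conv-≥ : ∀ n f g {x} → (∀ i → 0ℚ ≤ g i) → (∀ i → x ≤ f i) → x * sumTo n g ≤ conv n f g
  conv-≥ zero f g {x} h k = *-monoʳ-≤-nonNeg (g 0) {{nonNegative (h 0)}} (k 0)
  conv-≥ (suc n) f g {x} h k = ≤-trans (≤-reflexive (*-distribˡ-+ x (sumTo n g) (g (suc n))))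
    (+-mono-≤ (conv-≥ n (f ∘ suc) g h (k ∘ suc)) (*-monoʳ-≤-nonNeg (g (suc n)) {{nonNegative (h (suc n))}} (k 0)))

  conv-shift : ∀ d n f g → (∀ i → 0ℚ ≤ f i) → (∀ i → 0ℚ ≤ g i) → conv n (λ i → f (d ℕ.+ i)) g ≤ conv (d ℕ.+ n) f g
  conv-shift zero n f g _ _ = ≤-refl
  conv-shift (suc d) n f g hf hg = ≤-trans (conv-shift d n (f ∘ suc) g (hf ∘ suc) hg)
    (≤-by (hf 0 ⊠ hg (suc (d ℕ.+ n))) refl)

  sumTo-term : ∀ n a → sumTo n (λ i → term i a) ≡ expSum n a
  sumTo-term zero a = refl
  sumTo-term (suc n) a = cong (_+ term (suc n) a) (sumTo-term n a)

  0≤expSum : ∀ n {a} → 0ℚ ≤ a → 0ℚ ≤ expSum n a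
  0≤expSum n h = ≤-trans 0≤1 (1≤expSum n h)

  expSum-≤ : ∀ d n {a} → 0ℚ ≤ a → expSum n a ≤ expSum (d ℕ.+ n) a
  expSum-≤ zero n h = ≤-refl
  expSum-≤ (suc d) n h = ≤-trans (expSum-≤ d n h) (≤-by (0≤term (suc (d ℕ.+ n)) h) refl)

  expSum-mono : ∀ n {a b} → 0ℚ ≤ a → a ≤ b → expSum n a ≤ expSum n b
  expSum-mono zero h k = ≤-refl
  expSum-mono (suc n) h k = +-mono-≤ (expSum-mono n h k) (term-mono (suc n) h k)

  -- In the sum of `expSum-+` every factor `expSum (n - j) a` is replaced by the larger
  -- `expSum n a`.
  expSum-+-≤ : ∀ n {a b} → 0ℚ ≤ a → 0ℚ ≤ b → expSum n (a + b) ≤ expSum n a * expSum n b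
  expSum-+-≤ n {a} {b} ha hb = ≤-trans (≤-reflexive (sym (expSum-+ n a b)))
    (≤-trans (conv-≤ n (λ i → expSum i a) (λ i → term i b) (λ i → 0≤term i hb)
      (λ i l → subst (λ m → expSum i a ≤ expSum m a) (ℕP.m∸n+n≡m l) (expSum-≤ (n ℕ.∸ i) i ha)))
      (≤-reflexive (cong (expSum n a *_) (sumTo-term n b))))

  -- Among the terms of `expSum-+` at `n + n`, those with `j ≤ n` have a first factor of at least
  -- `expSum n a`; `conv-shift` drops the others.
  expSum-*-≤ : ∀ n {a b} → 0ℚ ≤ a → 0ℚ ≤ b → expSum n a * expSum n b ≤ expSum (n ℕ.+ n) (a + b)
  expSum-*-≤ n {a} {b} ha hb = ≤-trans (≤-reflexive (cong (expSum n a *_) (sym (sumTo-term n b))))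
    (≤-trans (conv-≥ n (λ i → expSum (n ℕ.+ i) a) (λ i → term i b) (λ i → 0≤term i hb)
        (λ i → subst (λ m → expSum n a ≤ expSum m a) (ℕP.+-comm i n) (expSum-≤ i n ha)))
      (≤-trans (conv-shift n n (λ i → expSum i a) (λ i → term i b) (λ i → 0≤expSum i ha) (λ i → 0≤term i hb))
        (≤-reflexive (expSum-+ (n ℕ.+ n) a b))))

  -- Order and products of Cauchy reals

  pointwise-≤ : ∀ {x y} → (∀ n → seq x n ≤ seq y n) → x ≤ᴿ y
  pointwise-≤ h _ δ>0 = 0 , λ n _ → ≤-trans (h n) (≤-by (<⇒≤ δ>0) refl)

  pointwise : ∀ {x y} → (∀ n → seq x n ≡ seq y n) → x ≤ᴿ y
  pointwise {x} {y} h = pointwise-≤ {x} {y} λ n → ≤-reflexive (h n)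

  ≤ᴿ-refl : ∀ {x} → x ≤ᴿ x
  ≤ᴿ-refl {x} = pointwise {x} {x} λ _ → refl

  ≤ᴿ-trans : ∀ {x y z} → x ≤ᴿ y → y ≤ᴿ z → x ≤ᴿ z
  ≤ᴿ-trans {x} {y} {z} h k δ δ>0 with halve δ>0
  ... | η , η>0 , refl = mapᵉ (λ {n} (p , q) → ≤-trans p (≤-trans (+-monoˡ-≤ η q)
    (≤-reflexive (+-assoc (seq z n) η η)))) (h η η>0 ∧ᵉ k η η>0)

  ≤ᴿ-preorder : Preorder 0ℓ 0ℓ 0ℓ
  ≤ᴿ-preorder = record
    { Carrier = ℝ
    ; _≈_ = _≡_
    ; _≲_ = _≤ᴿ_
    ; isPreorder = record
      { isEquivalence = isEquivalence
      ; reflexive = λ { {x} refl → ≤ᴿ-refl {x} }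
      ; trans = λ {x} {y} {z} → ≤ᴿ-trans {x} {y} {z}
      }
    }

  open import Relation.Binary.Reasoning.Preorder ≤ᴿ-preorder

  small : ∀ {M δ} → 0ℚ < M → 0ℚ < δ → ∃ λ η → 0ℚ < η × η ≤ 1ℚ × M * η ≤ δ
  small {M} {δ} M>0 δ>0 with shrink M>0 δ>0
  ... | η , η>0 , e = η ⊓ 1ℚ , min-pos η>0 0<1 , p⊓q≤q η 1ℚ ,
    subst (M * (η ⊓ 1ℚ) ≤_) e (*-monoˡ-≤-nonNeg M {{nonNegative (<⇒≤ M>0)}} (p⊓q≤p η 1ℚ))

  -- The hypotheses hold for approximants only up to `η`. Expanding `(b + η - a) * (c + η) ≥ 0`
  -- leaves an error of `η * (b - a + c + η)`, at most `η * (X + Y + (Z + 1))`.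
  *ᴿ-monoˡ : ∀ {x y z} → 0ℝ ≤ᴿ z → x ≤ᴿ y → x *ᴿ z ≤ᴿ y *ᴿ z
  *ᴿ-monoˡ {x} {y} {z} z≥0 h δ δ>0 with bounded x | bounded y | bounded z
  ... | X , X>0 , bx | Y , Y>0 , by | Z , Z>0 , bz
    with small (+-pos (+-pos X>0 Y>0) (+-pos Z>0 0<1)) δ>0
  ... | η , η>0 , η≤1 , Mη≤δ = mapᵉ (λ {n} (px , py , pz , pz≥0 , pxy) → go (seq x n) (seq y n) (seq z n) px py pz pz≥0 pxy)
      (bx ∧ᵉ by ∧ᵉ bz ∧ᵉ z≥0 η η>0 ∧ᵉ h η η>0)
    where
    go : ∀ a b c → abs a ≤ X → abs b ≤ Y → abs c ≤ Z → 0ℚ ≤ c + η → a ≤ b + η → a * c ≤ b * c + δ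
    go a b c ha hb hc c≥ ab = ≤-by
      (diff ab ⊠ c≥
        ⊞ <⇒≤ η>0 ⊠ (diff (≤-trans (-p≤∣p∣ a) ha) ⊞ diff (≤-trans (p≤∣p∣ b) hb) ⊞ diff (≤-trans (p≤∣p∣ c) hc) ⊞ diff η≤1)
        ⊞ diff Mη≤δ)
      (lem a b c η X Y Z δ)
      where
      lem : ∀ a b c η X Y Z δ → a * c + ((b + η - a) * (c + η)
        + η * ((X - - a) + (Y - b) + (Z - c) + (1ℚ - η)) + (δ - (X + Y + (Z + 1ℚ)) * η)) ≡ b * c + δ
      lem = solve-∀ ℚ-ring

  *ᴿ-comm : ∀ x y → x *ᴿ y ≤ᴿ y *ᴿ x
  *ᴿ-comm x y = pointwise {x *ᴿ y} {y *ᴿ x} λ n → *-comm (seq x n) (seq y n)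

  *ᴿ-mono : ∀ {x x′ y y′} → 0ℝ ≤ᴿ x′ → 0ℝ ≤ᴿ y → x ≤ᴿ x′ → y ≤ᴿ y′ → x *ᴿ y ≤ᴿ x′ *ᴿ y′
  *ᴿ-mono {x} {x′} {y} {y′} x′≥0 y≥0 h k = begin
    x *ᴿ y      ≲⟨ *ᴿ-monoˡ {x} {x′} {y} y≥0 h ⟩
    x′ *ᴿ y     ≲⟨ *ᴿ-comm x′ y ⟩
    y *ᴿ x′     ≲⟨ *ᴿ-monoˡ {y} {y′} {x′} x′≥0 k ⟩
    y′ *ᴿ x′    ≲⟨ *ᴿ-comm y′ x′ ⟩
    x′ *ᴿ y′    ∎

  *ᴿ-nonneg : ∀ {x y} → 0ℝ ≤ᴿ x → 0ℝ ≤ᴿ y → 0ℝ ≤ᴿ x *ᴿ y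
  *ᴿ-nonneg {x} {y} hx hy = begin
    0ℝ         ≲⟨ pointwise {0ℝ} {0ℝ *ᴿ y} (λ n → sym (*-zeroˡ (seq y n))) ⟩
    0ℝ *ᴿ y    ≲⟨ *ᴿ-monoˡ {0ℝ} {x} {y} hy hx ⟩
    x *ᴿ y     ∎

  fromℚ-mono : ∀ {p q} → p ≤ q → fromℚ p ≤ᴿ fromℚ q
  fromℚ-mono {p} {q} h = pointwise-≤ {fromℚ p} {fromℚ q} λ _ → h

  fromℕ-cancel : ∀ {m n} → fromℕ m ≤ᴿ fromℕ n → m ℕ.≤ n
  fromℕ-cancel {m} {n} h with m ℕP.≤? n
  ... | yes k = k
  ... | no k with h ½ (positive⁻¹ ½)
  ... | N , f = contradiction (≤-trans (≤-trans (≤-reflexive (sym (ι-suc n))) (ι-mono (ℕP.≰⇒> k))) (f N ℕP.≤-refl)) absurd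
    where
    absurd : ¬ (ι n + 1ℚ ≤ ι n + ½)
    absurd h = <-irrefl refl (<-≤-trans (positive⁻¹ ½) (≤-by (diff h) (lem (ι n))))
      where
      lem : ∀ i → ½ + ((i + ½) - (i + 1ℚ)) ≡ 0ℚ
      lem = solve-∀ ℚ-ring

  -- Permits proofs by contradiction. Beyond `K` both sequences vary by at most `η`, so one
  -- decidable comparison of rationals at index `K` either gives the claim or separates `y` from `x`
  -- by `η`.
  ≮⇒≥ᴿ : ∀ {x y} → ¬ (y <ᴿ x) → x ≤ᴿ y
  ≮⇒≥ᴿ {x} {y} h δ δ>0 with eighth δ>0
  ... | η , η>0 , refl with cauchy x η>0 | cauchy y η>0
  ... | M , f | N , g = K , λ n K≤n → go n K≤n (seq x K ≤? seq y K + ((η + η) + (η + η)))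
    where
    K : ℕ
    K = M ℕ.⊔ N
    xK : ∀ m n → K ℕ.≤ m → K ℕ.≤ n → seq x m ≤ seq x n + η
    xK m n k l = close⇒≤ {seq x m} {seq x n}
      (f m n (ℕP.≤-trans (ℕP.m≤m⊔n M N) k) (ℕP.≤-trans (ℕP.m≤m⊔n M N) l))
    yK : ∀ m n → K ℕ.≤ m → K ℕ.≤ n → seq y m ≤ seq y n + η
    yK m n k l = close⇒≤ {seq y m} {seq y n}
      (g m n (ℕP.≤-trans (ℕP.m≤n⊔m M N) k) (ℕP.≤-trans (ℕP.m≤n⊔m M N) l))
    lem : ∀ a b c d η → a + ((b + η - a) + (c + ((η + η) + (η + η)) - b) + (d + η - c) + η + η)
      ≡ d + (((η + η) + (η + η)) + ((η + η) + (η + η)))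
    lem = solve-∀ ℚ-ring
    lem′ : ∀ a b c d η → a + η + ((b + η - a) + (c - (b + ((η + η) + (η + η)))) + (d + η - c) + η) ≡ d
    lem′ = solve-∀ ℚ-ring
    go : ∀ n → K ℕ.≤ n → Dec (seq x K ≤ seq y K + ((η + η) + (η + η))) →
      seq x n ≤ seq y n + (((η + η) + (η + η)) + ((η + η) + (η + η)))
    go n K≤n (yes p) = ≤-by
      (diff (xK n K K≤n ℕP.≤-refl) ⊞ diff p ⊞ diff (yK K n ℕP.≤-refl K≤n) ⊞ <⇒≤ η>0 ⊞ <⇒≤ η>0)
      (lem (seq x n) (seq x K) (seq y K) (seq y n) η)
    go n K≤n (no p) = ⊥-elim (h (η , η>0 , K , λ m K≤m → ≤-by
      (diff (yK m K K≤m ℕP.≤-refl) ⊞ diff (<⇒≤ (≰⇒> p)) ⊞ diff (xK K m ℕP.≤-refl K≤m) ⊞ <⇒≤ η>0)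
      (lem′ (seq y m) (seq y K) (seq x K) (seq x m) η)))

  -- If `x` exceeded `y` by `4 η` where `y ≥ - η`, then `x² - y²` would be at least `8 η²`, whereas
  -- it is at most `η²`.
  sq-cancel-≤ : ∀ {x y} → 0ℝ ≤ᴿ y → x *ᴿ x ≤ᴿ y *ᴿ y → x ≤ᴿ y
  sq-cancel-≤ {x} {y} y≥0 h = ≮⇒≥ᴿ {x} {y} λ (δ , δ>0 , e) → refute δ δ>0 e
    where
    refute : ∀ δ → 0ℚ < δ → Eventually (λ n → seq y n + δ ≤ seq x n) → ⊥
    refute δ δ>0 e with quarter δ>0
    ... | η , η>0 , refl with e ∧ᵉ y≥0 η η>0 ∧ᵉ h (η * η) (*-pos η>0 η>0)
    ... | N , f with f N ℕP.≤-refl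
    ... | p , q , r = <-irrefl refl (<-≤-trans (*-pos η>0 η>0) (≤-by
        (diff r ⊞ (η≥0 ⊞ η≥0) ⊠ (η≥0 ⊞ η≥0 ⊞ η≥0 ⊞ (q ⊞ q ⊞ (q ⊞ q)) ⊞ (diff p ⊞ diff p ⊞ diff p)) ⊞ diff p ⊠ (q ⊞ q ⊞ diff p))
        (lem (seq x N) (seq y N) η)))
      where
      η≥0 : 0ℚ ≤ η
      η≥0 = <⇒≤ η>0
      -- In terms of d = x - (y + 4 η) and q = y + η.
      lem : ∀ x y η →
          η * η + ((y * y + η * η) - x * x + (η + η) * (η + η + η
            + ((y + η) + (y + η) + ((y + η) + (y + η)))
            + ((x - (y + ((η + η) + (η + η)))) + (x - (y + ((η + η) + (η + η)))) + (x - (y + ((η + η) + (η + η))))))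
            + (x - (y + ((η + η) + (η + η)))) * ((y + η) + (y + η) + (x - (y + ((η + η) + (η + η)))))) ≡ 0ℚ
      lem = solve-∀ ℚ-ring

  -- The functional equation of `exp`

  NonNeg : ℝ → Set
  NonNeg x = ∀ n → 0ℚ ≤ seq x n

  nonNeg⇒≥0 : ∀ {x} → NonNeg x → 0ℝ ≤ᴿ x
  nonNeg⇒≥0 {x} h = pointwise-≤ {0ℝ} {x} h

  exp-nonNeg : ∀ {x} → NonNeg x → NonNeg (exp x)
  exp-nonNeg h n = 0≤expSum n (h n)

  -- `NonNeg` is stronger than `0ℝ ≤ᴿ x`: it puts every approximant into the range where the
  -- monotonicity of `expSum n` is available.
  exp-mono : ∀ {x y} → NonNeg x → x ≤ᴿ y → exp x ≤ᴿ exp y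
  exp-mono {x} {y} x≥0 h δ δ>0 with bounded y
  ... | Y , Y>0 , by with modulus expSum-continuous (Y + 1ℚ) δ>0
  ... | η , η>0 , e = mapᵉ (λ {n} (p , q , r) → go n p q r) (by ∧ᵉ h ζ ζ>0 ∧ᵉ diag e)
    where
    ζ : ℚ
    -- The cap 1 keeps `seq y n + ζ` within the bound `Y + 1ℚ` for which the modulus was taken.
    ζ = η ⊓ 1ℚ
    ζ>0 : 0ℚ < ζ
    ζ>0 = min-pos η>0 0<1
    go : ∀ n → abs (seq y n) ≤ Y → seq x n ≤ seq y n + ζ →
      (∀ a b → abs a ≤ Y + 1ℚ → abs b ≤ Y + 1ℚ → abs (a - b) ≤ η → abs (expSum n a - expSum n b) ≤ δ) →
      expSum n (seq x n) ≤ expSum n (seq y n) + δ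
    go n p q r = ≤-trans (expSum-mono n (x≥0 n) q) (close⇒≤ {expSum n (seq y n + ζ)} {expSum n (seq y n)}
      (r (seq y n + ζ) (seq y n)
        (≤-trans (∣p+q∣≤∣p∣+∣q∣ (seq y n) ζ) (+-mono-≤ p (≤-trans (≤-reflexive (0≤p⇒∣p∣≡p (<⇒≤ ζ>0))) (p⊓q≤q η 1ℚ))))
        (≤-trans p (≤-by 0≤1 refl))
        (≤-trans (≤-reflexive (trans (cong abs (lem (seq y n) ζ)) (0≤p⇒∣p∣≡p (<⇒≤ ζ>0)))) (p⊓q≤p η 1ℚ))))
      where
      lem : ∀ a z → a + z - a ≡ z
      lem = solve-∀ ℚ-ring

  exp-+-≤ : ∀ {x y} → NonNeg x → NonNeg y → exp (x +ᴿ y) ≤ᴿ exp x *ᴿ exp y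
  exp-+-≤ {x} {y} hx hy = pointwise-≤ {exp (x +ᴿ y)} {exp x *ᴿ exp y} λ n → expSum-+-≤ n (hx n) (hy n)

  -- The rational bound doubles the truncation index; the modulus of `expSum` compares the
  -- truncations at `n + n` and `n` for the same argument.
  exp-*-≤ : ∀ {x y} → NonNeg x → NonNeg y → exp x *ᴿ exp y ≤ᴿ exp (x +ᴿ y)
  exp-*-≤ {x} {y} hx hy δ δ>0 with bounded (x +ᴿ y)
  ... | B , B>0 , b with modulus expSum-continuous B δ>0
  ... | η , η>0 , N , e = mapᵉ (λ { {n} (p , N≤n) → ≤-trans (expSum-*-≤ n (hx n) (hy n))
    (close⇒≤ {expSum (n ℕ.+ n) (s n)} {expSum n (s n)}
      (e (n ℕ.+ n) n (ℕP.≤-trans N≤n (ℕP.m≤m+n n n)) N≤n (s n) (s n) p p (∣p-p∣≤ (s n) (<⇒≤ η>0)))) })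
    (b ∧ᵉ (N , λ _ k → k))
    where
    s : ℕ → ℚ
    s n = seq x n + seq y n

  times : ℕ → ℝ → ℝ
  times zero    x = 0ℝ
  times (suc k) x = times k x +ᴿ x

  pow : ℝ → ℕ → ℝ
  pow x zero    = 1ℝ
  pow x (suc k) = pow x k *ᴿ x

  times-nonNeg : ∀ k {x} → NonNeg x → NonNeg (times k x)
  times-nonNeg zero h n = ≤-refl
  times-nonNeg (suc k) h n = times-nonNeg k h n ⊞ h n

  pow-nonneg : ∀ k {x} → 0ℝ ≤ᴿ x → 0ℝ ≤ᴿ pow x k
  pow-nonneg zero h = fromℚ-mono 0≤1
  pow-nonneg (suc k) {x} h = *ᴿ-nonneg {pow x k} {x} (pow-nonneg k h) h

  pow-mono : ∀ k {x y} → 0ℝ ≤ᴿ x → x ≤ᴿ y → pow x k ≤ᴿ pow y k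
  pow-mono zero h l = ≤ᴿ-refl {1ℝ}
  pow-mono (suc k) {x} {y} h l = *ᴿ-mono {pow x k} {pow y k} {x} {y}
    (pow-nonneg k (≤ᴿ-trans {0ℝ} {x} {y} h l)) h (pow-mono k h l) l

  exp-times-≤ : ∀ k {x} → NonNeg x → exp (times k x) ≤ᴿ pow (exp x) k
  exp-times-≤ zero h = pointwise {exp 0ℝ} {1ℝ} expSum-0
  exp-times-≤ (suc k) {x} h = begin
    exp (times k x +ᴿ x)          ≲⟨ exp-+-≤ {times k x} {x} (times-nonNeg k h) h ⟩
    exp (times k x) *ᴿ exp x      ≲⟨ *ᴿ-monoˡ {exp (times k x)} {pow (exp x) k} {exp x}
                                       (nonNeg⇒≥0 {exp x} (exp-nonNeg {x} h)) (exp-times-≤ k h) ⟩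
    pow (exp x) k *ᴿ exp x        ∎

  exp-times-≥ : ∀ k {x} → NonNeg x → pow (exp x) k ≤ᴿ exp (times k x)
  exp-times-≥ zero h = pointwise {1ℝ} {exp 0ℝ} λ n → sym (expSum-0 n)
  exp-times-≥ (suc k) {x} h = begin
    pow (exp x) k *ᴿ exp x        ≲⟨ *ᴿ-monoˡ {pow (exp x) k} {exp (times k x)} {exp x}
                                       (nonNeg⇒≥0 {exp x} (exp-nonNeg {x} h)) (exp-times-≥ k h) ⟩
    exp (times k x) *ᴿ exp x      ≲⟨ exp-*-≤ {times k x} {x} (times-nonNeg k h) h ⟩
    exp (times k x +ᴿ x)          ∎

  seq-times : ∀ k x n → seq (times k x) n ≡ ι k * seq x n
  seq-times zero x n = sym (*-zeroˡ (seq x n))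
  seq-times (suc k) x n = trans (cong (_+ seq x n) (seq-times k x n))
    (trans (lem (ι k) (seq x n)) (cong (_* seq x n) (sym (ι-suc k))))
    where
    lem : ∀ i a → i * a + a ≡ (i + 1ℚ) * a
    lem = solve-∀ ℚ-ring

  ι-+ : ∀ m n → ι (m ℕ.+ n) ≡ ι m + ι n
  ι-+ zero n = sym (+-identityˡ (ι n))
  ι-+ (suc m) n = trans (ι-suc (m ℕ.+ n)) (trans (cong (_+ 1ℚ) (ι-+ m n))
    (trans (lem (ι m) (ι n)) (cong (_+ ι n) (sym (ι-suc m)))))
    where
    lem : ∀ a b → a + b + 1ℚ ≡ a + 1ℚ + b
    lem = solve-∀ ℚ-ring

  ι-* : ∀ m n → ι (m ℕ.* n) ≡ ι m * ι n
  ι-* zero n = sym (*-zeroˡ (ι n))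
  ι-* (suc m) n = trans (ι-+ n (m ℕ.* n)) (trans (cong (λ x → ι n + x) (ι-* m n))
    (trans (lem (ι m) (ι n)) (cong (_* ι n) (sym (ι-suc m)))))
    where
    lem : ∀ a b → b + a * b ≡ (a + 1ℚ) * b
    lem = solve-∀ ℚ-ring

  seq-pow-fromℕ : ∀ m k n → seq (pow (fromℕ m) k) n ≡ ι (m ℕ.^ k)
  seq-pow-fromℕ m zero n = refl
  seq-pow-fromℕ m (suc k) n = trans (cong (_* ι m) (seq-pow-fromℕ m k n))
    (trans (*-comm (ι (m ℕ.^ k)) (ι m)) (sym (ι-* m (m ℕ.^ k))))

  -- Bounds on `exp (W x)` and on the ratio of the roots

  -- If e ^ w > 9 N / 8 then n ^ 8 = e ^ (8 w e ^ w) ≥ (e ^ w) ^ (9 N) ≥ N ^ (9 N).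
  expW-bound : ∀ {w l : ℝ} {n N} → NonNeg w → NonNeg l → w *ᴿ exp w ≃ᴿ l → exp l ≃ᴿ fromℕ n →
    n ℕ.^ 8 ℕ.< N ℕ.^ (9 ℕ.* N) → fromℕ 8 *ᴿ exp w ≤ᴿ fromℕ (9 ℕ.* N)
  expW-bound {w} {l} {n} {N} w≥0 l≥0 w-eq l-eq n<N = ≮⇒≥ᴿ {fromℕ 8 *ᴿ exp w} {fromℕ K} λ (δ , δ>0 , e) →
      ℕP.<⇒≱ n<N (fromℕ-cancel (refute (λ δ′ δ′>0 → mapᵉ (λ {m} h →
        ≤-trans (≤-by (<⇒≤ δ>0) refl) (≤-trans h (≤-by (<⇒≤ δ′>0) refl))) e)))
    where
    K : ℕ
    K = 9 ℕ.* N
    expw≥0 : 0ℝ ≤ᴿ exp w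
    expw≥0 = nonNeg⇒≥0 {exp w} (exp-nonNeg {w} w≥0)
    module _ (K≤ : fromℕ K ≤ᴿ fromℕ 8 *ᴿ exp w) where
      Kw≤8l : times K w ≤ᴿ times 8 l
      Kw≤8l = begin
        times K w                        ≲⟨ pointwise {times K w} {fromℕ K *ᴿ w} (seq-times K w) ⟩
        fromℕ K *ᴿ w                     ≲⟨ *ᴿ-monoˡ {fromℕ K} {fromℕ 8 *ᴿ exp w} {w} (nonNeg⇒≥0 {w} w≥0) K≤ ⟩
        fromℕ 8 *ᴿ exp w *ᴿ w            ≲⟨ pointwise {fromℕ 8 *ᴿ exp w *ᴿ w} {w *ᴿ exp w *ᴿ fromℕ 8}
                                              (λ m → lem (ι 8) (seq (exp w) m) (seq w m)) ⟩
        w *ᴿ exp w *ᴿ fromℕ 8            ≲⟨ *ᴿ-monoˡ {w *ᴿ exp w} {l} {fromℕ 8} (fromℚ-mono (0≤ι 8)) (proj₁ w-eq) ⟩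
        l *ᴿ fromℕ 8                     ≲⟨ pointwise {l *ᴿ fromℕ 8} {times 8 l}
                                              (λ m → trans (*-comm (seq l m) (ι 8)) (sym (seq-times 8 l m))) ⟩
        times 8 l                        ∎
        where
        lem : ∀ a b c → a * b * c ≡ c * b * a
        lem = solve-∀ ℚ-ring
      N≤expw : fromℕ N ≤ᴿ exp w
      N≤expw = begin
        fromℕ N                             ≲⟨ pointwise {fromℕ N} {fromℚ eighth⁻ *ᴿ fromℕ (8 ℕ.* N)} (λ _ →
                                                 trans (sym (*-identityˡ (ι N))) (trans (*-assoc eighth⁻ (ι 8) (ι N))
                                                   (cong (eighth⁻ *_) (sym (ι-* 8 N))))) ⟩
        fromℚ eighth⁻ *ᴿ fromℕ (8 ℕ.* N)    ≲⟨ mono {fromℕ (8 ℕ.* N)} {fromℕ K} (fromℚ-mono (ι-mono (ℕP.*-monoˡ-≤ N (ℕP.n≤1+n 8)))) ⟩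
        fromℚ eighth⁻ *ᴿ fromℕ K            ≲⟨ mono {fromℕ K} {fromℕ 8 *ᴿ exp w} K≤ ⟩
        fromℚ eighth⁻ *ᴿ (fromℕ 8 *ᴿ exp w) ≲⟨ pointwise {fromℚ eighth⁻ *ᴿ (fromℕ 8 *ᴿ exp w)} {exp w} (λ m →
                                                 trans (sym (*-assoc eighth⁻ (ι 8) (seq (exp w) m))) (*-identityˡ _)) ⟩
        exp w                               ∎
        where
        eighth⁻ : ℚ
        eighth⁻ = + 1 / 8
        eighth⁻≥0 : 0ℝ ≤ᴿ fromℚ eighth⁻
        eighth⁻≥0 = fromℚ-mono (<⇒≤ (0<1/ 7))
        mono : ∀ {x y} → x ≤ᴿ y → fromℚ eighth⁻ *ᴿ x ≤ᴿ fromℚ eighth⁻ *ᴿ y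
        mono {x} {y} h = begin
          fromℚ eighth⁻ *ᴿ x  ≲⟨ *ᴿ-comm (fromℚ eighth⁻) x ⟩
          x *ᴿ fromℚ eighth⁻  ≲⟨ *ᴿ-monoˡ {x} {y} {fromℚ eighth⁻} eighth⁻≥0 h ⟩
          y *ᴿ fromℚ eighth⁻  ≲⟨ *ᴿ-comm y (fromℚ eighth⁻) ⟩
          fromℚ eighth⁻ *ᴿ y  ∎
      refute : fromℕ (N ℕ.^ K) ≤ᴿ fromℕ (n ℕ.^ 8)
      refute = begin
        fromℕ (N ℕ.^ K)       ≲⟨ pointwise {fromℕ (N ℕ.^ K)} {pow (fromℕ N) K} (λ m → sym (seq-pow-fromℕ N K m)) ⟩
        pow (fromℕ N) K       ≲⟨ pow-mono K {fromℕ N} {exp w} (fromℚ-mono (0≤ι N)) N≤expw ⟩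
        pow (exp w) K         ≲⟨ exp-times-≥ K {w} w≥0 ⟩
        exp (times K w)       ≲⟨ exp-mono {times K w} {times 8 l} (times-nonNeg K w≥0) Kw≤8l ⟩
        exp (times 8 l)       ≲⟨ exp-times-≤ 8 {l} l≥0 ⟩
        pow (exp l) 8         ≲⟨ pow-mono 8 {exp l} {fromℕ n} (nonNeg⇒≥0 {exp l} (exp-nonNeg {l} l≥0)) (proj₁ l-eq) ⟩
        pow (fromℕ n) 8       ≲⟨ pointwise {pow (fromℕ n) 8} {fromℕ (n ℕ.^ 8)} (seq-pow-fromℕ n 8) ⟩
        fromℕ (n ℕ.^ 8)       ∎

  -- Here a = √w, b = √l and r = 1/b, where w e = l with e = exp w.
  ratio-bound : ∀ {τ} {a b r w l e c : ℝ} → 0ℚ ≤ τ → 0ℝ ≤ᴿ a → 0ℝ ≤ᴿ r → 0ℝ ≤ᴿ w → 0ℝ ≤ᴿ c →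
    a *ᴿ a ≃ᴿ w → b *ᴿ b ≃ᴿ l → r *ᴿ b ≃ᴿ 1ℝ → w *ᴿ e ≃ᴿ l → fromℚ (τ * τ) *ᴿ e ≤ᴿ c *ᴿ c →
    fromℚ τ ≤ᴿ c *ᴿ a *ᴿ r
  ratio-bound {τ} {a} {b} {r} {w} {l} {e} {c} τ≥0 a≥0 r≥0 w≥0 c≥0 a-eq b-eq r-eq e-eq h = begin
    fromℚ τ                   ≲⟨ pointwise {fromℚ τ} {1ℝ *ᴿ fromℚ τ} (λ _ → sym (*-identityˡ τ)) ⟩
    1ℝ *ᴿ fromℚ τ             ≲⟨ *ᴿ-monoˡ {1ℝ} {r *ᴿ b} {fromℚ τ} (fromℚ-mono τ≥0) (proj₂ r-eq) ⟩
    r *ᴿ b *ᴿ fromℚ τ         ≲⟨ pointwise {r *ᴿ b *ᴿ fromℚ τ} {fromℚ τ *ᴿ b *ᴿ r} (λ n → lem₁ (seq r n) (seq b n) τ) ⟩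
    fromℚ τ *ᴿ b *ᴿ r         ≲⟨ *ᴿ-monoˡ {fromℚ τ *ᴿ b} {c *ᴿ a} {r} r≥0
                                   (sq-cancel-≤ {fromℚ τ *ᴿ b} {c *ᴿ a} (*ᴿ-nonneg {c} {a} c≥0 a≥0) squares) ⟩
    c *ᴿ a *ᴿ r               ∎
    where
    lem₁ : ∀ x y z → x * y * z ≡ z * y * x
    lem₁ = solve-∀ ℚ-ring
    lem₂ : ∀ t b → t * b * (t * b) ≡ b * b * (t * t)
    lem₂ = solve-∀ ℚ-ring
    lem₃ : ∀ w e t → w * e * (t * t) ≡ t * t * e * w
    lem₃ = solve-∀ ℚ-ring
    lem₄ : ∀ a c → a * a * (c * c) ≡ c * a * (c * a)
    lem₄ = solve-∀ ℚ-ring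
    τ² : ℝ
    τ² = fromℚ (τ * τ)
    τ²≥0 : 0ℝ ≤ᴿ τ²
    τ²≥0 = fromℚ-mono (τ≥0 ⊠ τ≥0)
    squares : fromℚ τ *ᴿ b *ᴿ (fromℚ τ *ᴿ b) ≤ᴿ c *ᴿ a *ᴿ (c *ᴿ a)
    squares = begin
      fromℚ τ *ᴿ b *ᴿ (fromℚ τ *ᴿ b)  ≲⟨ pointwise {fromℚ τ *ᴿ b *ᴿ (fromℚ τ *ᴿ b)} {b *ᴿ b *ᴿ τ²} (λ n → lem₂ τ (seq b n)) ⟩
      b *ᴿ b *ᴿ τ²                    ≲⟨ *ᴿ-monoˡ {b *ᴿ b} {l} {τ²} τ²≥0 (proj₁ b-eq) ⟩
      l *ᴿ τ²                         ≲⟨ *ᴿ-monoˡ {l} {w *ᴿ e} {τ²} τ²≥0 (proj₂ e-eq) ⟩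
      w *ᴿ e *ᴿ τ²                    ≲⟨ pointwise {w *ᴿ e *ᴿ τ²} {τ² *ᴿ e *ᴿ w} (λ n → lem₃ (seq w n) (seq e n) τ) ⟩
      τ² *ᴿ e *ᴿ w                    ≲⟨ *ᴿ-monoˡ {τ² *ᴿ e} {c *ᴿ c} {w} w≥0 h ⟩
      c *ᴿ c *ᴿ w                     ≲⟨ *ᴿ-comm (c *ᴿ c) w ⟩
      w *ᴿ (c *ᴿ c)                   ≲⟨ *ᴿ-monoˡ {w} {a *ᴿ a} {c *ᴿ c} (*ᴿ-nonneg {c} {c} c≥0 c≥0) (proj₂ a-eq) ⟩
      a *ᴿ a *ᴿ (c *ᴿ c)              ≲⟨ pointwise {a *ᴿ a *ᴿ (c *ᴿ c)} {c *ᴿ a *ᴿ (c *ᴿ a)} (λ n → lem₄ (seq a n) (seq c n)) ⟩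
      c *ᴿ a *ᴿ (c *ᴿ a)              ∎

  -- Application to `W` and `log`

  W-nonNeg : ∀ x → NonNeg ⟨ W x ⟩
  W-nonNeg (x , x≥0) = Solve.z≥0 (W-solvable x x≥0)

  log-nonNeg : ∀ x x≥1 → NonNeg ⟨ log x x≥1 ⟩
  log-nonNeg x x≥1 = Solve.z≥0 (log-solvable x x≥1)

  recip≥0 : ∀ x x>0 → 0ℝ ≤ᴿ recip x x>0
  recip≥0 x x>0 = Solve.solution≥0 (recip-solvable x x>0)

  -- Since `x = W x * exp (W x)`, the quotient of the roots is `1 / √(exp (W x))`, so the claim
  -- reduces to an inequality of squares without root or division.
  √W÷√-bound : ∀ {τ} (x : ℝ≥0) (√x>0 : 0ℝ <ᴿ ⟨ √ x ⟩) (c : ℝ) → 0ℚ ≤ τ → 0ℝ ≤ᴿ c →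
    fromℚ (τ * τ) *ᴿ exp ⟨ W x ⟩ ≤ᴿ c *ᴿ c → fromℚ τ ≤ᴿ c *ᴿ ⟨ √ (W x) ⟩ ÷ ⟨ √ x ⟩ [ √x>0 ]
  √W÷√-bound {τ} x √x>0 c τ≥0 c≥0 =
    ratio-bound {τ} {⟨ √ (W x) ⟩} {⟨ √ x ⟩} {recip ⟨ √ x ⟩ √x>0} {⟨ W x ⟩} {⟨ x ⟩} {exp ⟨ W x ⟩} {c} τ≥0
      (proj₂ (√ (W x))) (recip≥0 ⟨ √ x ⟩ √x>0) (proj₂ (W x)) c≥0
      (√-spec (W x)) (√-spec x) (recip-spec ⟨ √ x ⟩ √x>0) (W-spec x)

  large-case : ∀ {n w l} T → NonNeg w → NonNeg l → w *ᴿ exp w ≃ᴿ l → exp l ≃ᴿ fromℕ n →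
    (∃ λ t → 3 ℕ.* T ℕ.* suc t ℕ.≤ 4 ℕ.* n × ¬ Fits n (twice-square (suc t))) →
    fromℚ (ι T * ι T) *ᴿ exp w ≤ᴿ (fromℕ 2 +ᴿ 0ℝ) *ᴿ fromℕ n *ᴿ ((fromℕ 2 +ᴿ 0ℝ) *ᴿ fromℕ n)
  large-case {n} {w} {l} T w≥0 l≥0 w-eq l-eq (t , small-T , ¬fits) = begin
    fromℚ (ι T * ι T) *ᴿ exp w             ≲⟨ pointwise {fromℚ (ι T * ι T) *ᴿ exp w} {fromℕ 8 *ᴿ exp w *ᴿ fromℚ q}
                                                (λ m → lem₁ (ι T * ι T) (seq (exp w) m)) ⟩
    fromℕ 8 *ᴿ exp w *ᴿ fromℚ q            ≲⟨ *ᴿ-monoˡ {fromℕ 8 *ᴿ exp w} {fromℕ (9 ℕ.* N)} {fromℚ q} (fromℚ-mono q≥0)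
                                                (expW-bound {w} {l} {n} {N} w≥0 l≥0 w-eq l-eq n<N) ⟩
    fromℕ (9 ℕ.* N) *ᴿ fromℚ q             ≲⟨ pointwise-≤ {fromℕ (9 ℕ.* N) *ᴿ fromℚ q}
                                                {(fromℕ 2 +ᴿ 0ℝ) *ᴿ fromℕ n *ᴿ ((fromℕ 2 +ᴿ 0ℝ) *ᴿ fromℕ n)} (λ _ → rational) ⟩
    (fromℕ 2 +ᴿ 0ℝ) *ᴿ fromℕ n *ᴿ ((fromℕ 2 +ᴿ 0ℝ) *ᴿ fromℕ n) ∎
    where
    N : ℕ
    N = twice-square (suc t)
    q : ℚ
    q = (ι T * ι T) * (+ 1 / 8)
    q≥0 : 0ℚ ≤ q
    q≥0 = 0≤ι T ⊠ 0≤ι T ⊠ <⇒≤ (0<1/ 7)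
    n<N : n ℕ.^ 8 ℕ.< N ℕ.^ (9 ℕ.* N)
    n<N = subst (n ℕ.^ 8 ℕ.<_) (trans (ℕP.^-*-assoc N N 9) (cong (N ℕ.^_) (ℕP.*-comm N 9))) (ℕP.≰⇒> (¬fits ∘ mkFits))
    lem₁ : ∀ x y → x * y ≡ ι 8 * y * (x * (+ 1 / 8))
    lem₁ x y = trans (sym (*-identityˡ (x * y))) (trans (cong (_* (x * y)) (sym (ι-inv 7))) (lem (ι 8) (+ 1 / 8) x y))
      where
      lem : ∀ i j x y → i * j * (x * y) ≡ i * y * (x * j)
      lem = solve-∀ ℚ-ring
    -- Twice the square of `small-T`, with `N = 2 (t + 1)²`. Nothing is lost: the factor 4/3 in the
    -- bound on `T` is exactly what 9/8 and the target constant 2 allow.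
    natural : 9 ℕ.* N ℕ.* (T ℕ.* T) ℕ.≤ 8 ℕ.* ((2 ℕ.* n) ℕ.* (2 ℕ.* n))
    natural = subst₂ ℕ._≤_ (lemˡ T (suc t)) (lemʳ n) (ℕP.*-monoʳ-≤ 2 (ℕP.*-mono-≤ small-T small-T))
      where
      lemˡ : ∀ T s → 2 ℕ.* (3 ℕ.* T ℕ.* s ℕ.* (3 ℕ.* T ℕ.* s)) ≡ 9 ℕ.* ((s ℕ.+ s) ℕ.* s) ℕ.* (T ℕ.* T)
      lemˡ = ℕ.solve-∀
      lemʳ : ∀ n → 2 ℕ.* (4 ℕ.* n ℕ.* (4 ℕ.* n)) ≡ 8 ℕ.* ((2 ℕ.* n) ℕ.* (2 ℕ.* n))
      lemʳ = ℕ.solve-∀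
    rational : ι (9 ℕ.* N) * q ≤ (ι 2 + 0ℚ) * ι n * ((ι 2 + 0ℚ) * ι n)
    rational = ≤-trans (≤-reflexive left)
      (≤-trans (*-monoʳ-≤-nonNeg (+ 1 / 8) {{nonNegative (<⇒≤ (0<1/ 7))}} (ι-mono natural)) (≤-reflexive right))
      where
      left : ι (9 ℕ.* N) * q ≡ ι (9 ℕ.* N ℕ.* (T ℕ.* T)) * (+ 1 / 8)
      left = trans (sym (*-assoc (ι (9 ℕ.* N)) (ι T * ι T) (+ 1 / 8)))
        (cong (_* (+ 1 / 8)) (sym (trans (ι-* (9 ℕ.* N) (T ℕ.* T)) (cong (ι (9 ℕ.* N) *_) (ι-* T T)))))
      right : ι (8 ℕ.* ((2 ℕ.* n) ℕ.* (2 ℕ.* n))) * (+ 1 / 8) ≡ (ι 2 + 0ℚ) * ι n * ((ι 2 + 0ℚ) * ι n)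
      right = trans (cong (_* (+ 1 / 8)) (trans (ι-* 8 ((2 ℕ.* n) ℕ.* (2 ℕ.* n)))
          (cong (ι 8 *_) (trans (ι-* (2 ℕ.* n) (2 ℕ.* n)) (cong₂ _*_ (ι-* 2 n) (ι-* 2 n))))))
        (trans (lem (ι 8) (+ 1 / 8) (ι 2) (ι n))
          (trans (cong (_* ((ι 2 + 0ℚ) * ι n * ((ι 2 + 0ℚ) * ι n))) (ι-inv 7)) (*-identityˡ _)))
        where
        lem : ∀ i j t n → i * (t * n * (t * n)) * j ≡ i * j * ((t + 0ℚ) * n * ((t + 0ℚ) * n))
        lem = solve-∀ ℚ-ring

  -- For the small `n` any finite error will do: `M` bounds `e`, and `M ≤ (2 + M)²`.
  crude-case : ∀ {n} T (e : ℝ) → NonNeg e → T ℕ.≤ n → let M = proj₁ (bounded e) in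
    fromℚ (ι T * ι T) *ᴿ e ≤ᴿ (fromℕ 2 +ᴿ fromℚ M) *ᴿ fromℕ n *ᴿ ((fromℕ 2 +ᴿ fromℚ M) *ᴿ fromℕ n)
  crude-case {n} T e e≥0 T≤n δ δ>0 = mapᵉ (λ {m} h → ≤-trans (go (seq e m) (e≥0 m) (≤-trans (p≤∣p∣ (seq e m)) h))
      (≤-by (<⇒≤ δ>0) refl)) (proj₂ (proj₂ (bounded e)))
    where
    M : ℚ
    M = proj₁ (bounded e)
    M≥0 : 0ℚ ≤ M
    M≥0 = <⇒≤ (proj₁ (proj₂ (bounded e)))
    go : ∀ e → 0ℚ ≤ e → e ≤ M → ι T * ι T * e ≤ (ι 2 + M) * ι n * ((ι 2 + M) * ι n)
    go e e≥0 e≤M = ≤-trans (*-mono-≤-nonNeg (0≤ι n ⊠ 0≤ι n) e≥0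
        (*-mono-≤-nonNeg (0≤ι n) (0≤ι T) (ι-mono T≤n) (ι-mono T≤n)) e≤M)
      (≤-by (0≤ι n ⊠ 0≤ι n ⊠ (M≥0 ⊠ M≥0 ⊞ M≥0 ⊞ M≥0 ⊞ M≥0 ⊞ 0≤ι 4)) (lem (ι n) M))
      where
      lem : ∀ n m → n * n * m + n * n * (m * m + m + m + m + ι 4) ≡ (ι 2 + m) * n * ((ι 2 + m) * n)
      lem = solve-∀ ℚ-ring

  scale≥0 : ∀ n {ε} → NonNeg ε → 0ℝ ≤ᴿ (fromℕ 2 +ᴿ ε) *ᴿ fromℕ n
  scale≥0 n {ε} h = nonNeg⇒≥0 {(fromℕ 2 +ᴿ ε) *ᴿ fromℕ n} λ m → (0≤ι 2 ⊞ h m) ⊠ 0≤ι n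

  infix 4 _≤√W÷√log[_,_]
  _≤√W÷√log[_,_] : ∀ {n} → ℕ → ℝ → 2 ℕ.≤ n → Set
  _≤√W÷√log[_,_] {n} T ε 2≤n = fromℕ T ≤ᴿ (fromℕ 2 +ᴿ ε) *ᴿ fromℕ n *ᴿ ⟨ √ (W (log-n n 2≤n)) ⟩
    ÷ ⟨ √ (log-n n 2≤n) ⟩ [ √-pos (log-n n 2≤n) (log-n>0 n 2≤n) ]

  large-bound : ∀ n (2≤n : 2 ℕ.≤ n) T →
    (∃ λ t → 3 ℕ.* T ℕ.* suc t ℕ.≤ 4 ℕ.* n × ¬ Fits n (twice-square (suc t))) → T ≤√W÷√log[ 0ℝ , 2≤n ]
  large-bound n 2≤n T h = √W÷√-bound {ι T} (log-n n 2≤n) (√-pos (log-n n 2≤n) (log-n>0 n 2≤n))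
    ((fromℕ 2 +ᴿ 0ℝ) *ᴿ fromℕ n) (0≤ι T) (scale≥0 n {0ℝ} (λ _ → ≤-refl))
    (large-case {n} {⟨ W (log-n n 2≤n) ⟩} {⟨ log-n n 2≤n ⟩} T (W-nonNeg (log-n n 2≤n))
      (log-nonNeg (fromℕ n) (1≤fromℕ 2≤n)) (W-spec (log-n n 2≤n)) (log-spec (fromℕ n) (1≤fromℕ 2≤n)) h)

  crude-error : ∀ n → 2 ℕ.≤ n → ℚ
  crude-error n 2≤n = proj₁ (bounded (exp ⟨ W (log-n n 2≤n) ⟩))

  crude-bound : ∀ n (2≤n : 2 ℕ.≤ n) T → T ℕ.≤ n → T ≤√W÷√log[ fromℚ (crude-error n 2≤n) , 2≤n ]
  crude-bound n 2≤n T T≤n = √W÷√-bound {ι T} (log-n n 2≤n) (√-pos (log-n n 2≤n) (log-n>0 n 2≤n))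
    ((fromℕ 2 +ᴿ fromℚ (crude-error n 2≤n)) *ᴿ fromℕ n) (0≤ι T)
    (scale≥0 n {fromℚ (crude-error n 2≤n)} (λ _ → <⇒≤ (proj₁ (proj₂ (bounded (exp ⟨ W (log-n n 2≤n) ⟩))))))
    (crude-case T (exp ⟨ W (log-n n 2≤n) ⟩) (exp-nonNeg {⟨ W (log-n n 2≤n) ⟩} (W-nonNeg (log-n n 2≤n))) T≤n)

  -- The error term

  error : ∀ n → Dec (2 ℕ.≤ n) → Dec (Fits n (twice-square 9)) → ℝ
  error n _         (yes _) = 0ℝ
  error n (no _)    (no _)  = 0ℝ
  error n (yes 2≤n) (no _)  = fromℚ (crude-error n 2≤n)

  -- The decisions are arguments, so that `error` reduces by matching on them. The case `n < 2` is
  -- only a default value.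
  error-bound : ∀ n (2≤n : 2 ℕ.≤ n) (G : Graph n) d f → thc G ≤√W÷√log[ error n d f , 2≤n ]
  error-bound n 2≤n G _ (yes fits) = large-bound n 2≤n (thc G) (throttling-parameter G fits)
  error-bound n 2≤n G (no n<2) (no _) = contradiction 2≤n n<2
  error-bound n 2≤n G (yes 2≤n′) (no _) =
    -- `crude-error` was formed with the proof of `2 ≤ n` found by the decision, which must be
    -- identified with the given one.
    subst (λ p → thc G ≤√W÷√log[ fromℚ (crude-error n p) , 2≤n ]) (ℕP.≤-irrelevant 2≤n 2≤n′)
      (crude-bound n 2≤n (thc G) (thc≤n G))

  error-tends-to-0 : Tends-to-0 λ n → error n (2 ℕP.≤? n) (fits? n (twice-square 9))
  error-tends-to-0 δ δ>0 = proj₁ (fits-large (twice-square 9)) , λ n N≤n →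
    go n (2 ℕP.≤? n) (fits? n (twice-square 9)) (proj₂ (fits-large (twice-square 9)) n N≤n)
    where
    go : ∀ n d f → Fits n (twice-square 9) → fromℚ (- δ) ≤ᴿ error n d f × error n d f ≤ᴿ fromℚ δ
    go n _ (yes _) _ = fromℚ-mono (neg-antimono-≤ (<⇒≤ δ>0)) , fromℚ-mono (<⇒≤ δ>0)
    go n _ (no ¬fits) fits = contradiction fits ¬fits

open import Data.Nat.Base using (_≤_)
open import Data.Nat.Properties using (_≤?_)

theorem3 : ∃ λ (ε : ℕ → ℝ) → Tends-to-0 ε ×
    (∀ n (2≤n : 2 ≤ n) (G : Graph n) →
    fromℕ (thc G) ≤ᴿ
    (fromℕ 2 +ᴿ ε n) *ᴿ fromℕ n *ᴿ ⟨ √ (W (log-n n 2≤n)) ⟩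
    ÷ ⟨ √ (log-n n 2≤n) ⟩ [ √-pos (log-n n 2≤n) (log-n>0 n 2≤n) ])
theorem3 = (λ n → error n (2 ≤? n) (fits? n (twice-square 9))) , error-tends-to-0 ,
  λ n 2≤n G → error-bound n 2≤n G (2 ≤? n) (fits? n (twice-square 9))
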